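{- (i) Let $S\equiv\pm\{1, 4, 7, 10, 11, 13, 17, 18, 19, 24, 25, 27\}\pmod{60}$ and $T\equiv\pm\{1, 3, 7, 10, 11, 16, 17, 18, 23, 24, 25, 29\}\pmod{60}$. Then $p(S,n)=p(T,n-1)$ for all $n\geq 1$. (ii) Let $S\equiv\pm\{1, 5, 6, 7, 8, 10, 11, 12, 17, 19, 21, 23\}\pmod{60}$ and $T\equiv\pm\{1, 5, 6, 7, 9, 10, 11, 12, 13, 17, 28, 29\}\pmod{60}$. Then $p(S,n)=p(T,n)$ for all integers $n\ge0$ with $n\neq 8$. (iii) Let $S\equiv\pm\{6, 7, 8, 9, 10, 11, 12, 13, 19, 23, 25, 29\}\pmod{60}$ and $T\equiv\pm\{1, 6, 10, 12, 13, 17, 19, 21, 23, 25, 28, 29\}\pmod{60}$. Then $p(S,n)=p(T,n-6)$ for all $n\geq 6$. (iv) Let $S\equiv\pm\{3, 4, 5, 10, 11, 13, 17, 18, 19, 23, 24, 29\}\pmod{60}$ and $T\equiv\pm\{1, 5, 7, 10, 13, 16, 18, 19, 23, 24, 27, 29\}\pmod{60}$. Then $p(S,n)=p(T,n-3)$ for all $n\geq 3$.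
   Context: For a set $S$ of positive integers and an integer $n\ge 0$, $p(S,n)$ denotes the number of partitions of $n$ into parts belonging to $S$ (so $p(S,0)=1$). The notation $S\equiv\pm\{r_1,\dots,r_k\}\pmod M$ means that $S$ is the set of all positive integers $n$ such that $n\equiv r_i$ or $n\equiv -r_i\pmod M$ for some $i$. -}

module Defs where

open import Data.Nat using (ℕ; zero; suc; _+_; _*_; _∸_; _≤ᵇ_; _≡ᵇ_)
open import Data.Nat.DivMod using (_%_)
open import Data.Bool using (Bool; true; false; if_then_else_; _∧_; _∨_)
open import Data.List using (List)
open import Data.Bool.ListAction using (any)

PosSet : Set
PosSet = ℕ → Bool

-- S ≡ ± {r₁,…,r_k} (mod M): the positive integers n with n ≡ rᵢ or n ≡ -rᵢ (mod M).
-- (n ≡ -r mod 60  iff  (n + r) % 60 = 0.)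
pmSet60 : List ℕ → PosSet
pmSet60 rs n = (1 ≤ᵇ n) ∧ any (λ r → ((n % 60) ≡ᵇ (r % 60)) ∨ (((n + r) % 60) ≡ᵇ 0)) rs

sumUpTo : ℕ → (ℕ → ℕ) → ℕ
sumUpTo zero f = f zero
sumUpTo (suc m) f = sumUpTo m f + f (suc m)

-- pLe S k n = number of partitions of n into parts belonging to S, all parts ≤ k.
-- A partition with parts ≤ suc k is determined by the multiplicity j of the part
-- suc k (allowed only if suc k ∈ S, with j * suc k ≤ n) together with a partition
-- of n - j * suc k into parts ≤ k.
pLe : PosSet → ℕ → ℕ → ℕ
pLe S zero zero = 1
pLe S zero (suc n) = 0
pLe S (suc k) n =
  if S (suc k)
  then sumUpTo n (λ j → if (j * suc k) ≤ᵇ n then pLe S k (n ∸ j * suc k) else 0)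
  else pLe S k n

-- p(S, n): the number of partitions of n into parts belonging to S (p(S,0) = 1).
-- Parts of a partition of n are ≤ n.
p : PosSet → ℕ → ℕ
p S n = pLe S n n

{-# OPTIONS --safe #-}
module Submission where

-- Write θ₆₀ r = (q^r, q^(60-r); q^60)_∞, so that the generating function of p(S, ·) is the inverse of
-- the product of the θ₆₀ r over the residues r defining S. Each part then amounts to a relation
-- ∏_T θ₆₀ - q^k ∏_S θ₆₀ = q^l ∏_S θ₆₀ ∏_T θ₆₀. After multiplication by suitable factors θ₆₀ r it is
-- the combination X = A + B, Y = A + C, B = C + Z of three instances of Weierstrass' three-term
-- theta relation, two modulo 60 and one modulo 30; in the latter two of the four points carry a
-- minus sign, and (-q^r; q^30) is removed by means of (q^r; q^30)(-q^r; q^30) = (q^2r; q^60).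
-- By the Jacobi triple product, Weierstrass' relation is Plücker's relation between 2 × 2 minors: a
-- product of two theta series is a double sum over ℤ², which splits according to the parity of the
-- difference of the two indices into a(x) a′(y) ± q^d a′(x) a(y).

open import Defs
open import Data.Nat using (ℕ; zero; suc; _+_; _*_; _∸_; _⊓_; _≤_; _<_; z≤n; s≤s; _≤ᵇ_; _≡ᵇ_)
import Data.Nat as ℕ
open import Data.Nat.DivMod using (_%_; [m+kn]%n≡m%n)
import Data.Nat.Properties as ℕₚ
import Data.Nat.Tactic.RingSolver as ℕSolver
open import Data.Integer using (ℤ; +_; -[1+_]; 0ℤ; 1ℤ; ∣_∣; _⊖_)
  renaming (_+_ to _+ᶻ_; _*_ to _*ᶻ_; -_ to -ᶻ_; _-_ to _-ᶻ_)
import Data.Integer.Properties as ℤₚ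
open import Data.Integer.Tactic.RingSolver using (solve-∀)
open import Data.Sign as Sign using (Sign)
import Data.Sign.Properties as Signₚ
open import Data.Bool using (true; false; if_then_else_; _∨_)
open import Data.List using (List; []; _∷_; _++_; map)
open import Data.List.Relation.Unary.All using (All; []; _∷_; all?)
open import Data.List.Relation.Binary.Permutation.Propositional as ↭ using (_↭_; ↭-sym; ↭-trans)
import Data.List.Sort.InsertionSort ℕₚ.≤-decTotalOrder as Sort
import Data.List.Sort.InsertionSort.Properties ℕₚ.≤-decTotalOrder as Sortₚ
open import Data.Product using (_×_; _,_; ∃; proj₁; proj₂)
open import Data.Sum using (inj₁; inj₂)
open import Function using (_∘_)
open import Level using (0ℓ)
open import Relation.Binary.Bundles using (Setoid)
open import Relation.Binary.PropositionalEquality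
  using (_≡_; _≢_; refl; sym; trans; cong; cong₂; subst; subst₂; module ≡-Reasoning)
open import Relation.Nullary using (yes; no; contradiction)
open import Relation.Nullary.Decidable using (True; toWitness; _×-dec_)
open import Relation.Unary using (Decidable)
open import Algebra.Bundles using (CommutativeRing)
import Algebra.Properties.Group as GroupProperties

-- Formal power series over ℤ

-- With P_S and P_T for the two generating functions, dividing the relation of each part by ∏_S ∏_T
-- gives P_S = q^k P_T + q^l. The single coefficient of index l is the exception: n = 0 in (i),
-- (iii), (iv) and n = 8 in (ii). Infinite products, bilateral sums and quotients all have to be
-- controlled. Products and sums are compared modulo q^(N+1) for every N, the triple product being
-- the limit of a finite identity. The factor between theta product and theta series, 1/(q^M;
-- q^M)_∞, is never evaluated: each product in Weierstrass' relation has four theta functions of one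
-- modulus, hence the same fourth power of it. Division becomes cancellation of a series with
-- constant term 1, and differences are written as A + B = C, which a solver for semirings can
-- handle. Minors appear because two theta series of equal modulus have equal quadratic
-- coefficients, so that their joint quadratic form stays diagonal in the sum and the difference of
-- the indices. After Weierstrass' relation, every check on the residues is an evaluation on finite
-- lists.

Series : Set
Series = ℕ → ℤ

infix 4 _≈_ _≈[_]_
infixl 6 _⊕_
infixl 7 _⊛_

-- A record rather than a bare function type, so that unification recovers both series from the type
-- of an equation.
record _≈_ (a b : Series) : Set where
  constructor coeffs
  field coeff : ∀ n → a n ≡ b n
open _≈_

-- Congruence modulo q^(N+1).
record _≈[_]_ (a : Series) (N : ℕ) (b : Series) : Set where
  constructor coeffs≤
  field coeff≤ : ∀ n → n ≤ N → a n ≡ b n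
open _≈[_]_

𝟘 𝟙 : Series
𝟘 _ = 0ℤ
𝟙 zero    = 1ℤ
𝟙 (suc _) = 0ℤ

-- `_⊛_` is the Cauchy product, written through a = a(0) + q (a ∘ suc): no inner sum appears, and
-- the ring laws become inductions on the coefficient.
_⊕_ _⊛_ : Series → Series → Series
(a ⊕ b) n = a n +ᶻ b n
(a ⊛ b) zero    = a 0 *ᶻ b 0
(a ⊛ b) (suc n) = a 0 *ᶻ b (suc n) +ᶻ ((a ∘ suc) ⊛ b) n

⊝_ : Series → Series
(⊝ a) n = -ᶻ a n

≈-refl : ∀ {a} → a ≈ a
≈-refl = coeffs λ _ → refl

≈-sym : ∀ {a b} → a ≈ b → b ≈ a
≈-sym p = coeffs λ n → sym (coeff p n)

≈-trans : ∀ {a b c} → a ≈ b → b ≈ c → a ≈ c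
≈-trans p q = coeffs λ n → trans (coeff p n) (coeff q n)

≡⇒≈ : ∀ {a b} → a ≡ b → a ≈ b
≡⇒≈ refl = ≈-refl

≈[]-refl : ∀ {a N} → a ≈[ N ] a
≈[]-refl = coeffs≤ λ _ _ → refl

≈[]-sym : ∀ {a b N} → a ≈[ N ] b → b ≈[ N ] a
≈[]-sym p = coeffs≤ λ n l → sym (coeff≤ p n l)

≈[]-trans : ∀ {a b c N} → a ≈[ N ] b → b ≈[ N ] c → a ≈[ N ] c
≈[]-trans p q = coeffs≤ λ n l → trans (coeff≤ p n l) (coeff≤ q n l)

≈⇒≈[] : ∀ {a b} → a ≈ b → ∀ {N} → a ≈[ N ] b
≈⇒≈[] p = coeffs≤ λ n _ → coeff p n

≈[]⇒≈ : ∀ {a b} → (∀ N → a ≈[ N ] b) → a ≈ b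
≈[]⇒≈ p = coeffs λ n → coeff≤ (p n) n ℕₚ.≤-refl

≈[]-mono : ∀ {a b N K} → K ≤ N → a ≈[ N ] b → a ≈[ K ] b
≈[]-mono l p = coeffs≤ λ n k → coeff≤ p n (ℕₚ.≤-trans k l)

⊕-cong : ∀ {a a′ b b′} → a ≈ a′ → b ≈ b′ → a ⊕ b ≈ a′ ⊕ b′
⊕-cong p q = coeffs λ n → cong₂ _+ᶻ_ (coeff p n) (coeff q n)

⊕-cong[] : ∀ {a a′ b b′ N} → a ≈[ N ] a′ → b ≈[ N ] b′ → a ⊕ b ≈[ N ] a′ ⊕ b′
⊕-cong[] p q = coeffs≤ λ n l → cong₂ _+ᶻ_ (coeff≤ p n l) (coeff≤ q n l)

⊛-cong[] : ∀ {a a′ b b′ N} → a ≈[ N ] a′ → b ≈[ N ] b′ → a ⊛ b ≈[ N ] a′ ⊛ b′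
⊛-cong[] {N = N} p q = coeffs≤ λ n l → go n N (coeff≤ p) (coeff≤ q) l
  where
  go : ∀ {a a′ b b′} n N → (∀ i → i ≤ N → a i ≡ a′ i) → (∀ i → i ≤ N → b i ≡ b′ i) →
       n ≤ N → (a ⊛ b) n ≡ (a′ ⊛ b′) n
  go zero    N       p q l = cong₂ _*ᶻ_ (p 0 z≤n) (q 0 z≤n)
  go (suc n) (suc N) p q (s≤s l) = cong₂ _+ᶻ_
    (cong₂ _*ᶻ_ (p 0 z≤n) (q (suc n) (s≤s l)))
    (go n N (λ i k → p (suc i) (s≤s k)) (λ i k → q i (ℕₚ.m≤n⇒m≤1+n k)) l)

⊛-cong : ∀ {a a′ b b′} → a ≈ a′ → b ≈ b′ → a ⊛ b ≈ a′ ⊛ b′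
⊛-cong p q = ≈[]⇒≈ λ N → ⊛-cong[] (≈⇒≈[] p) (≈⇒≈[] q)

⊛-distribʳ : ∀ c a b n → ((a ⊕ b) ⊛ c) n ≡ (a ⊛ c) n +ᶻ (b ⊛ c) n
⊛-distribʳ c a b zero    = ℤₚ.*-distribʳ-+ (c 0) (a 0) (b 0)
⊛-distribʳ c a b (suc n) =
  trans (cong ((a 0 +ᶻ b 0) *ᶻ c (suc n) +ᶻ_) (⊛-distribʳ c (a ∘ suc) (b ∘ suc) n))
        (arith (a 0) (b 0) (c (suc n)) _ _)
  where
  arith : ∀ x y z u v → (x +ᶻ y) *ᶻ z +ᶻ (u +ᶻ v) ≡ x *ᶻ z +ᶻ u +ᶻ (y *ᶻ z +ᶻ v)
  arith = solve-∀

scale-⊛ : ∀ x a b n → ((λ i → x *ᶻ a i) ⊛ b) n ≡ x *ᶻ (a ⊛ b) n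
scale-⊛ x a b zero    = ℤₚ.*-assoc x (a 0) (b 0)
scale-⊛ x a b (suc n) =
  trans (cong (x *ᶻ a 0 *ᶻ b (suc n) +ᶻ_) (scale-⊛ x (a ∘ suc) b n))
        (arith x (a 0) (b (suc n)) _)
  where
  arith : ∀ x y z u → x *ᶻ y *ᶻ z +ᶻ x *ᶻ u ≡ x *ᶻ (y *ᶻ z +ᶻ u)
  arith = solve-∀

⊛-assoc : ∀ a b c n → ((a ⊛ b) ⊛ c) n ≡ (a ⊛ (b ⊛ c)) n
⊛-assoc a b c zero    = ℤₚ.*-assoc (a 0) (b 0) (c 0)
⊛-assoc a b c (suc n) = begin
  a 0 *ᶻ b 0 *ᶻ c (suc n) +ᶻ (((λ i → a 0 *ᶻ b (suc i)) ⊕ ((a ∘ suc) ⊛ b)) ⊛ c) n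
    ≡⟨ cong (a 0 *ᶻ b 0 *ᶻ c (suc n) +ᶻ_)
         (⊛-distribʳ c (λ i → a 0 *ᶻ b (suc i)) ((a ∘ suc) ⊛ b) n) ⟩
  a 0 *ᶻ b 0 *ᶻ c (suc n) +ᶻ
    (((λ i → a 0 *ᶻ b (suc i)) ⊛ c) n +ᶻ (((a ∘ suc) ⊛ b) ⊛ c) n)
    ≡⟨ cong₂ (λ u v → a 0 *ᶻ b 0 *ᶻ c (suc n) +ᶻ (u +ᶻ v))
         (scale-⊛ (a 0) (b ∘ suc) c n) (⊛-assoc (a ∘ suc) b c n) ⟩
  a 0 *ᶻ b 0 *ᶻ c (suc n) +ᶻ
    (a 0 *ᶻ ((b ∘ suc) ⊛ c) n +ᶻ ((a ∘ suc) ⊛ (b ⊛ c)) n)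
    ≡⟨ arith (a 0) (b 0) (c (suc n)) _ _ ⟩
  a 0 *ᶻ (b 0 *ᶻ c (suc n) +ᶻ ((b ∘ suc) ⊛ c) n) +ᶻ ((a ∘ suc) ⊛ (b ⊛ c)) n ∎
  where
  open ≡-Reasoning
  arith : ∀ x y z u v → x *ᶻ y *ᶻ z +ᶻ (x *ᶻ u +ᶻ v) ≡ x *ᶻ (y *ᶻ z +ᶻ u) +ᶻ v
  arith = solve-∀

-- The mirror image of the defining recursion, peeling the right factor; the two together give
-- commutativity.
⊛-suc-right : ∀ a b n → (a ⊛ b) (suc n) ≡ a (suc n) *ᶻ b 0 +ᶻ (a ⊛ (b ∘ suc)) n
⊛-suc-right a b zero    = ℤₚ.+-comm (a 0 *ᶻ b 1) (a 1 *ᶻ b 0)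
⊛-suc-right a b (suc n) =
  trans (cong (a 0 *ᶻ b (suc (suc n)) +ᶻ_) (⊛-suc-right (a ∘ suc) b n))
        (arith (a 0 *ᶻ b (suc (suc n))) (a (suc (suc n)) *ᶻ b 0) _)
  where
  arith : ∀ x y z → x +ᶻ (y +ᶻ z) ≡ y +ᶻ (x +ᶻ z)
  arith = solve-∀

⊛-comm : ∀ a b n → (a ⊛ b) n ≡ (b ⊛ a) n
⊛-comm a b zero    = ℤₚ.*-comm (a 0) (b 0)
⊛-comm a b (suc n) = trans
  (cong₂ _+ᶻ_ (ℤₚ.*-comm (a 0) (b (suc n))) (⊛-comm (a ∘ suc) b n))
  (sym (⊛-suc-right b a n))

𝟘-⊛ : ∀ a n → (𝟘 ⊛ a) n ≡ 0ℤ
𝟘-⊛ a zero    = refl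
𝟘-⊛ a (suc n) = trans (ℤₚ.+-identityˡ _) (𝟘-⊛ a n)

𝟙-⊛ : ∀ a n → (𝟙 ⊛ a) n ≡ a n
𝟙-⊛ a zero    = ℤₚ.*-identityˡ (a 0)
𝟙-⊛ a (suc n) = trans (cong₂ _+ᶻ_ (ℤₚ.*-identityˡ (a (suc n))) (𝟘-⊛ a n)) (ℤₚ.+-identityʳ _)

seriesRing : CommutativeRing 0ℓ 0ℓ
seriesRing = record
  { Carrier = Series ; _≈_ = _≈_ ; _+_ = _⊕_ ; _*_ = _⊛_ ; -_ = ⊝_ ; 0# = 𝟘 ; 1# = 𝟙
  ; isCommutativeRing = record
    { isRing = record
      { +-isAbelianGroup = record
        { isGroup = record
          { isMonoid = record
            { isSemigroup = record
              { isMagma = record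
                { isEquivalence = record { refl = ≈-refl ; sym = ≈-sym ; trans = ≈-trans }
                ; ∙-cong = ⊕-cong }
              ; assoc = λ a b c → coeffs λ n → ℤₚ.+-assoc (a n) (b n) (c n) }
            ; identity = (λ a → coeffs λ n → ℤₚ.+-identityˡ (a n))
                       , (λ a → coeffs λ n → ℤₚ.+-identityʳ (a n)) }
          ; inverse = (λ a → coeffs λ n → ℤₚ.+-inverseˡ (a n))
                    , (λ a → coeffs λ n → ℤₚ.+-inverseʳ (a n))
          ; ⁻¹-cong = λ p → coeffs λ n → cong -ᶻ_ (coeff p n) }
        ; comm = λ a b → coeffs λ n → ℤₚ.+-comm (a n) (b n) }
      ; *-cong = ⊛-cong
      ; *-assoc = λ a b c → coeffs (⊛-assoc a b c)
      ; *-identity = (λ a → coeffs (𝟙-⊛ a))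
                   , (λ a → coeffs λ n → trans (⊛-comm a 𝟙 n) (𝟙-⊛ a n))
      ; distrib = (λ a b c → coeffs λ n → trans (⊛-comm a (b ⊕ c) n)
                    (trans (⊛-distribʳ a b c n) (cong₂ _+ᶻ_ (⊛-comm b a n) (⊛-comm c a n))))
                , (λ a b c → coeffs (⊛-distribʳ a b c)) }
    ; *-comm = λ a b → coeffs (⊛-comm a b) } }

-- The constant term forces d(0) = 0; then `a ⊛ (d ∘ suc)` vanishes as well and the argument
-- descends. This takes the place of inverting a series.
unit-cancel-zero : ∀ a d → a 0 ≡ 1ℤ → a ⊛ d ≈ 𝟘 → d ≈ 𝟘
unit-cancel-zero a d a₀ p = coeffs λ n → go n d (coeff p)
  where
  head-zero : ∀ d → (∀ n → (a ⊛ d) n ≡ 0ℤ) → d 0 ≡ 0ℤ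
  head-zero d p = trans (sym (ℤₚ.*-identityˡ (d 0))) (trans (cong (_*ᶻ d 0) (sym a₀)) (p 0))
  go : ∀ n d → (∀ n → (a ⊛ d) n ≡ 0ℤ) → d n ≡ 0ℤ
  go zero    d p = head-zero d p
  go (suc n) d p = go n (d ∘ suc) λ m → begin
    (a ⊛ (d ∘ suc)) m                         ≡⟨ ℤₚ.+-identityˡ _ ⟨
    0ℤ +ᶻ (a ⊛ (d ∘ suc)) m                   ≡⟨ cong (_+ᶻ (a ⊛ (d ∘ suc)) m) (ℤₚ.*-zeroʳ (a (suc m))) ⟨
    a (suc m) *ᶻ 0ℤ +ᶻ (a ⊛ (d ∘ suc)) m      ≡⟨ cong (λ z → a (suc m) *ᶻ z +ᶻ (a ⊛ (d ∘ suc)) m) (head-zero d p) ⟨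
    a (suc m) *ᶻ d 0 +ᶻ (a ⊛ (d ∘ suc)) m     ≡⟨ ⊛-suc-right a d m ⟨
    (a ⊛ d) (suc m)                           ≡⟨ p (suc m) ⟩
    0ℤ ∎
    where open ≡-Reasoning

unit-cancel : ∀ a {b c} → a 0 ≡ 1ℤ → a ⊛ b ≈ a ⊛ c → b ≈ c
unit-cancel a {b} {c} a₀ p = coeffs λ n → ℤₚ.i-j≡0⇒i≡j (b n) (c n) (coeff diff n)
  where
  open CommutativeRing seriesRing using (distribˡ; -‿inverseʳ; setoid; ring)
  open import Algebra.Properties.Ring ring using (-‿distribʳ-*)
  open import Relation.Binary.Reasoning.Setoid setoid
  diff : b ⊕ (⊝ c) ≈ 𝟘
  diff = unit-cancel-zero a (b ⊕ (⊝ c)) a₀ (begin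
    a ⊛ (b ⊕ (⊝ c))         ≈⟨ distribˡ a b (⊝ c) ⟩
    a ⊛ b ⊕ a ⊛ (⊝ c)       ≈⟨ ⊕-cong p (≈-sym (-‿distribʳ-* a c)) ⟩
    a ⊛ c ⊕ (⊝ (a ⊛ c))     ≈⟨ -‿inverseʳ (a ⊛ c) ⟩
    𝟘 ∎)

open CommutativeRing seriesRing using (setoid; *-identityˡ; *-identityʳ; +-identityˡ; +-identityʳ;
  zeroˡ; zeroʳ; *-assoc; *-comm; +-comm; distribˡ; distribʳ)
open import Algebra.Solver.Ring.NaturalCoefficients.Default
  (CommutativeRing.commutativeSemiring seriesRing) using (solve; _:=_; _:+_; _:*_; con)

module ≈-Reasoning where
  open import Relation.Binary.Reasoning.Setoid setoid public

truncated : ℕ → Setoid _ _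
truncated N = record { Carrier = Series ; _≈_ = _≈[ N ]_
  ; isEquivalence = record { refl = ≈[]-refl ; sym = ≈[]-sym ; trans = ≈[]-trans } }

-- Signed monomials

shift : Series → Series
shift a zero    = 0ℤ
shift a (suc n) = a n

infix 8 q^_
q^_ : ℕ → Series
q^ zero  = 𝟙
q^ suc e = shift (q^ e)

shift-⊛ : ∀ a b n → (shift a ⊛ b) n ≡ shift (a ⊛ b) n
shift-⊛ a b zero    = refl
shift-⊛ a b (suc n) = ℤₚ.+-identityˡ ((a ⊛ b) n)

q^-+ : ∀ d e → q^ (d + e) ≈ q^ d ⊛ q^ e
q^-+ zero    e = ≈-sym (*-identityˡ (q^ e))
q^-+ (suc d) e = coeffs λ
  { zero    → refl
  ; (suc n) → trans (coeff (q^-+ d e) n) (sym (shift-⊛ (q^ d) (q^ e) (suc n))) }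

q^-⊛-< : ∀ e a {n} → n < e → (q^ e ⊛ a) n ≡ 0ℤ
q^-⊛-< (suc e) a {zero}  l       = refl
q^-⊛-< (suc e) a {suc n} (s≤s l) = trans (shift-⊛ (q^ e) a (suc n)) (q^-⊛-< e a l)

q^-⊛-≈[] : ∀ e a {N} → N < e → q^ e ⊛ a ≈[ N ] 𝟘
q^-⊛-≈[] e a l = coeffs≤ λ n k → q^-⊛-< e a (ℕₚ.≤-<-trans k l)

sgn : Sign → Series
sgn Sign.+ = 𝟙
sgn Sign.- = ⊝ 𝟙

sgn-* : ∀ s t → sgn (s Sign.* t) ≈ sgn s ⊛ sgn t
sgn-* Sign.+ t = ≈-sym (*-identityˡ (sgn t))
sgn-* Sign.- Sign.+ = ≈-sym (*-identityʳ (⊝ 𝟙))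
sgn-* Sign.- Sign.- = coeffs λ { zero → refl ; (suc n) → sym (go n) }
  where
  go : ∀ n → ((⊝ 𝟙) ⊛ (⊝ 𝟙)) (suc n) ≡ 0ℤ
  go n = trans (ℤₚ.+-identityˡ _) (cancel n)
    where
    cancel : ∀ n → ((λ i → -ᶻ 𝟙 (suc i)) ⊛ (⊝ 𝟙)) n ≡ 0ℤ
    cancel zero    = refl
    cancel (suc n) = trans (ℤₚ.+-identityˡ _) (cancel n)

monomial : Sign → ℕ → Series
monomial s e = sgn s ⊛ q^ e

monomial-⊛ : ∀ s t d e → monomial s d ⊛ monomial t e ≈ monomial (s Sign.* t) (d + e)
monomial-⊛ s t d e = begin
  (sgn s ⊛ q^ d) ⊛ (sgn t ⊛ q^ e)
    ≈⟨ solve 4 (λ a b c d → (a :* b) :* (c :* d) := (a :* c) :* (b :* d)) ≈-refl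
         (sgn s) (q^ d) (sgn t) (q^ e) ⟩
  (sgn s ⊛ sgn t) ⊛ (q^ d ⊛ q^ e)
    ≈⟨ ⊛-cong (sgn-* s t) (q^-+ d e) ⟨
  monomial (s Sign.* t) (d + e) ∎
  where open ≈-Reasoning

monomial-≈[] : ∀ s e {N} → N < e → monomial s e ≈[ N ] 𝟘
monomial-≈[] s e l = ≈[]-trans (≈⇒≈[] (*-comm (sgn s) (q^ e))) (q^-⊛-≈[] e (sgn s) l)

-- Infinite products

∏< : (ℕ → Series) → ℕ → Series
∏< f zero    = 𝟙
∏< f (suc n) = ∏< f n ⊛ f n

∏<-cong : ∀ {f g} → (∀ k → f k ≈ g k) → ∀ n → ∏< f n ≈ ∏< g n
∏<-cong p zero    = ≈-refl
∏<-cong p (suc n) = ⊛-cong (∏<-cong p n) (p n)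

∏<-⊛ : ∀ f g n → ∏< (λ k → f k ⊛ g k) n ≈ ∏< f n ⊛ ∏< g n
∏<-⊛ f g zero    = ≈-sym (*-identityˡ 𝟙)
∏<-⊛ f g (suc n) = ≈-trans (⊛-cong (∏<-⊛ f g n) ≈-refl)
  (solve 4 (λ a b c d → (a :* b) :* (c :* d) := (a :* c) :* (b :* d)) ≈-refl
    (∏< f n) (∏< g n) (f n) (g n))

double : ℕ → ℕ
double n = n + n

∏<-pairs : ∀ f n → ∏< f (double n) ≈ ∏< (λ k → f (double k) ⊛ f (suc (double k))) n
∏<-pairs f zero    = ≈-refl
∏<-pairs f (suc n) rewrite ℕₚ.+-suc n n =
  ≈-trans (*-assoc _ _ _) (⊛-cong (∏<-pairs f n) ≈-refl)

-- The coefficient of qⁿ in the infinite product is read off the first n factors,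
-- which is legitimate for the following families.
Tame : (ℕ → Series) → Set
Tame f = ∀ k → f k ≈[ k ] 𝟙

∏∞ : (ℕ → Series) → Series
∏∞ f n = ∏< f n n

-- Factors of index at least n are 1 modulo q^(n+1) and leave the coefficients up to n alone.
∏<-stable : ∀ {f} → Tame f → ∀ n d → ∏< f (d + n) ≈[ n ] ∏< f n
∏<-stable t n zero    = ≈[]-refl
∏<-stable {f} t n (suc d) = begin
  ∏< f (d + n) ⊛ f (d + n) ≈⟨ ⊛-cong[] ≈[]-refl (≈[]-mono (ℕₚ.m≤n+m n d) (t (d + n))) ⟩
  ∏< f (d + n) ⊛ 𝟙         ≈⟨ ≈⇒≈[] (*-identityʳ _) ⟩
  ∏< f (d + n)             ≈⟨ ∏<-stable t n d ⟩
  ∏< f n ∎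
  where open import Relation.Binary.Reasoning.Setoid (truncated n)

∏∞-approx : ∀ {f} → Tame f → ∀ {n m} → n ≤ m → ∏∞ f ≈[ n ] ∏< f m
∏∞-approx {f} t {n} {m} l = coeffs≤ λ i k →
  sym (subst (λ j → ∏< f j i ≡ ∏< f i i) (ℕₚ.m∸n+n≡m (ℕₚ.≤-trans k l))
    (coeff≤ (∏<-stable t i (m ∸ i)) i ℕₚ.≤-refl))

∏∞-cong : ∀ {f g} → (∀ k → f k ≈ g k) → ∏∞ f ≈ ∏∞ g
∏∞-cong p = coeffs λ n → coeff (∏<-cong p n) n

Tame-⊛ : ∀ {f g} → Tame f → Tame g → Tame (λ k → f k ⊛ g k)
Tame-⊛ s t k = ≈[]-trans (⊛-cong[] (s k) (t k)) (≈⇒≈[] (*-identityˡ 𝟙))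

∏∞-⊛ : ∀ {f g} → Tame f → Tame g → ∏∞ (λ k → f k ⊛ g k) ≈ ∏∞ f ⊛ ∏∞ g
∏∞-⊛ {f} {g} s t = coeffs λ n → trans (coeff (∏<-⊛ f g n) n)
  (coeff≤ (⊛-cong[] (≈[]-sym (∏∞-approx s ℕₚ.≤-refl)) (≈[]-sym (∏∞-approx t ℕₚ.≤-refl)))
    n ℕₚ.≤-refl)

∏∞-pairs : ∀ {f} → Tame f → ∏∞ f ≈ ∏∞ (λ k → f (double k) ⊛ f (suc (double k)))
∏∞-pairs {f} t = coeffs λ n → trans
  (coeff≤ (∏∞-approx t (ℕₚ.m≤m+n n n)) n ℕₚ.≤-refl) (coeff (∏<-pairs f n) n)

-- Theta products: dissection and conjugation

factor : Sign → ℕ → Series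
factor s e = 𝟙 ⊕ monomial s e

Tame-factor : ∀ {s} {e : ℕ → ℕ} → (∀ k → k < e k) → Tame (λ k → factor s (e k))
Tame-factor {s} {e} l k = ≈[]-trans
  (⊕-cong[] {a = 𝟙} ≈[]-refl (monomial-≈[] s (e k) (l k))) (≈⇒≈[] (+-identityʳ 𝟙))

-- θ s α β = (-s q^α, -s q^β; q^(α+β))_∞
θ-block : Sign → ℕ → ℕ → ℕ → Series
θ-block s α β k = factor s (k * (α + β) + α) ⊛ factor s (k * (α + β) + β)

θ : Sign → ℕ → ℕ → Series
θ s α β = ∏∞ (θ-block s α β)

progression-< : ∀ {r} M → 1 ≤ r → r ≤ M → ∀ k → k < k * M + r
progression-< {r} M r≥1 r≤M k = ℕₚ.≤-<-trans
  (subst (_≤ k * M) (ℕₚ.*-identityʳ k) (ℕₚ.*-monoʳ-≤ k (ℕₚ.≤-trans r≥1 r≤M)))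
  (ℕₚ.m<m+n (k * M) r≥1)

Tame-θ : ∀ s {α β} → 1 ≤ α → 1 ≤ β → Tame (θ-block s α β)
Tame-θ s {α} {β} a b = Tame-⊛
  (Tame-factor {s} (progression-< (α + β) a (ℕₚ.m≤m+n α β)))
  (Tame-factor {s} (progression-< (α + β) b (ℕₚ.m≤n+m β α)))

θ-sym : ∀ s α β → θ s α β ≈ θ s β α
θ-sym s α β = ∏∞-cong λ k → ≈-trans (*-comm _ _)
  (⊛-cong (exps k β) (exps k α))
  where
  exps : ∀ k e → factor s (k * (α + β) + e) ≈ factor s (k * (β + α) + e)
  exps k e rewrite ℕₚ.+-comm α β = ≈-refl

-- Merging blocks of even and odd index doubles the modulus to 2 (α + β). There the residues α, β
-- and their translates 2α + β, α + 2β pair off as complements: α with α + 2β, and β with 2α + β.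
θ-dissect : ∀ s {α β} → 1 ≤ α → 1 ≤ β →
  θ s α β ≈ θ s α (α + double β) ⊛ θ s β (β + double α)
θ-dissect s {α} {β} a b = begin
  θ s α β ≈⟨ ∏∞-pairs (Tame-θ s a b) ⟩
  ∏∞ (λ k → θ-block s α β (double k) ⊛ θ-block s α β (suc (double k)))
    ≈⟨ ∏∞-cong step ⟩
  ∏∞ (λ k → θ-block s α (α + double β) k ⊛ θ-block s β (β + double α) k)
    ≈⟨ ∏∞-⊛ (Tame-θ s a (ℕₚ.≤-trans a (ℕₚ.m≤m+n α _))) (Tame-θ s b (ℕₚ.≤-trans b (ℕₚ.m≤m+n β _))) ⟩
  θ s α (α + double β) ⊛ θ s β (β + double α) ∎
  where
  open ≈-Reasoning
  ≡-factor : ∀ {d e} → d ≡ e → factor s d ≈ factor s e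
  ≡-factor refl = ≈-refl
  e₁ : ∀ k α β → (k + k) * (α + β) + α ≡ k * (α + (α + (β + β))) + α
  e₁ = ℕSolver.solve-∀
  e₂ : ∀ k α β → (k + k) * (α + β) + β ≡ k * (β + (β + (α + α))) + β
  e₂ = ℕSolver.solve-∀
  e₃ : ∀ k α β → suc (k + k) * (α + β) + α ≡ k * (β + (β + (α + α))) + (β + (α + α))
  e₃ = ℕSolver.solve-∀
  e₄ : ∀ k α β → suc (k + k) * (α + β) + β ≡ k * (α + (α + (β + β))) + (α + (β + β))
  e₄ = ℕSolver.solve-∀
  step : ∀ k → θ-block s α β (double k) ⊛ θ-block s α β (suc (double k)) ≈
               θ-block s α (α + double β) k ⊛ θ-block s β (β + double α) k
  step k = ≈-trans
    (⊛-cong (⊛-cong (≡-factor (e₁ k α β)) (≡-factor (e₂ k α β)))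
            (⊛-cong (≡-factor (e₃ k α β)) (≡-factor (e₄ k α β))))
    (solve 4 (λ a b c d → (a :* b) :* (c :* d) := (a :* d) :* (b :* c)) ≈-refl
      (factor s (k * (α + (α + double β)) + α)) (factor s (k * (β + (β + double α)) + β))
      (factor s (k * (β + (β + double α)) + (β + double α)))
      (factor s (k * (α + (α + double β)) + (α + double β))))

factor-conjugates : ∀ e → factor Sign.+ e ⊛ factor Sign.- e ≈ factor Sign.- (double e)
factor-conjugates e = begin
  (𝟙 ⊕ 𝟙 ⊛ q^ e) ⊛ (𝟙 ⊕ m ⊛ q^ e)
    -- The semiring solver treats -1 as an opaque `m`; the cross terms are therefore collected into
    -- a multiple of 1 + m, which is then cancelled by hand.
    ≈⟨ solve 3 (λ o m x → (o :+ o :* x) :* (o :+ m :* x) :=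
         o :* o :+ o :* m :* (x :* x) :+ (o :* o :+ o :* m) :* x) ≈-refl 𝟙 m (q^ e) ⟩
  𝟙 ⊛ 𝟙 ⊕ 𝟙 ⊛ m ⊛ (q^ e ⊛ q^ e) ⊕ (𝟙 ⊛ 𝟙 ⊕ 𝟙 ⊛ m) ⊛ q^ e
    ≈⟨ ⊕-cong (⊕-cong (*-identityˡ 𝟙) (⊛-cong (*-identityˡ m) (≈-sym (q^-+ e e))))
              (⊛-cong (≈-trans (⊕-cong (*-identityˡ 𝟙) (*-identityˡ m)) (-‿inverseʳ 𝟙)) ≈-refl) ⟩
  𝟙 ⊕ m ⊛ q^ (e + e) ⊕ 𝟘 ⊛ q^ e
    ≈⟨ ≈-trans (⊕-cong {a = 𝟙 ⊕ m ⊛ q^ (e + e)} ≈-refl (zeroˡ (q^ e))) (+-identityʳ _) ⟩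
  𝟙 ⊕ m ⊛ q^ (e + e) ∎
  where
  open ≈-Reasoning
  open CommutativeRing seriesRing using (-‿inverseʳ)
  m = ⊝ 𝟙

θ-conjugates : ∀ {α β} → 1 ≤ α → 1 ≤ β →
  θ Sign.+ α β ⊛ θ Sign.- α β ≈ θ Sign.- (double α) (double β)
θ-conjugates {α} {β} a b = begin
  θ Sign.+ α β ⊛ θ Sign.- α β ≈⟨ ∏∞-⊛ (Tame-θ Sign.+ a b) (Tame-θ Sign.- a b) ⟨
  ∏∞ (λ k → θ-block Sign.+ α β k ⊛ θ-block Sign.- α β k) ≈⟨ ∏∞-cong step ⟩
  θ Sign.- (double α) (double β) ∎
  where
  open ≈-Reasoning
  ≡-factor : ∀ {d e} → d ≡ e → factor Sign.- d ≈ factor Sign.- e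
  ≡-factor refl = ≈-refl
  e₁ : ∀ k α β γ → (k * (α + β) + γ) + (k * (α + β) + γ) ≡ k * ((α + α) + (β + β)) + (γ + γ)
  e₁ = ℕSolver.solve-∀
  step : ∀ k → θ-block Sign.+ α β k ⊛ θ-block Sign.- α β k ≈
               θ-block Sign.- (double α) (double β) k
  step k = ≈-trans
    (solve 4 (λ a b c d → (a :* b) :* (c :* d) := (a :* c) :* (b :* d)) ≈-refl
      (factor Sign.+ x) (factor Sign.+ y) (factor Sign.- x) (factor Sign.- y))
    (⊛-cong (≈-trans (factor-conjugates x) (≡-factor (e₁ k α β α)))
            (≈-trans (factor-conjugates y) (≡-factor (e₁ k α β β))))
    where
    x = k * (α + β) + α
    y = k * (α + β) + β

-- Gaussian binomials and sums over antidiagonals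

⊕-congˡ : ∀ a {b c} → b ≈ c → a ⊕ b ≈ a ⊕ c
⊕-congˡ a = ⊕-cong {a = a} ≈-refl

⊛-congˡ : ∀ a {b c} → b ≈ c → a ⊛ b ≈ a ⊛ c
⊛-congˡ a = ⊛-cong {a = a} ≈-refl

-- The Gaussian binomial [j + k, j] in base q^M.
binom : ℕ → ℕ → ℕ → Series
binom M zero    k       = 𝟙
binom M (suc j) zero    = 𝟙
binom M (suc j) (suc k) = binom M (suc j) k ⊕ q^ (suc k * M) ⊛ binom M j (suc k)

q^-multiples : ∀ M b c → q^ ((b + c) * M) ≈ q^ (b * M) ⊛ q^ (c * M)
q^-multiples M b c rewrite ℕₚ.*-distribʳ-+ M b c = q^-+ (b * M) (c * M)

binom-zeroʳ : ∀ M j → binom M j 0 ≡ 𝟙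
binom-zeroʳ M zero    = refl
binom-zeroʳ M (suc j) = refl

-- The other q-Pascal rule. The defining one serves to add a factor of the α-progression to the
-- finite triple product, this one a factor of the β-progression. In the inductive step both rules
-- reach `binom M (suc j) (suc k)` with the same total shift j + k + 3.
binom-pascal : ∀ M j k →
  binom M (suc j) (suc k) ≈ binom M j (suc k) ⊕ q^ (suc j * M) ⊛ binom M (suc j) k
binom-pascal M zero zero = ≈-refl
binom-pascal M zero (suc k) = begin
  binom M 1 (suc k) ⊕ q^ (suc (suc k) * M) ⊛ 𝟙
    ≈⟨ ⊕-cong (binom-pascal M zero k) (⊛-cong (q^-multiples M 1 (suc k)) ≈-refl) ⟩
  𝟙 ⊕ x ⊛ b ⊕ x ⊛ y ⊛ 𝟙
    ≈⟨ solve 4 (λ o x b y → o :+ x :* b :+ x :* y :* o := o :+ x :* (b :+ y :* o)) ≈-refl 𝟙 x b y ⟩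
  𝟙 ⊕ x ⊛ (b ⊕ y ⊛ 𝟙) ∎
  where
  open ≈-Reasoning
  b = binom M 1 k
  x = q^ (1 * M)
  y = q^ (suc k * M)
binom-pascal M (suc j) zero = begin
  𝟙 ⊕ q^ (1 * M) ⊛ binom M (suc j) 1
    ≈⟨ ⊕-congˡ 𝟙 (⊛-congˡ x (binom-pascal M j zero)) ⟩
  𝟙 ⊕ x ⊛ (b ⊕ y ⊛ 𝟙)
    ≈⟨ solve 4 (λ o x b y → o :+ x :* (b :+ y :* o) := o :+ x :* b :+ x :* y :* o) ≈-refl 𝟙 x b y ⟩
  𝟙 ⊕ x ⊛ b ⊕ x ⊛ y ⊛ 𝟙
    ≈⟨ ⊕-congˡ (𝟙 ⊕ x ⊛ b) (⊛-cong (q^-multiples M 1 (suc j)) ≈-refl) ⟨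
  𝟙 ⊕ x ⊛ b ⊕ q^ (suc (suc j) * M) ⊛ 𝟙 ∎
  where
  open ≈-Reasoning
  b = binom M j 1
  x = q^ (1 * M)
  y = q^ (suc j * M)
binom-pascal M (suc j) (suc k) = begin
  binom M (suc (suc j)) (suc k) ⊕ q^ (suc (suc k) * M) ⊛ binom M (suc j) (suc (suc k))
    ≈⟨ ⊕-cong (binom-pascal M (suc j) k) (⊛-congˡ x (binom-pascal M j (suc k))) ⟩
  (b ⊕ z ⊛ c) ⊕ x ⊛ (d ⊕ w ⊛ b)
    ≈⟨ solve 6 (λ b z c x d w → (b :+ z :* c) :+ x :* (d :+ w :* b) :=
         (b :+ x :* d) :+ (z :* c :+ (x :* w) :* b)) ≈-refl b z c x d w ⟩
  (b ⊕ x ⊛ d) ⊕ (z ⊛ c ⊕ (x ⊛ w) ⊛ b)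
    ≈⟨ ⊕-congˡ (b ⊕ x ⊛ d) (⊕-congˡ (z ⊛ c) (⊛-cong powers ≈-refl)) ⟩
  (b ⊕ x ⊛ d) ⊕ (z ⊛ c ⊕ (z ⊛ y) ⊛ b)
    ≈⟨ solve 6 (λ b z c x d y → (b :+ x :* d) :+ (z :* c :+ (z :* y) :* b) :=
         (b :+ x :* d) :+ z :* (c :+ y :* b)) ≈-refl b z c x d y ⟩
  (b ⊕ x ⊛ d) ⊕ z ⊛ (c ⊕ y ⊛ b) ∎
  where
  open ≈-Reasoning
  b = binom M (suc j) (suc k)
  c = binom M (suc (suc j)) k
  d = binom M j (suc (suc k))
  x = q^ (suc (suc k) * M)
  y = q^ (suc k * M)
  z = q^ (suc (suc j) * M)
  w = q^ (suc j * M)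
  exponents : ∀ j k M → suc (suc k) * M + suc j * M ≡ suc (suc j) * M + suc k * M
  exponents = ℕSolver.solve-∀
  powers : x ⊛ w ≈ z ⊛ y
  powers = begin
    x ⊛ w                             ≈⟨ q^-+ (suc (suc k) * M) (suc j * M) ⟨
    q^ (suc (suc k) * M + suc j * M)  ≡⟨ cong q^_ (exponents j k M) ⟩
    q^ (suc (suc j) * M + suc k * M)  ≈⟨ q^-+ (suc (suc j) * M) (suc k * M) ⟩
    z ⊛ y ∎

antidiagonal : (ℕ → ℕ → Series) → ℕ → Series
antidiagonal f zero    = f 0 0
antidiagonal f (suc N) = f 0 (suc N) ⊕ antidiagonal (λ j → f (suc j)) N

antidiagonal-cong[] : ∀ {f g K} N → (∀ j k → j + k ≡ N → f j k ≈[ K ] g j k) →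
  antidiagonal f N ≈[ K ] antidiagonal g N
antidiagonal-cong[] zero    p = p 0 0 refl
antidiagonal-cong[] (suc N) p =
  ⊕-cong[] (p 0 (suc N) refl) (antidiagonal-cong[] N λ j k e → p (suc j) k (cong suc e))

antidiagonal-cong : ∀ {f g} N → (∀ j k → j + k ≡ N → f j k ≈ g j k) →
  antidiagonal f N ≈ antidiagonal g N
antidiagonal-cong N p = ≈[]⇒≈ λ K → antidiagonal-cong[] N λ j k e → ≈⇒≈[] (p j k e)

antidiagonal-⊕ : ∀ f g N →
  antidiagonal (λ j k → f j k ⊕ g j k) N ≈ antidiagonal f N ⊕ antidiagonal g N
antidiagonal-⊕ f g zero    = ≈-refl
antidiagonal-⊕ f g (suc N) = ≈-trans
  (⊕-congˡ (f 0 (suc N) ⊕ g 0 (suc N)) (antidiagonal-⊕ (λ j → f (suc j)) (λ j → g (suc j)) N))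
  (solve 4 (λ a b c d → a :+ b :+ (c :+ d) := a :+ c :+ (b :+ d)) ≈-refl
    (f 0 (suc N)) (g 0 (suc N)) (antidiagonal (λ j → f (suc j)) N) (antidiagonal (λ j → g (suc j)) N))

antidiagonal-⊛ : ∀ f c N → antidiagonal f N ⊛ c ≈ antidiagonal (λ j k → f j k ⊛ c) N
antidiagonal-⊛ f c zero    = ≈-refl
antidiagonal-⊛ f c (suc N) = ≈-trans (distribʳ c (f 0 (suc N)) _)
  (⊕-congˡ (f 0 (suc N) ⊛ c) (antidiagonal-⊛ (λ j → f (suc j)) c N))

-- A Pascal rule summed over an antidiagonal. Predecessors missing at the boundary are supplied as 𝟘
-- by `up` and `right`, so that all cells split uniformly.
antidiagonal-pascal : ∀ f g h →
  (∀ k → f 0 (suc k) ≈ g 0 k) → (∀ j → f (suc j) 0 ≈ h j 0) →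
  (∀ j k → f (suc j) (suc k) ≈ g (suc j) k ⊕ h j (suc k)) →
  ∀ N → antidiagonal f (suc N) ≈ antidiagonal g N ⊕ antidiagonal h N
antidiagonal-pascal f g h p₁ p₂ p₃ N = begin
  antidiagonal f (suc N)
    ≈⟨ antidiagonal-cong (suc N) split ⟩
  antidiagonal (λ j k → up (g j) k ⊕ right h j k) (suc N)
    ≈⟨ antidiagonal-⊕ (λ j → up (g j)) (right h) (suc N) ⟩
  antidiagonal (λ j → up (g j)) (suc N) ⊕ antidiagonal (right h) (suc N)
    ≈⟨ ⊕-cong (sum-up g N) (+-identityˡ (antidiagonal h N)) ⟩
  antidiagonal g N ⊕ antidiagonal h N ∎
  where
  open ≈-Reasoning
  up : (ℕ → Series) → ℕ → Series
  up a zero    = 𝟘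
  up a (suc k) = a k
  right : (ℕ → ℕ → Series) → ℕ → ℕ → Series
  right h zero    k = 𝟘
  right h (suc j) k = h j k
  split : ∀ j k → j + k ≡ suc N → f j k ≈ up (g j) k ⊕ right h j k
  split zero    (suc k) _ = ≈-trans (p₁ k) (≈-sym (+-identityʳ (g 0 k)))
  split (suc j) zero    _ = ≈-trans (p₂ j) (≈-sym (+-identityˡ (h j 0)))
  split (suc j) (suc k) _ = p₃ j k
  sum-up : ∀ g N → antidiagonal (λ j → up (g j)) (suc N) ≈ antidiagonal g N
  sum-up g zero    = +-identityʳ (g 0 0)
  sum-up g (suc N) = ⊕-congˡ (g 0 (suc N)) (sum-up (λ j → g (suc j)) N)

antidiagonal-binom₁ : ∀ M (T : ℕ → Series) N → antidiagonal (λ j k → binom M j k ⊛ T j) (suc N) ≈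
  antidiagonal (λ j k → binom M j k ⊛ T j) N ⊕
  antidiagonal (λ j k → binom M j k ⊛ (q^ (k * M) ⊛ T (suc j))) N
antidiagonal-binom₁ M T = antidiagonal-pascal (λ j k → binom M j k ⊛ T j)
  (λ j k → binom M j k ⊛ T j) (λ j k → binom M j k ⊛ (q^ (k * M) ⊛ T (suc j)))
  (λ _ → ≈-refl) last inner
  where
  last : ∀ j → 𝟙 ⊛ T (suc j) ≈ binom M j 0 ⊛ (𝟙 ⊛ T (suc j))
  last j rewrite binom-zeroʳ M j = ⊛-congˡ 𝟙 (≈-sym (*-identityˡ (T (suc j))))
  inner : ∀ j k → binom M (suc j) (suc k) ⊛ T (suc j) ≈
    binom M (suc j) k ⊛ T (suc j) ⊕ binom M j (suc k) ⊛ (q^ (suc k * M) ⊛ T (suc j))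
  inner j k = solve 4 (λ a x b t → (a :+ x :* b) :* t := a :* t :+ b :* (x :* t)) ≈-refl
    (binom M (suc j) k) (q^ (suc k * M)) (binom M j (suc k)) (T (suc j))

antidiagonal-binom₂ : ∀ M (T : ℕ → Series) N → antidiagonal (λ j k → binom M j k ⊛ T j) (suc N) ≈
  antidiagonal (λ j k → binom M j k ⊛ (q^ (j * M) ⊛ T j)) N ⊕
  antidiagonal (λ j k → binom M j k ⊛ T (suc j)) N
antidiagonal-binom₂ M T = antidiagonal-pascal (λ j k → binom M j k ⊛ T j)
  (λ j k → binom M j k ⊛ (q^ (j * M) ⊛ T j)) (λ j k → binom M j k ⊛ T (suc j))
  first last inner
  where
  first : ∀ k → 𝟙 ⊛ T 0 ≈ 𝟙 ⊛ (𝟙 ⊛ T 0)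
  first k = ⊛-congˡ 𝟙 (≈-sym (*-identityˡ (T 0)))
  last : ∀ j → 𝟙 ⊛ T (suc j) ≈ binom M j 0 ⊛ T (suc j)
  last j rewrite binom-zeroʳ M j = ≈-refl
  inner : ∀ j k → binom M (suc j) (suc k) ⊛ T (suc j) ≈
    binom M (suc j) k ⊛ (q^ (suc j * M) ⊛ T (suc j)) ⊕ binom M j (suc k) ⊛ T (suc j)
  inner j k = ≈-trans (⊛-cong (binom-pascal M j k) ≈-refl)
    (solve 4 (λ a x b t → (a :+ x :* b) :* t := b :* (x :* t) :+ a :* t) ≈-refl
      (binom M j (suc k)) (q^ (suc j * M)) (binom M (suc j) k) (T (suc j)))

-- Exponents and signs of the theta series

-- τ z = z (z + 1) / 2
triangle : ℕ → ℕ
triangle zero    = 0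
triangle (suc k) = suc k + triangle k

τ : ℤ → ℕ
τ (+ k)    = triangle k
τ -[1+ k ] = triangle k

double-triangle : ∀ k → + 2 *ᶻ + triangle k ≡ + k *ᶻ (+ k +ᶻ 1ℤ)
double-triangle zero    = refl
double-triangle (suc k) = begin
  + 2 *ᶻ (+ suc k +ᶻ + triangle k)             ≡⟨ ℤₚ.*-distribˡ-+ (+ 2) (+ suc k) (+ triangle k) ⟩
  + 2 *ᶻ + suc k +ᶻ + 2 *ᶻ + triangle k        ≡⟨ cong (+ 2 *ᶻ + suc k +ᶻ_) (double-triangle k) ⟩
  + 2 *ᶻ (1ℤ +ᶻ + k) +ᶻ + k *ᶻ (+ k +ᶻ 1ℤ)     ≡⟨ arith (+ k) ⟩
  (1ℤ +ᶻ + k) *ᶻ (1ℤ +ᶻ + k +ᶻ 1ℤ)             ∎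
  where
  open ≡-Reasoning
  arith : ∀ x → + 2 *ᶻ (1ℤ +ᶻ x) +ᶻ x *ᶻ (x +ᶻ 1ℤ) ≡ (1ℤ +ᶻ x) *ᶻ (1ℤ +ᶻ x +ᶻ 1ℤ)
  arith = solve-∀

-- Identities between exponents are proved after doubling, where they are polynomial identities over
-- ℤ; `double-injective` then leads back to ℕ.
double-τ : ∀ z → + 2 *ᶻ + τ z ≡ z *ᶻ (z +ᶻ 1ℤ)
double-τ (+ k)    = double-triangle k
double-τ -[1+ k ] = trans (double-triangle k) (arith (+ k))
  where
  arith : ∀ x → x *ᶻ (x +ᶻ 1ℤ) ≡ (-ᶻ (1ℤ +ᶻ x)) *ᶻ (-ᶻ (1ℤ +ᶻ x) +ᶻ 1ℤ)
  arith = solve-∀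

-- This is ((α + β) z² + (α - β) z) / 2; as a combination of triangular numbers it stays in ℕ.
exponent : ℕ → ℕ → ℤ → ℕ
exponent α β z = α * τ z + β * τ (-ᶻ z)

double-exponent : ∀ α β z →
  + 2 *ᶻ + exponent α β z ≡ + α *ᶻ (z *ᶻ (z +ᶻ 1ℤ)) +ᶻ + β *ᶻ (z *ᶻ (z -ᶻ 1ℤ))
double-exponent α β z = begin
  + 2 *ᶻ + (α * τ z + β * τ (-ᶻ z))
    ≡⟨ cong (+ 2 *ᶻ_) (trans (ℤₚ.pos-+ (α * τ z) _) (cong₂ _+ᶻ_ (ℤₚ.pos-* α _) (ℤₚ.pos-* β _))) ⟩
  + 2 *ᶻ (+ α *ᶻ + τ z +ᶻ + β *ᶻ + τ (-ᶻ z))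
    ≡⟨ arith (+ α) (+ β) (+ τ z) (+ τ (-ᶻ z)) ⟩
  + α *ᶻ (+ 2 *ᶻ + τ z) +ᶻ + β *ᶻ (+ 2 *ᶻ + τ (-ᶻ z))
    ≡⟨ cong₂ (λ x y → + α *ᶻ x +ᶻ + β *ᶻ y) (double-τ z) (trans (double-τ (-ᶻ z)) (arith′ z)) ⟩
  + α *ᶻ (z *ᶻ (z +ᶻ 1ℤ)) +ᶻ + β *ᶻ (z *ᶻ (z -ᶻ 1ℤ)) ∎
  where
  open ≡-Reasoning
  arith : ∀ a b s t → + 2 *ᶻ (a *ᶻ s +ᶻ b *ᶻ t) ≡ a *ᶻ (+ 2 *ᶻ s) +ᶻ b *ᶻ (+ 2 *ᶻ t)
  arith = solve-∀
  arith′ : ∀ z → (-ᶻ z) *ᶻ (-ᶻ z +ᶻ 1ℤ) ≡ z *ᶻ (z -ᶻ 1ℤ)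
  arith′ = solve-∀

double-injective : ∀ {m n} → + 2 *ᶻ + m ≡ + 2 *ᶻ + n → m ≡ n
double-injective p = ℤₚ.+-injective (ℤₚ.*-cancelˡ-≡ (+ 2) _ _ p)

power : Sign → ℕ → Sign
power s zero    = Sign.+
power s (suc n) = s Sign.* power s n

infix 8 _^ˢ_
_^ˢ_ : Sign → ℤ → Sign
s ^ˢ z = power s ∣ z ∣

-- The z-th term of the bilateral series for (-s q^α, -s q^β, q^(α+β); q^(α+β))_∞.
term : Sign → ℕ → ℕ → ℤ → Series
term s α β z = monomial (s ^ˢ z) (exponent α β z)

sign-cancel : ∀ s t → s Sign.* (s Sign.* t) ≡ t
sign-cancel s t = trans (sym (Signₚ.*-assoc s s t)) (cong (Sign._* t) (Signₚ.s*s≡+ s))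

^ˢ-suc : ∀ s z → s ^ˢ (1ℤ +ᶻ z) ≡ s Sign.* s ^ˢ z
^ˢ-suc s (+ n)          = refl
^ˢ-suc s -[1+ zero ]    = sym (sign-cancel s Sign.+)
^ˢ-suc s -[1+ suc n ]   = sym (sign-cancel s (power s (suc n)))

term-exponent-suc : ∀ α β z n k → + n ≡ z +ᶻ + k →
  n * (α + β) + α + exponent α β z ≡ k * (α + β) + exponent α β (1ℤ +ᶻ z)
term-exponent-suc α β z n k p = double-injective (begin
  + 2 *ᶻ + (n * (α + β) + α + exponent α β z)
    ≡⟨ cast (n * (α + β) + α) (exponent α β z) ⟩
  + 2 *ᶻ + (n * (α + β) + α) +ᶻ + 2 *ᶻ + exponent α β z
    ≡⟨ cong₂ _+ᶻ_ (cong (+ 2 *ᶻ_) (trans (ℤₚ.pos-+ (n * (α + β)) α) (cong (_+ᶻ + α)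
         (trans (ℤₚ.pos-* n (α + β)) (cong₂ _*ᶻ_ p (ℤₚ.pos-+ α β)))))) (double-exponent α β z) ⟩
  + 2 *ᶻ ((z +ᶻ + k) *ᶻ (+ α +ᶻ + β) +ᶻ + α) +ᶻ
    (+ α *ᶻ (z *ᶻ (z +ᶻ 1ℤ)) +ᶻ + β *ᶻ (z *ᶻ (z -ᶻ 1ℤ)))
    ≡⟨ arith (+ α) (+ β) z (+ k) ⟩
  + 2 *ᶻ (+ k *ᶻ (+ α +ᶻ + β)) +ᶻ
    (+ α *ᶻ ((1ℤ +ᶻ z) *ᶻ (1ℤ +ᶻ z +ᶻ 1ℤ)) +ᶻ + β *ᶻ ((1ℤ +ᶻ z) *ᶻ (1ℤ +ᶻ z -ᶻ 1ℤ)))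
    ≡⟨ cong₂ _+ᶻ_ (cong (+ 2 *ᶻ_) (trans (ℤₚ.pos-* k (α + β)) (cong (+ k *ᶻ_) (ℤₚ.pos-+ α β))))
         (double-exponent α β (1ℤ +ᶻ z)) ⟨
  + 2 *ᶻ + (k * (α + β)) +ᶻ + 2 *ᶻ + exponent α β (1ℤ +ᶻ z)
    ≡⟨ cast (k * (α + β)) (exponent α β (1ℤ +ᶻ z)) ⟨
  + 2 *ᶻ + (k * (α + β) + exponent α β (1ℤ +ᶻ z)) ∎)
  where
  open ≡-Reasoning
  cast : ∀ m n → + 2 *ᶻ + (m + n) ≡ + 2 *ᶻ + m +ᶻ + 2 *ᶻ + n
  cast m n = trans (cong (+ 2 *ᶻ_) (ℤₚ.pos-+ m n)) (ℤₚ.*-distribˡ-+ (+ 2) (+ m) (+ n))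
  arith : ∀ a b z k →
    + 2 *ᶻ ((z +ᶻ k) *ᶻ (a +ᶻ b) +ᶻ a) +ᶻ (a *ᶻ (z *ᶻ (z +ᶻ 1ℤ)) +ᶻ b *ᶻ (z *ᶻ (z -ᶻ 1ℤ))) ≡
    + 2 *ᶻ (k *ᶻ (a +ᶻ b)) +ᶻ
      (a *ᶻ ((1ℤ +ᶻ z) *ᶻ (1ℤ +ᶻ z +ᶻ 1ℤ)) +ᶻ b *ᶻ ((1ℤ +ᶻ z) *ᶻ (1ℤ +ᶻ z -ᶻ 1ℤ)))
  arith = solve-∀

-- Consecutive terms have the ratio s q^((α + β) z + α). Writing z as n - k distributes this power
-- over both sides and avoids negative exponents.
term-suc : ∀ s α β z n k → + n ≡ z +ᶻ + k →
  monomial s (n * (α + β) + α) ⊛ term s α β z ≈ q^ (k * (α + β)) ⊛ term s α β (1ℤ +ᶻ z)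
term-suc s α β z n k p = begin
  monomial s (n * (α + β) + α) ⊛ term s α β z
    ≈⟨ monomial-⊛ s (s ^ˢ z) (n * (α + β) + α) (exponent α β z) ⟩
  monomial (s Sign.* s ^ˢ z) (n * (α + β) + α + exponent α β z)
    ≡⟨ cong₂ monomial (sym (^ˢ-suc s z)) (term-exponent-suc α β z n k p) ⟩
  monomial (s ^ˢ (1ℤ +ᶻ z)) (k * (α + β) + exponent α β (1ℤ +ᶻ z))
    ≈⟨ monomial-⊛ Sign.+ (s ^ˢ (1ℤ +ᶻ z)) (k * (α + β)) (exponent α β (1ℤ +ᶻ z)) ⟨
  monomial Sign.+ (k * (α + β)) ⊛ term s α β (1ℤ +ᶻ z)
    ≈⟨ ⊛-cong (*-identityˡ (q^ (k * (α + β)))) ≈-refl ⟩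
  q^ (k * (α + β)) ⊛ term s α β (1ℤ +ᶻ z) ∎
  where open ≈-Reasoning

term-reflect : ∀ s α β z → term s α β (-ᶻ z) ≡ term s β α z
term-reflect s α β z = cong₂ monomial (sign z)
  (trans (cong (λ y → α * τ (-ᶻ z) + β * τ y) (ℤₚ.neg-involutive z))
         (ℕₚ.+-comm (α * τ (-ᶻ z)) (β * τ z)))
  where
  sign : ∀ z → s ^ˢ (-ᶻ z) ≡ s ^ˢ z
  sign (+ zero)  = refl
  sign (+ suc n) = refl
  sign -[1+ n ]  = refl

-- The finite triple product and its limit

progression : Sign → ℕ → ℕ → ℕ → Series
progression s M γ k = factor s (k * M + γ)

module _ (s : Sign) (α β : ℕ) where
  private
    M : ℕ
    M = α + β

    finite : ℕ → ℕ → Series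
    finite n m = ∏< (progression s M α) n ⊛ ∏< (progression s M β) m

    expansion : ℕ → ℕ → ℕ → Series
    expansion m j k = binom M j k ⊛ term s α β (j ⊖ m)

    ⊖-split : ∀ n m j k → j + k ≡ n + m → + n ≡ (j ⊖ m) +ᶻ + k
    ⊖-split n m j k p = sym (begin
      (j ⊖ m) +ᶻ + k     ≡⟨ ℤₚ.distribˡ-⊖-+-pos k j m ⟩
      j + k ⊖ m          ≡⟨ cong (_⊖ m) (trans p (ℕₚ.+-comm n m)) ⟩
      m + n ⊖ m          ≡⟨ cong (m + n ⊖_) (ℕₚ.+-identityʳ m) ⟨
      m + n ⊖ (m + 0)    ≡⟨ ℤₚ.+-cancelˡ-⊖ m n 0 ⟩
      + n ∎)
      where open ≡-Reasoning

    expand-factor : ∀ (f : ℕ → ℕ → Series) (g : ℕ → ℕ → Series) e N →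
      (∀ j k → j + k ≡ N → f j k ⊛ monomial s e ≈ g j k) →
      antidiagonal f N ⊛ factor s e ≈ antidiagonal f N ⊕ antidiagonal g N
    expand-factor f g e N p = begin
      antidiagonal f N ⊛ (𝟙 ⊕ monomial s e)
        ≈⟨ distribˡ (antidiagonal f N) 𝟙 (monomial s e) ⟩
      antidiagonal f N ⊛ 𝟙 ⊕ antidiagonal f N ⊛ monomial s e
        ≈⟨ ⊕-cong (*-identityʳ (antidiagonal f N))
             (≈-trans (antidiagonal-⊛ f (monomial s e) N) (antidiagonal-cong N p)) ⟩
      antidiagonal f N ⊕ antidiagonal g N ∎
      where open ≈-Reasoning

    swap-last : ∀ a b c → a ⊛ b ⊛ c ≈ a ⊛ (c ⊛ b)
    swap-last = solve 3 (λ a b c → a :* b :* c := a :* (c :* b)) ≈-refl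

    grow-α : ∀ n m → finite n m ≈ antidiagonal (expansion m) (n + m) →
      finite (suc n) m ≈ antidiagonal (expansion m) (suc n + m)
    grow-α n m ih = begin
      (∏< (progression s M α) n ⊛ factor s e) ⊛ ∏< (progression s M β) m
        ≈⟨ solve 3 (λ a b c → a :* b :* c := a :* c :* b) ≈-refl
             (∏< (progression s M α) n) (factor s e) (∏< (progression s M β) m) ⟩
      finite n m ⊛ factor s e
        ≈⟨ ⊛-cong ih ≈-refl ⟩
      antidiagonal (expansion m) (n + m) ⊛ factor s e
        ≈⟨ expand-factor (expansion m) _ e (n + m) step ⟩
      antidiagonal (expansion m) (n + m) ⊕
      antidiagonal (λ j k → binom M j k ⊛ (q^ (k * M) ⊛ term s α β (suc j ⊖ m))) (n + m)
        ≈⟨ antidiagonal-binom₁ M (λ j → term s α β (j ⊖ m)) (n + m) ⟨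
      antidiagonal (expansion m) (suc n + m) ∎
      where
      open ≈-Reasoning
      e = n * M + α
      step : ∀ j k → j + k ≡ n + m → expansion m j k ⊛ monomial s e ≈
        binom M j k ⊛ (q^ (k * M) ⊛ term s α β (suc j ⊖ m))
      step j k p = ≈-trans (swap-last (binom M j k) _ _)
        (⊛-congˡ (binom M j k) (begin
          monomial s e ⊛ term s α β (j ⊖ m)
            ≈⟨ term-suc s α β (j ⊖ m) n k (⊖-split n m j k p) ⟩
          q^ (k * M) ⊛ term s α β (1ℤ +ᶻ (j ⊖ m))
            ≡⟨ cong (λ z → q^ (k * M) ⊛ term s α β z) (ℤₚ.distribʳ-⊖-+-pos 1 j m) ⟩
          q^ (k * M) ⊛ term s α β (suc j ⊖ m) ∎))

    grow-β : ∀ n m → finite n m ≈ antidiagonal (expansion m) (n + m) →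
      finite n (suc m) ≈ antidiagonal (expansion (suc m)) (suc (n + m))
    grow-β n m ih = begin
      ∏< (progression s M α) n ⊛ (∏< (progression s M β) m ⊛ factor s e)
        ≈⟨ *-assoc (∏< (progression s M α) n) _ _ ⟨
      finite n m ⊛ factor s e
        -- A further β-factor moves the centre of the bilateral sum by one place: the old j-th term
        -- is the new term of index j + 1.
        ≈⟨ ⊛-cong (≈-trans ih (antidiagonal-cong (n + m) λ j k _ →
             ⊛-congˡ (binom M j k) (≡⇒≈ (sym (T-suc j))))) ≈-refl ⟩
      antidiagonal (λ j k → binom M j k ⊛ T (suc j)) (n + m) ⊛ factor s e
        ≈⟨ expand-factor (λ j k → binom M j k ⊛ T (suc j)) _ e (n + m) step ⟩
      antidiagonal (λ j k → binom M j k ⊛ T (suc j)) (n + m) ⊕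
      antidiagonal (λ j k → binom M j k ⊛ (q^ (j * M) ⊛ T j)) (n + m)
        ≈⟨ +-comm (antidiagonal (λ j k → binom M j k ⊛ T (suc j)) (n + m))
                  (antidiagonal (λ j k → binom M j k ⊛ (q^ (j * M) ⊛ T j)) (n + m)) ⟩
      antidiagonal (λ j k → binom M j k ⊛ (q^ (j * M) ⊛ T j)) (n + m) ⊕
      antidiagonal (λ j k → binom M j k ⊛ T (suc j)) (n + m)
        ≈⟨ antidiagonal-binom₂ M T (n + m) ⟨
      antidiagonal (expansion (suc m)) (suc (n + m)) ∎
      where
      open ≈-Reasoning
      e = m * M + β
      T : ℕ → Series
      T j = term s α β (j ⊖ suc m)
      T-suc : ∀ j → T (suc j) ≡ term s α β (j ⊖ m)
      T-suc j = cong (term s α β) (ℤₚ.[1+m]⊖[1+n]≡m⊖n j m)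
      step : ∀ j k → j + k ≡ n + m → binom M j k ⊛ T (suc j) ⊛ monomial s e ≈
        binom M j k ⊛ (q^ (j * M) ⊛ T j)
      -- The reflection z ↦ -z exchanges α and β, which makes the new factor an instance of
      -- `term-suc` again.
      step j k _ = ≈-trans (swap-last (binom M j k) _ _)
        (⊛-congˡ (binom M j k) (begin
          monomial s e ⊛ T (suc j)
            ≡⟨ cong₂ (λ x y → monomial s (m * x + β) ⊛ y) (ℕₚ.+-comm α β)
                 (trans (T-suc j) (trans (cong (term s α β) (ℤₚ.⊖-swap j m)) (term-reflect s α β (m ⊖ j)))) ⟩
          monomial s (m * (β + α) + β) ⊛ term s β α (m ⊖ j)
            ≈⟨ term-suc s β α (m ⊖ j) m j (⊖-split m j m j refl) ⟩
          q^ (j * (β + α)) ⊛ term s β α (1ℤ +ᶻ (m ⊖ j))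
            ≡⟨ cong₂ (λ x y → q^ (j * x) ⊛ y) (ℕₚ.+-comm β α)
                 (trans (cong (term s β α) (ℤₚ.distribʳ-⊖-+-pos 1 m j))
                   (trans (sym (term-reflect s α β (suc m ⊖ j)))
                          (cong (term s α β) (sym (ℤₚ.⊖-swap j (suc m)))))) ⟩
          q^ (j * M) ⊛ T j ∎))

  -- The numbers n and m of factors of the two kinds grow independently, each by its own q-Pascal
  -- rule. The index `j ⊖ m` runs from -m to n, so that a term keeps its place in the bilateral sum
  -- as both grow.
  finite-triple-product : ∀ n m →
    ∏< (progression s M α) n ⊛ ∏< (progression s M β) m ≈
    antidiagonal (λ j k → binom M j k ⊛ term s α β (j ⊖ m)) (n + m)
  finite-triple-product zero zero = ⊛-congˡ 𝟙 (≈-sym unit)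
    where
    unit : term s α β 0ℤ ≈ 𝟙
    unit rewrite ℕₚ.*-zeroʳ α | ℕₚ.*-zeroʳ β = *-identityˡ 𝟙
  finite-triple-product (suc n) zero    = grow-α n zero (finite-triple-product n zero)
  finite-triple-product n       (suc m) rewrite ℕₚ.+-suc n m =
    grow-β n m (finite-triple-product n m)

-- For M ≥ 1 this is 1/(q^M; q^M)_∞, read along the diagonal of the central binomials. Its use rests
-- on two facts only: it depends on M alone, and its constant term is 1.
binom-limit : ℕ → Series
binom-limit M d = binom M d d d

binom-sucˡ : ∀ {M} → 1 ≤ M → ∀ j k → binom M (suc j) k ≈[ j ] binom M j k
binom-sucˡ {M} p j zero rewrite binom-zeroʳ M j = ≈[]-refl
binom-sucˡ {M} p j (suc k) = begin
  binom M (suc j) (suc k)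
    ≈⟨ ≈⇒≈[] (binom-pascal M j k) ⟩
  binom M j (suc k) ⊕ q^ (suc j * M) ⊛ binom M (suc j) k
    ≈⟨ ⊕-cong[] {a = binom M j (suc k)} ≈[]-refl
         (q^-⊛-≈[] (suc j * M) _ (ℕₚ.m≤m*n (suc j) M {{ℕ.>-nonZero p}})) ⟩
  binom M j (suc k) ⊕ 𝟘
    ≈⟨ ≈⇒≈[] (+-identityʳ (binom M j (suc k))) ⟩
  binom M j (suc k) ∎
  where open import Relation.Binary.Reasoning.Setoid (truncated j)

binom-sucʳ : ∀ {M} → 1 ≤ M → ∀ j k → binom M j (suc k) ≈[ k ] binom M j k
binom-sucʳ {M} p zero    k = ≈[]-refl
binom-sucʳ {M} p (suc j) k = ≈[]-trans
  (⊕-cong[] {a = binom M (suc j) k} ≈[]-refl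
    (q^-⊛-≈[] (suc k * M) _ (ℕₚ.m≤m*n (suc k) M {{ℕ.>-nonZero p}})))
  (≈⇒≈[] (+-identityʳ (binom M (suc j) k)))

binom-≈-limit : ∀ {M} → 1 ≤ M → ∀ {N j k} → N ≤ j → N ≤ k → binom M j k ≈[ N ] binom-limit M
binom-≈-limit {M} p {N} {j} {k} N≤j N≤k = coeffs≤ λ d d≤N →
  subst (λ x → binom M x k d ≡ binom M d d d) (ℕₚ.m∸n+n≡m (ℕₚ.≤-trans d≤N N≤j))
    (subst (λ y → binom M (j ∸ d + d) y d ≡ binom M d d d) (ℕₚ.m∸n+n≡m (ℕₚ.≤-trans d≤N N≤k))
      (coeff≤ (both d (j ∸ d) (k ∸ d)) d ℕₚ.≤-refl))
  where
  both : ∀ d a b → binom M (a + d) (b + d) ≈[ d ] binom M d d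
  both d zero    zero    = ≈[]-refl
  both d zero    (suc b) =
    ≈[]-trans (≈[]-mono (ℕₚ.m≤n+m d b) (binom-sucʳ p d (b + d))) (both d zero b)
  both d (suc a) b       =
    ≈[]-trans (≈[]-mono (ℕₚ.m≤n+m d a) (binom-sucˡ p (a + d) (b + d))) (both d a b)

-- Finite sums over intervals of ℤ

-- ∑ lo l ranges over lo, …, lo + l - 1.
∑ : ℤ → ℕ → (ℤ → ℤ) → ℤ
∑ lo zero    g = 0ℤ
∑ lo (suc l) g = g lo +ᶻ ∑ (1ℤ +ᶻ lo) l g

∑± : ℕ → (ℤ → ℤ) → ℤ
∑± K = ∑ (-ᶻ + K) (suc (K + K))

Supported : ℕ → (ℤ → ℤ) → Set
Supported K g = ∀ z → K < ∣ z ∣ → g z ≡ 0ℤ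

private
  ∑-step : ∀ lo i → lo +ᶻ + suc i ≡ 1ℤ +ᶻ lo +ᶻ + i
  ∑-step lo i = trans (cong (lo +ᶻ_) (ℤₚ.pos-+ 1 i)) (arith lo (+ i))
    where
    arith : ∀ x y → x +ᶻ (1ℤ +ᶻ y) ≡ 1ℤ +ᶻ x +ᶻ y
    arith = solve-∀

∑-cong : ∀ lo l {g h} → (∀ i → i < l → g (lo +ᶻ + i) ≡ h (lo +ᶻ + i)) → ∑ lo l g ≡ ∑ lo l h
∑-cong lo zero    p = refl
∑-cong lo (suc l) {g} {h} p = cong₂ _+ᶻ_
  (subst (λ z → g z ≡ h z) (ℤₚ.+-identityʳ lo) (p 0 (s≤s z≤n)))
  (∑-cong (1ℤ +ᶻ lo) l λ i i<l →
    subst (λ z → g z ≡ h z) (∑-step lo i) (p (suc i) (s≤s i<l)))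

∑-0 : ∀ lo l → ∑ lo l (λ _ → 0ℤ) ≡ 0ℤ
∑-0 lo zero    = refl
∑-0 lo (suc l) = trans (ℤₚ.+-identityˡ _) (∑-0 (1ℤ +ᶻ lo) l)

∑-+ : ∀ lo l g h → ∑ lo l (λ z → g z +ᶻ h z) ≡ ∑ lo l g +ᶻ ∑ lo l h
∑-+ lo zero    g h = refl
∑-+ lo (suc l) g h = trans (cong (g lo +ᶻ h lo +ᶻ_) (∑-+ (1ℤ +ᶻ lo) l g h))
  (arith (g lo) (h lo) _ _)
  where
  arith : ∀ a b c d → a +ᶻ b +ᶻ (c +ᶻ d) ≡ a +ᶻ c +ᶻ (b +ᶻ d)
  arith = solve-∀

∑-swap : ∀ lo l lo′ l′ (F : ℤ → ℤ → ℤ) →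
  ∑ lo l (λ x → ∑ lo′ l′ (F x)) ≡ ∑ lo′ l′ (λ y → ∑ lo l (λ x → F x y))
∑-swap lo zero    lo′ l′ F = sym (∑-0 lo′ l′)
∑-swap lo (suc l) lo′ l′ F = trans
  (cong (∑ lo′ l′ (F lo) +ᶻ_) (∑-swap (1ℤ +ᶻ lo) l lo′ l′ F))
  (sym (∑-+ lo′ l′ (F lo) (λ y → ∑ (1ℤ +ᶻ lo) l (λ x → F x y))))

∑-++ : ∀ lo a b g → ∑ lo (a + b) g ≡ ∑ lo a g +ᶻ ∑ (lo +ᶻ + a) b g
∑-++ lo zero    b g = trans (cong (λ x → ∑ x b g) (sym (ℤₚ.+-identityʳ lo))) (sym (ℤₚ.+-identityˡ _))
∑-++ lo (suc a) b g = begin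
  g lo +ᶻ ∑ (1ℤ +ᶻ lo) (a + b) g
    ≡⟨ cong (g lo +ᶻ_) (∑-++ (1ℤ +ᶻ lo) a b g) ⟩
  g lo +ᶻ (∑ (1ℤ +ᶻ lo) a g +ᶻ ∑ (1ℤ +ᶻ lo +ᶻ + a) b g)
    ≡⟨ ℤₚ.+-assoc (g lo) _ _ ⟨
  g lo +ᶻ ∑ (1ℤ +ᶻ lo) a g +ᶻ ∑ (1ℤ +ᶻ lo +ᶻ + a) b g
    ≡⟨ cong (λ x → g lo +ᶻ ∑ (1ℤ +ᶻ lo) a g +ᶻ ∑ x b g) (∑-step lo a) ⟨
  g lo +ᶻ ∑ (1ℤ +ᶻ lo) a g +ᶻ ∑ (lo +ᶻ + suc a) b g ∎
  where open ≡-Reasoning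

∑-shift : ∀ a lo l g → ∑ lo l (λ z → g (a +ᶻ z)) ≡ ∑ (a +ᶻ lo) l g
∑-shift a lo zero    g = refl
∑-shift a lo (suc l) g = cong (g (a +ᶻ lo) +ᶻ_)
  (trans (∑-shift a (1ℤ +ᶻ lo) l g) (cong (λ x → ∑ x l g) (arith a lo)))
  where
  arith : ∀ a x → a +ᶻ (1ℤ +ᶻ x) ≡ 1ℤ +ᶻ (a +ᶻ x)
  arith = solve-∀

∑-parity : ∀ lo l g → ∑ (lo +ᶻ lo) (l + l) g ≡
  ∑ lo l (λ z → g (z +ᶻ z)) +ᶻ ∑ lo l (λ z → g (1ℤ +ᶻ (z +ᶻ z)))
∑-parity lo zero    g = refl
∑-parity lo (suc l) g rewrite ℕₚ.+-suc l l = begin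
  e +ᶻ (o +ᶻ ∑ (1ℤ +ᶻ (1ℤ +ᶻ (lo +ᶻ lo))) (l + l) g)
    ≡⟨ cong (λ x → e +ᶻ (o +ᶻ ∑ x (l + l) g)) (arith lo) ⟩
  e +ᶻ (o +ᶻ ∑ ((1ℤ +ᶻ lo) +ᶻ (1ℤ +ᶻ lo)) (l + l) g)
    ≡⟨ cong (λ x → e +ᶻ (o +ᶻ x)) (∑-parity (1ℤ +ᶻ lo) l g) ⟩
  e +ᶻ (o +ᶻ (∑ (1ℤ +ᶻ lo) l (λ z → g (z +ᶻ z)) +ᶻ
    ∑ (1ℤ +ᶻ lo) l (λ z → g (1ℤ +ᶻ (z +ᶻ z)))))
    ≡⟨ arith′ e o _ _ ⟩
  (e +ᶻ ∑ (1ℤ +ᶻ lo) l (λ z → g (z +ᶻ z))) +ᶻ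
  (o +ᶻ ∑ (1ℤ +ᶻ lo) l (λ z → g (1ℤ +ᶻ (z +ᶻ z)))) ∎
  where
  open ≡-Reasoning
  e = g (lo +ᶻ lo)
  o = g (1ℤ +ᶻ (lo +ᶻ lo))
  arith : ∀ x → 1ℤ +ᶻ (1ℤ +ᶻ (x +ᶻ x)) ≡ (1ℤ +ᶻ x) +ᶻ (1ℤ +ᶻ x)
  arith = solve-∀
  arith′ : ∀ a b c d → a +ᶻ (b +ᶻ (c +ᶻ d)) ≡ (a +ᶻ c) +ᶻ (b +ᶻ d)
  arith′ = solve-∀

-- The window overshoots [-K, K] by d places on the left and e on the right, where g vanishes.
∑-support : ∀ {K g} → Supported K g → ∀ d e → ∀ {lo l} →
  -ᶻ + K ≡ lo +ᶻ + d → l ≡ d + (suc (K + K) + e) → ∑ lo l g ≡ ∑± K g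
∑-support {K} {g} supp d e {lo} p refl = begin
  ∑ lo (d + (suc (K + K) + e)) g
    ≡⟨ ∑-++ lo d _ g ⟩
  ∑ lo d g +ᶻ ∑ (lo +ᶻ + d) (suc (K + K) + e) g
    ≡⟨ cong₂ (λ x y → x +ᶻ ∑ y (suc (K + K) + e) g) left (sym p) ⟩
  0ℤ +ᶻ ∑ (-ᶻ + K) (suc (K + K) + e) g
    ≡⟨ ℤₚ.+-identityˡ _ ⟩
  ∑ (-ᶻ + K) (suc (K + K) + e) g
    ≡⟨ ∑-++ (-ᶻ + K) (suc (K + K)) e g ⟩
  ∑± K g +ᶻ ∑ (-ᶻ + K +ᶻ + suc (K + K)) e g
    ≡⟨ cong (∑± K g +ᶻ_) right ⟩
  ∑± K g +ᶻ 0ℤ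
    ≡⟨ ℤₚ.+-identityʳ _ ⟩
  ∑± K g ∎
  where
  open ≡-Reasoning
  left : ∑ lo d g ≡ 0ℤ
  left = trans (∑-cong lo d λ i i<d → supp _ (below i i<d)) (∑-0 lo d)
    where
    below : ∀ i → i < d → K < ∣ lo +ᶻ + i ∣
    below i i<d = subst (K <_) (sym (trans (cong ∣_∣ eq) (ℤₚ.∣-i∣≡∣i∣ (+ (K + (d ∸ i))))))
      (ℕₚ.m<m+n K (ℕₚ.m<n⇒0<n∸m i<d))
      where
      arith : ∀ lo x y → lo +ᶻ x ≡ -ᶻ (-ᶻ (lo +ᶻ (x +ᶻ y)) +ᶻ y)
      arith = solve-∀
      eq : lo +ᶻ + i ≡ -ᶻ + (K + (d ∸ i))
      eq = begin
        lo +ᶻ + i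
          ≡⟨ arith lo (+ i) (+ (d ∸ i)) ⟩
        -ᶻ (-ᶻ (lo +ᶻ (+ i +ᶻ + (d ∸ i))) +ᶻ + (d ∸ i))
          ≡⟨ cong (λ x → -ᶻ (-ᶻ (lo +ᶻ x) +ᶻ + (d ∸ i)))
               (trans (sym (ℤₚ.pos-+ i (d ∸ i))) (cong +_ (ℕₚ.m+[n∸m]≡n (ℕₚ.<⇒≤ i<d)))) ⟩
        -ᶻ (-ᶻ (lo +ᶻ + d) +ᶻ + (d ∸ i))
          ≡⟨ cong (λ x → -ᶻ (-ᶻ x +ᶻ + (d ∸ i))) (sym p) ⟩
        -ᶻ (-ᶻ (-ᶻ + K) +ᶻ + (d ∸ i))
          ≡⟨ cong (λ x → -ᶻ (x +ᶻ + (d ∸ i))) (ℤₚ.neg-involutive (+ K)) ⟩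
        -ᶻ (+ K +ᶻ + (d ∸ i))
          ≡⟨ cong -ᶻ_ (ℤₚ.pos-+ K (d ∸ i)) ⟨
        -ᶻ + (K + (d ∸ i)) ∎
  right : ∑ (-ᶻ + K +ᶻ + suc (K + K)) e g ≡ 0ℤ
  right = trans (∑-cong _ e λ i _ → supp _ (above i)) (∑-0 _ e)
    where
    arith : ∀ k i → -ᶻ k +ᶻ (1ℤ +ᶻ (k +ᶻ k)) +ᶻ i ≡ 1ℤ +ᶻ (k +ᶻ i)
    arith = solve-∀
    eq : ∀ i → -ᶻ + K +ᶻ + suc (K + K) +ᶻ + i ≡ + suc (K + i)
    eq i = arith (+ K) (+ i)
    above : ∀ i → K < ∣ -ᶻ + K +ᶻ + suc (K + K) +ᶻ + i ∣
    above i = subst (λ z → K < ∣ z ∣) (sym (eq i)) (s≤s (ℕₚ.m≤m+n K i))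

∑±-extend : ∀ {K g} → Supported K g → ∀ {K′} → K ≤ K′ → ∑± K′ g ≡ ∑± K g
∑±-extend {K} supp {K′} l = ∑-support supp d d
  (trans (arith (+ K) (+ d)) (cong (λ x → -ᶻ x +ᶻ + d) (cong +_ (ℕₚ.m+[n∸m]≡n l))))
  (trans (cong (λ x → suc (x + x)) (sym (ℕₚ.m+[n∸m]≡n l))) (arith′ K d))
  where
  d = K′ ∸ K
  arith : ∀ k d → -ᶻ k ≡ -ᶻ (k +ᶻ d) +ᶻ d
  arith = solve-∀
  arith′ : ∀ k d → suc (k + d + (k + d)) ≡ d + (suc (k + k) + d)
  arith′ = ℕSolver.solve-∀

antidiagonal-∑ : ∀ (G : ℕ → ℕ → Series) (g : ℤ → ℤ) lo n N →
  (∀ j k → G j k n ≡ g (lo +ᶻ + j)) → antidiagonal G N n ≡ ∑ lo (suc N) g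
antidiagonal-∑ G g lo n zero    p =
  trans (p 0 0) (trans (cong g (ℤₚ.+-identityʳ lo)) (sym (ℤₚ.+-identityʳ (g lo))))
antidiagonal-∑ G g lo n (suc N) p = cong₂ _+ᶻ_
  (trans (p 0 (suc N)) (cong g (ℤₚ.+-identityʳ lo)))
  (antidiagonal-∑ (λ j → G (suc j)) g (1ℤ +ᶻ lo) n N λ j k →
    trans (p (suc j) k) (cong g (arith lo (+ j))))
  where
  arith : ∀ x y → x +ᶻ (1ℤ +ᶻ y) ≡ 1ℤ +ᶻ x +ᶻ y
  arith = solve-∀

-- Bilateral series and the triple product

-- The sum of a family indexed by ℤ whose z-th member has no coefficient below |z| - 1.
Summable : (ℤ → Series) → Set
Summable t = ∀ n → Supported (suc n) (λ z → t z n)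

bilateral : (ℤ → Series) → Series
bilateral t n = ∑± (suc n) (λ z → t z n)

Summable-≈[] : ∀ {t} → Summable t → ∀ {n z} → suc n < ∣ z ∣ → t z ≈[ n ] 𝟘
Summable-≈[] {t} σ {n} {z} l = coeffs≤ go
  where
  go : ∀ i → i ≤ n → t z i ≡ 𝟘 i
  go i k = σ i z (ℕₚ.≤-<-trans (s≤s k) l)

-- Since τ vanishes at -1 as well as at 0, the extra 1 is unavoidable; it is the origin of the
-- window `suc n` in `bilateral`.
∣z∣≤1+τ : ∀ z → ∣ z ∣ ≤ suc (τ z)
∣z∣≤1+τ (+ zero)   = z≤n
∣z∣≤1+τ (+ suc k)  = ℕₚ.m≤n⇒m≤1+n (ℕₚ.m≤m+n (suc k) (triangle k))
∣z∣≤1+τ -[1+ k ]   = s≤s (k≤triangle k)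
  where
  k≤triangle : ∀ k → k ≤ triangle k
  k≤triangle zero    = z≤n
  k≤triangle (suc k) = ℕₚ.m≤m+n (suc k) (triangle k)

exponent-bound : ∀ {α} β → 1 ≤ α → ∀ z → ∣ z ∣ ≤ suc (exponent α β z)
exponent-bound {α} β a z = ℕₚ.≤-trans (∣z∣≤1+τ z)
  (s≤s (ℕₚ.≤-trans (ℕₚ.m≤n*m (τ z) α {{ℕ.>-nonZero a}}) (ℕₚ.m≤m+n (α * τ z) (β * τ (-ᶻ z)))))

Summable-term : ∀ s {α} β → 1 ≤ α → Summable (term s α β)
Summable-term s {α} β a n z l =
  trans (coeff≤ (monomial-≈[] (s ^ˢ z) (exponent α β z)
                  (ℕ.s≤s⁻¹ (ℕₚ.<-≤-trans l (exponent-bound β a z)))) n ℕₚ.≤-refl) refl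

J : Sign → ℕ → ℕ → Series
J s α β = bilateral (term s α β)

-- Modulo q^(N+1), in each summand of the finite identity either both j and k are at least N and the
-- binomial agrees with its limit, or the index `j ⊖ n` is so far from 0 that the theta term itself
-- vanishes.
triple-product : ∀ s {α β} → 1 ≤ α → 1 ≤ β → θ s α β ≈ binom-limit (α + β) ⊛ J s α β
triple-product s {α} {β} a b = ≈[]⇒≈ λ N → truncation N
  where
  M = α + β
  C = binom-limit M
  T : ℤ → Series
  T = term s α β
  truncation : ∀ N → θ s α β ≈[ N ] C ⊛ J s α β
  truncation N = begin
    θ s α β
      ≈⟨ ∏∞-approx (Tame-θ s a b) N≤n ⟩
    ∏< (θ-block s α β) n
      ≈⟨ ≈⇒≈[] (∏<-⊛ (progression s M α) (progression s M β) n) ⟩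
    ∏< (progression s M α) n ⊛ ∏< (progression s M β) n
      ≈⟨ ≈⇒≈[] (finite-triple-product s α β n n) ⟩
    antidiagonal (λ j k → binom M j k ⊛ T (j ⊖ n)) (n + n)
      ≈⟨ antidiagonal-cong[] (n + n) replace ⟩
    antidiagonal (λ j k → T (j ⊖ n) ⊛ C) (n + n)
      ≈⟨ ≈⇒≈[] (antidiagonal-⊛ (λ j k → T (j ⊖ n)) C (n + n)) ⟨
    antidiagonal (λ j k → T (j ⊖ n)) (n + n) ⊛ C
      ≈⟨ ⊛-cong[] (coeffs≤ collect) ≈[]-refl ⟩
    J s α β ⊛ C
      ≈⟨ ≈⇒≈[] (*-comm (J s α β) C) ⟩
    C ⊛ J s α β ∎
    where
    open import Relation.Binary.Reasoning.Setoid (truncated N)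
    -- Chosen such that j < N, or by symmetry k < N, puts `j ⊖ n` at distance greater than N + 1
    -- from 0, outside the support of all coefficients up to N.
    n = N + suc (suc N)
    N≤n : N ≤ n
    N≤n = ℕₚ.m≤m+n N (suc (suc N))
    gap : ∀ {j} → j < N → suc N < n ∸ j
    gap {j} l = subst (suc (suc N) ≤_) (sym (ℕₚ.+-∸-comm (suc (suc N)) (ℕₚ.<⇒≤ l)))
      (ℕₚ.m≤n+m (suc (suc N)) (N ∸ j))
    far : ∀ j k → suc N < ∣ j ⊖ n ∣ → binom M j k ⊛ T (j ⊖ n) ≈[ N ] T (j ⊖ n) ⊛ C
    far j k l = ≈[]-trans (⊛-cong[] {a = binom M j k} ≈[]-refl t≈0)
      (≈[]-trans (≈⇒≈[] (≈-trans (zeroʳ (binom M j k)) (≈-sym (zeroˡ C))))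
        (⊛-cong[] (≈[]-sym t≈0) ≈[]-refl))
      where t≈0 = Summable-≈[] (Summable-term s β a) {z = j ⊖ n} l
    replace : ∀ j k → j + k ≡ n + n → binom M j k ⊛ T (j ⊖ n) ≈[ N ] T (j ⊖ n) ⊛ C
    replace j k p with N ℕₚ.≤? j | N ℕₚ.≤? k
    ... | yes N≤j | yes N≤k = ≈[]-trans
      (⊛-cong[] (binom-≈-limit (ℕₚ.≤-trans a (ℕₚ.m≤m+n α β)) N≤j N≤k) ≈[]-refl)
      (≈⇒≈[] (*-comm C (T (j ⊖ n))))
    ... | no N≰j | _ = far j k (subst (suc N <_)
      (sym (ℤₚ.∣⊖∣-≤ (ℕₚ.≤-trans (ℕₚ.<⇒≤ (ℕₚ.≰⇒> N≰j)) N≤n))) (gap (ℕₚ.≰⇒> N≰j)))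
    ... | yes _ | no N≰k = far j k (subst (suc N <_) (sym distance) (gap k<N))
      where
      k<N = ℕₚ.≰⇒> N≰k
      k≤n = ℕₚ.≤-trans (ℕₚ.<⇒≤ k<N) N≤n
      n≤j : n ≤ j
      n≤j = ℕₚ.+-cancelʳ-≤ n n j (subst (_≤ j + n) p (ℕₚ.+-monoʳ-≤ j k≤n))
      distance : ∣ j ⊖ n ∣ ≡ n ∸ k
      distance = trans (ℤₚ.∣m⊖n∣≡∣n⊖m∣ j n) (trans (ℤₚ.∣⊖∣-≤ n≤j)
        (ℕₚ.+-cancelʳ-≡ n (j ∸ n) (n ∸ k) (trans (ℕₚ.m∸n+n≡m n≤j)
          (ℕₚ.+-cancelʳ-≡ k j (n ∸ k + n) (trans p
            (trans (cong (_+ n) (sym (ℕₚ.m∸n+n≡m k≤n))) (arith (n ∸ k) k n)))))))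
        where
        arith : ∀ x y z → x + y + z ≡ x + z + y
        arith = ℕSolver.solve-∀
    collect : ∀ i → i ≤ N → antidiagonal (λ j k → T (j ⊖ n)) (n + n) i ≡ J s α β i
    collect i i≤N = trans
      (antidiagonal-∑ (λ j k → T (j ⊖ n)) (λ z → T z i) (-ᶻ + n) i (n + n) λ j k →
        cong (λ z → T z i) (sym (ℤₚ.-m+n≡n⊖m n j)))
      (∑±-extend (Summable-term s β a i) (ℕₚ.≤-trans (s≤s i≤N)
        (subst (suc N ≤_) (sym (ℕₚ.+-suc N (suc N))) (s≤s (ℕₚ.m≤m+n N (suc N))))))

binom-limit-unit : ∀ M → binom-limit M 0 ≡ 1ℤ
binom-limit-unit M = refl

-- The reflection of the summation index, obtained without reindexing: the theta products agree by
-- `θ-sym`, and the common factor `binom-limit` cancels.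
J-sym : ∀ s {α β} → 1 ≤ α → 1 ≤ β → J s α β ≈ J s β α
J-sym s {α} {β} a b = unit-cancel (binom-limit (α + β)) (binom-limit-unit (α + β)) (begin
  binom-limit (α + β) ⊛ J s α β ≈⟨ triple-product s a b ⟨
  θ s α β                       ≈⟨ θ-sym s α β ⟩
  θ s β α                       ≈⟨ triple-product s b a ⟩
  binom-limit (β + α) ⊛ J s β α ≡⟨ cong (λ M → binom-limit M ⊛ J s β α) (ℕₚ.+-comm β α) ⟩
  binom-limit (α + β) ⊛ J s β α ∎)
  where open ≈-Reasoning

-- Double sums and the change of coordinates on ℤ²

∑-⊛ : ∀ lo l (t : ℤ → Series) b n →
  ((λ i → ∑ lo l (λ z → t z i)) ⊛ b) n ≡ ∑ lo l (λ z → (t z ⊛ b) n)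
∑-⊛ lo zero    t b n = 𝟘-⊛ b n
∑-⊛ lo (suc l) t b n = trans (⊛-distribʳ b (t lo) (λ i → ∑ (1ℤ +ᶻ lo) l (λ z → t z i)) n)
  (cong ((t lo ⊛ b) n +ᶻ_) (∑-⊛ (1ℤ +ᶻ lo) l t b n))

⊛-∑ : ∀ lo l (t : ℤ → Series) b n →
  (b ⊛ (λ i → ∑ lo l (λ z → t z i))) n ≡ ∑ lo l (λ z → (b ⊛ t z) n)
⊛-∑ lo l t b n = trans (⊛-comm b _ n) (trans (∑-⊛ lo l t b n)
  (∑-cong lo l λ i _ → ⊛-comm (t (lo +ᶻ + i)) b n))

bilateral-≈[] : ∀ {t} → Summable t → ∀ {n K} → suc n ≤ K →
  bilateral t ≈[ n ] (λ i → ∑± K (λ z → t z i))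
bilateral-≈[] {t} σ {n} {K} l = coeffs≤ λ i k →
  sym (∑±-extend (σ i) (ℕₚ.≤-trans (s≤s k) l))

-- The two windows are independent because the change of coordinates returns one sum over [-K, K]
-- and one over [-2K, 2K].
bilateral-⊛ : ∀ {t u} → Summable t → Summable u → ∀ {n K L} → suc n ≤ K → suc n ≤ L →
  (bilateral t ⊛ bilateral u) n ≡ ∑± K (λ x → ∑± L (λ y → (t x ⊛ u y) n))
bilateral-⊛ {t} {u} σ ρ {n} {K} {L} k l = begin
  (bilateral t ⊛ bilateral u) n
    ≡⟨ coeff≤ (⊛-cong[] (bilateral-≈[] σ k) (bilateral-≈[] ρ l)) n ℕₚ.≤-refl ⟩
  ((λ i → ∑± K (λ z → t z i)) ⊛ (λ i → ∑± L (λ z → u z i))) n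
    ≡⟨ ∑-⊛ (-ᶻ + K) (suc (K + K)) t _ n ⟩
  ∑± K (λ x → (t x ⊛ (λ i → ∑± L (λ z → u z i))) n)
    ≡⟨ ∑-cong (-ᶻ + K) (suc (K + K)) {λ x → (t x ⊛ (λ i → ∑± L (λ z → u z i))) n}
         {λ x → ∑± L (λ y → (t x ⊛ u y) n)} (λ i _ → ⊛-∑ (-ᶻ + L) (suc (L + L)) u (t (-ᶻ + K +ᶻ + i)) n) ⟩
  ∑± K (λ x → ∑± L (λ y → (t x ⊛ u y) n)) ∎
  where open ≡-Reasoning

Summable-⊛ : ∀ m {t} → Summable t → Summable (λ z → m ⊛ t z)
Summable-⊛ m {t} σ n z l = trans
  (coeff≤ (⊛-cong[] {a = m} ≈[]-refl (Summable-≈[] {t} σ {n} {z} l)) n ℕₚ.≤-refl)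
  (coeff (zeroʳ m) n)

bilateral-scale : ∀ m {t} → Summable t → bilateral (λ z → m ⊛ t z) ≈ m ⊛ bilateral t
bilateral-scale m {t} σ = coeffs λ n → trans
  (sym (⊛-∑ (-ᶻ + suc n) (suc (suc n + suc n)) t m n))
  (coeff≤ (⊛-cong[] {a = m} ≈[]-refl (≈[]-sym (bilateral-≈[] {t} σ ℕₚ.≤-refl))) n ℕₚ.≤-refl)

∑±-cong : ∀ {K g h} → (∀ z → ∣ z ∣ ≤ K → g z ≡ h z) → ∑± K g ≡ ∑± K h
∑±-cong {K} {g} {h} p = ∑-cong (-ᶻ + K) (suc (K + K)) {g} {h} λ i i≤2K → p _ (inside i (ℕ.s≤s⁻¹ i≤2K))
  where
  inside : ∀ i → i ≤ K + K → ∣ -ᶻ + K +ᶻ + i ∣ ≤ K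
  inside i l rewrite ℤₚ.-m+n≡n⊖m K i with ℕₚ.≤-total i K
  ... | inj₁ i≤K rewrite ℤₚ.∣⊖∣-≤ i≤K = ℕₚ.m∸n≤m K i
  ... | inj₂ K≤i rewrite ℤₚ.∣m⊖n∣≡∣n⊖m∣ i K | ℤₚ.∣⊖∣-≤ K≤i =
    subst (i ∸ K ≤_) (ℕₚ.m+n∸n≡m K K) (ℕₚ.∸-monoˡ-≤ K l)

distance-below : ∀ {K} z → ∣ z ∣ ≤ K → ∃ λ d → + d ≡ + K -ᶻ z
distance-below {K} (+ k)    l = K ∸ k , trans (sym (ℤₚ.⊖-≥ l)) (sym (ℤₚ.m-n≡m⊖n K k))
distance-below {K} -[1+ k ] l = K + suc k , refl

distance-above : ∀ {K} z → ∣ z ∣ ≤ K → ∃ λ d → + d ≡ + K +ᶻ z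
distance-above {K} z l
  with d , p ← distance-below {K} (-ᶻ z) (subst (_≤ K) (sym (ℤₚ.∣-i∣≡∣i∣ z)) l) =
  d , trans p (cong (+ K +ᶻ_) (ℤₚ.neg-involutive z))

-- `∑-support` with overshoots given as integers, so that both equations can be left to the ring
-- solver.
∑-around : ∀ {K g} → Supported K g → ∀ {d e lo l} →
  -ᶻ + K ≡ lo +ᶻ d → + l ≡ d +ᶻ (1ℤ +ᶻ (+ K +ᶻ + K) +ᶻ e) →
  ∀ {d′ e′} → + d′ ≡ d → + e′ ≡ e → ∑ lo l g ≡ ∑± K g
∑-around supp p q {d′} {e′} refl refl = ∑-support supp d′ e′ p (ℤₚ.+-injective q)

-- Summation over ℤ² in the coordinates x = t - s, y = t + s or x = t - s, y = t + s + 1.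
∑-rotate : ∀ (F : ℤ → ℤ → ℤ) K →
  (∀ x y → K < ∣ x ∣ → F x y ≡ 0ℤ) → (∀ x y → K < ∣ y ∣ → F x y ≡ 0ℤ) →
  ∑± K (λ x → ∑± K (F x)) ≡
  ∑± K (λ s → ∑± (K + K) (λ t → F (t -ᶻ s) (t +ᶻ s))) +ᶻ
  ∑± K (λ s → ∑± (K + K) (λ t → F (t -ᶻ s) (1ℤ +ᶻ (t +ᶻ s))))
∑-rotate F K supp₁ supp₂ = begin
  ∑± K (λ x → ∑± K (F x))
    ≡⟨ ∑±-cong {K} shear ⟩
  -- The difference k = y - x runs over -2K, ..., 2K + 1; the last place is padding that makes the
  -- length even, so that k = 2s and k = 2s + 1 share the window -K ≤ s ≤ K.
  ∑± K (λ x → ∑ (lo +ᶻ lo) (l + l) (λ k → F x (x +ᶻ k)))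
    ≡⟨ ∑-swap lo l (lo +ᶻ lo) (l + l) (λ x k → F x (x +ᶻ k)) ⟩
  ∑ (lo +ᶻ lo) (l + l) (λ k → ∑± K (λ x → F x (x +ᶻ k)))
    ≡⟨ ∑-parity lo l (λ k → ∑± K (λ x → F x (x +ᶻ k))) ⟩
  ∑± K (λ s → ∑± K (λ x → F x (x +ᶻ (s +ᶻ s)))) +ᶻ
  ∑± K (λ s → ∑± K (λ x → F x (x +ᶻ (1ℤ +ᶻ (s +ᶻ s)))))
    ≡⟨ cong₂ _+ᶻ_
         -- Substituting t = x + s makes the formula symmetric; as both x and s are at most K in
         -- absolute value, t stays within 2K.
         (∑±-cong {K} λ s ∣s∣≤K → recentre s ∣s∣≤K (λ x → F x (x +ᶻ (s +ᶻ s)))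
           (λ x → supp₁ x _) (λ t → F (t -ᶻ s) (t +ᶻ s))
           (λ t → cong₂ F (arith₁ t s) (arith₂ t s)))
         (∑±-cong {K} λ s ∣s∣≤K → recentre s ∣s∣≤K (λ x → F x (x +ᶻ (1ℤ +ᶻ (s +ᶻ s))))
           (λ x → supp₁ x _) (λ t → F (t -ᶻ s) (1ℤ +ᶻ (t +ᶻ s)))
           (λ t → cong₂ F (arith₁ t s) (arith₃ t s))) ⟩
  ∑± K (λ s → ∑± (K + K) (λ t → F (t -ᶻ s) (t +ᶻ s))) +ᶻ
  ∑± K (λ s → ∑± (K + K) (λ t → F (t -ᶻ s) (1ℤ +ᶻ (t +ᶻ s)))) ∎
  where
  open ≡-Reasoning
  lo = -ᶻ + K
  l = suc (K + K)
  arith₁ : ∀ t s → t -ᶻ s ≡ -ᶻ s +ᶻ t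
  arith₁ = solve-∀
  arith₂ : ∀ t s → t +ᶻ s ≡ -ᶻ s +ᶻ t +ᶻ (s +ᶻ s)
  arith₂ = solve-∀
  arith₃ : ∀ t s → 1ℤ +ᶻ (t +ᶻ s) ≡ -ᶻ s +ᶻ t +ᶻ (1ℤ +ᶻ (s +ᶻ s))
  arith₃ = solve-∀
  shear : ∀ x → ∣ x ∣ ≤ K → ∑± K (F x) ≡ ∑ (lo +ᶻ lo) (l + l) (λ k → F x (x +ᶻ k))
  shear x ∣x∣≤K
    with d , p ← distance-below x ∣x∣≤K | e , q ← distance-above x ∣x∣≤K =
    sym (trans (∑-shift x (lo +ᶻ lo) (l + l) (F x))
      (∑-around (supp₂ x) (eq₁ (+ K) x) (eq₂ (+ K) x) p (cong (1ℤ +ᶻ_) q)))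
    where
    eq₁ : ∀ k x → -ᶻ k ≡ x +ᶻ (-ᶻ k +ᶻ -ᶻ k) +ᶻ (k -ᶻ x)
    eq₁ = solve-∀
    eq₂ : ∀ k x → (1ℤ +ᶻ (k +ᶻ k)) +ᶻ (1ℤ +ᶻ (k +ᶻ k)) ≡
      k -ᶻ x +ᶻ (1ℤ +ᶻ (k +ᶻ k) +ᶻ (1ℤ +ᶻ (k +ᶻ x)))
    eq₂ = solve-∀
  recentre : ∀ s → ∣ s ∣ ≤ K → ∀ g → Supported K g → ∀ h → (∀ t → h t ≡ g (-ᶻ s +ᶻ t)) →
    ∑± K g ≡ ∑± (K + K) h
  recentre s ∣s∣≤K g supp h p
    with d , q ← distance-below s ∣s∣≤K | e , r ← distance-above s ∣s∣≤K =
    sym (trans (∑-cong (-ᶻ + (K + K)) (suc (K + K + (K + K))) {h} {λ t → g (-ᶻ s +ᶻ t)} (λ i _ → p _))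
      (trans (∑-shift (-ᶻ s) (-ᶻ + (K + K)) (suc (K + K + (K + K))) g)
        (∑-around supp (eq₁ (+ K) s) (eq₂ (+ K) s) r q)))
    where
    eq₁ : ∀ k s → -ᶻ k ≡ -ᶻ s +ᶻ -ᶻ (k +ᶻ k) +ᶻ (k +ᶻ s)
    eq₁ = solve-∀
    eq₂ : ∀ k s → 1ℤ +ᶻ (k +ᶻ k +ᶻ (k +ᶻ k)) ≡ k +ᶻ s +ᶻ (1ℤ +ᶻ (k +ᶻ k) +ᶻ (k -ᶻ s))
    eq₂ = solve-∀

-- Products of two theta functions as minors

+^ˢ : ∀ z → Sign.+ ^ˢ z ≡ Sign.+
+^ˢ (+ zero)      = refl
+^ˢ (+ suc n)     = +^ˢ (+ n)
+^ˢ -[1+ zero ]   = refl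
+^ˢ -[1+ suc n ]  = +^ˢ -[1+ n ]

^ˢ-even : ∀ s w z → s ^ˢ (w +ᶻ (z +ᶻ z)) ≡ s ^ˢ w
^ˢ-even s w (+ n) = positive n w
  where
  arith : ∀ w z → w +ᶻ ((1ℤ +ᶻ z) +ᶻ (1ℤ +ᶻ z)) ≡ 1ℤ +ᶻ (1ℤ +ᶻ (w +ᶻ (z +ᶻ z)))
  arith = solve-∀
  positive : ∀ n w → s ^ˢ (w +ᶻ (+ n +ᶻ + n)) ≡ s ^ˢ w
  positive zero    w = cong (s ^ˢ_) (ℤₚ.+-identityʳ w)
  positive (suc n) w = begin
    s ^ˢ (w +ᶻ (+ suc n +ᶻ + suc n))          ≡⟨ cong (s ^ˢ_) (arith w (+ n)) ⟩
    s ^ˢ (1ℤ +ᶻ (1ℤ +ᶻ (w +ᶻ (+ n +ᶻ + n))))  ≡⟨ ^ˢ-suc s (1ℤ +ᶻ (w +ᶻ (+ n +ᶻ + n))) ⟩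
    s Sign.* s ^ˢ (1ℤ +ᶻ (w +ᶻ (+ n +ᶻ + n))) ≡⟨ cong (s Sign.*_) (^ˢ-suc s (w +ᶻ (+ n +ᶻ + n))) ⟩
    s Sign.* (s Sign.* s ^ˢ (w +ᶻ (+ n +ᶻ + n))) ≡⟨ sign-cancel s (s ^ˢ (w +ᶻ (+ n +ᶻ + n))) ⟩
    s ^ˢ (w +ᶻ (+ n +ᶻ + n))                  ≡⟨ positive n w ⟩
    s ^ˢ w ∎
    where open ≡-Reasoning
^ˢ-even s w -[1+ n ] = sym (trans (cong (s ^ˢ_) (arith w (+ suc n)))
  (^ˢ-even s (w +ᶻ (-[1+ n ] +ᶻ -[1+ n ])) (+ suc n)))
  where
  arith : ∀ w z → w ≡ w +ᶻ (-ᶻ z +ᶻ -ᶻ z) +ᶻ (z +ᶻ z)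
  arith = solve-∀

sign-even : ∀ s t z → s ^ˢ (t -ᶻ z) Sign.* s ^ˢ (t +ᶻ z) ≡ Sign.+
sign-even s t z = trans
  (cong (s ^ˢ (t -ᶻ z) Sign.*_)
    (trans (cong (s ^ˢ_) (arith t z)) (^ˢ-even s (t -ᶻ z) z)))
  (Signₚ.s*s≡+ (s ^ˢ (t -ᶻ z)))
  where
  arith : ∀ t z → t +ᶻ z ≡ t -ᶻ z +ᶻ (z +ᶻ z)
  arith = solve-∀

-- The two indices differ by an odd number, which leaves exactly one factor s: the sign between the
-- two terms of the minor.
sign-odd : ∀ s t z → s ^ˢ (t -ᶻ z) Sign.* s ^ˢ (1ℤ +ᶻ (t +ᶻ z)) ≡ s
sign-odd s t z = begin
  x Sign.* s ^ˢ (1ℤ +ᶻ (t +ᶻ z))  ≡⟨ cong (x Sign.*_) (^ˢ-suc s (t +ᶻ z)) ⟩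
  x Sign.* (s Sign.* y)           ≡⟨ Signₚ.*-assoc x s y ⟨
  x Sign.* s Sign.* y             ≡⟨ cong (Sign._* y) (Signₚ.*-comm x s) ⟩
  s Sign.* x Sign.* y             ≡⟨ Signₚ.*-assoc s x y ⟩
  s Sign.* (x Sign.* y)           ≡⟨ cong (s Sign.*_) (sign-even s t z) ⟩
  s Sign.* Sign.+                 ≡⟨ Signₚ.*-identityʳ s ⟩
  s ∎
  where
  open ≡-Reasoning
  x = s ^ˢ (t -ᶻ z)
  y = s ^ˢ (t +ᶻ z)

private
  double-sum : ∀ m n → + 2 *ᶻ + (m + n) ≡ + 2 *ᶻ + m +ᶻ + 2 *ᶻ + n
  double-sum m n = ℤₚ.*-distribˡ-+ (+ 2) (+ m) (+ n)

  double-exponents : ∀ α β γ δ w z → + 2 *ᶻ + (exponent α β w + exponent γ δ z) ≡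
    (+ α *ᶻ (w *ᶻ (w +ᶻ 1ℤ)) +ᶻ + β *ᶻ (w *ᶻ (w -ᶻ 1ℤ))) +ᶻ
    (+ γ *ᶻ (z *ᶻ (z +ᶻ 1ℤ)) +ᶻ + δ *ᶻ (z *ᶻ (z -ᶻ 1ℤ)))
  double-exponents α β γ δ w z = trans (double-sum (exponent α β w) (exponent γ δ z))
    (cong₂ _+ᶻ_ (double-exponent α β w) (double-exponent γ δ z))

module _ (s : Sign) (Y D X′ : ℕ) where
  private
    X Y′ : ℕ
    X  = Y + double D
    Y′ = X′ + double D

  -- Both theta functions have modulus Y + 2D + X′, so the cross terms z t of the two quadratic
  -- forms cancel and the exponent separates.
  exponent-even : ∀ z t →
    exponent (Y + D) (X′ + D) (t -ᶻ z) + exponent D (Y + D + X′) (t +ᶻ z) ≡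
    exponent Y′ (Y′ + double Y) z + exponent X (X + double X′) t
  exponent-even z t = double-injective (trans
    (double-exponents (Y + D) (X′ + D) D (Y + D + X′) (t -ᶻ z) (t +ᶻ z))
    (trans (arith (+ Y) (+ D) (+ X′) z t)
      (sym (double-exponents Y′ (Y′ + double Y) X (X + double X′) z t))))
    where
    arith : ∀ y d x z t →
      ((y +ᶻ d) *ᶻ ((t -ᶻ z) *ᶻ (t -ᶻ z +ᶻ 1ℤ)) +ᶻ (x +ᶻ d) *ᶻ ((t -ᶻ z) *ᶻ (t -ᶻ z -ᶻ 1ℤ))) +ᶻ
      (d *ᶻ ((t +ᶻ z) *ᶻ (t +ᶻ z +ᶻ 1ℤ)) +ᶻ (y +ᶻ d +ᶻ x) *ᶻ ((t +ᶻ z) *ᶻ (t +ᶻ z -ᶻ 1ℤ))) ≡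
      ((x +ᶻ (d +ᶻ d)) *ᶻ (z *ᶻ (z +ᶻ 1ℤ)) +ᶻ
        (x +ᶻ (d +ᶻ d) +ᶻ (y +ᶻ y)) *ᶻ (z *ᶻ (z -ᶻ 1ℤ))) +ᶻ
      ((y +ᶻ (d +ᶻ d)) *ᶻ (t *ᶻ (t +ᶻ 1ℤ)) +ᶻ
        (y +ᶻ (d +ᶻ d) +ᶻ (x +ᶻ x)) *ᶻ (t *ᶻ (t -ᶻ 1ℤ)))
    arith = solve-∀

  -- The shift of one index by 1 reverses both series, exchanging the two parameters of each
  -- `exponent`, and leaves the constant D, the power of q in the minor.
  exponent-odd : ∀ z t →
    exponent (Y + D) (X′ + D) (t -ᶻ z) + exponent D (Y + D + X′) (1ℤ +ᶻ (t +ᶻ z)) ≡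
    D + (exponent (Y + double Y′) Y z + exponent (X′ + double X) X′ t)
  exponent-odd z t = double-injective (trans
    (double-exponents (Y + D) (X′ + D) D (Y + D + X′) (t -ᶻ z) (1ℤ +ᶻ (t +ᶻ z)))
    (trans (arith (+ Y) (+ D) (+ X′) z t)
      (sym (trans (double-sum D _) (cong (+ 2 *ᶻ + D +ᶻ_)
        (double-exponents (Y + double Y′) Y (X′ + double X) X′ z t))))))
    where
    arith : ∀ y d x z t →
      ((y +ᶻ d) *ᶻ ((t -ᶻ z) *ᶻ (t -ᶻ z +ᶻ 1ℤ)) +ᶻ (x +ᶻ d) *ᶻ ((t -ᶻ z) *ᶻ (t -ᶻ z -ᶻ 1ℤ))) +ᶻ
      (d *ᶻ ((1ℤ +ᶻ (t +ᶻ z)) *ᶻ (1ℤ +ᶻ (t +ᶻ z) +ᶻ 1ℤ)) +ᶻ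
        (y +ᶻ d +ᶻ x) *ᶻ ((1ℤ +ᶻ (t +ᶻ z)) *ᶻ (1ℤ +ᶻ (t +ᶻ z) -ᶻ 1ℤ))) ≡
      + 2 *ᶻ d +ᶻ
      (((y +ᶻ (x +ᶻ (d +ᶻ d) +ᶻ (x +ᶻ (d +ᶻ d)))) *ᶻ (z *ᶻ (z +ᶻ 1ℤ)) +ᶻ y *ᶻ (z *ᶻ (z -ᶻ 1ℤ))) +ᶻ
       ((x +ᶻ (y +ᶻ (d +ᶻ d) +ᶻ (y +ᶻ (d +ᶻ d)))) *ᶻ (t *ᶻ (t +ᶻ 1ℤ)) +ᶻ x *ᶻ (t *ᶻ (t -ᶻ 1ℤ))))
    arith = solve-∀

  term-even : ∀ z t → term s (Y + D) (X′ + D) (t -ᶻ z) ⊛ term s D (Y + D + X′) (t +ᶻ z) ≈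
    term Sign.+ Y′ (Y′ + double Y) z ⊛ term Sign.+ X (X + double X′) t
  term-even z t = begin
    term s (Y + D) (X′ + D) (t -ᶻ z) ⊛ term s D (Y + D + X′) (t +ᶻ z)
      ≈⟨ monomial-⊛ (s ^ˢ (t -ᶻ z)) (s ^ˢ (t +ᶻ z))
           (exponent (Y + D) (X′ + D) (t -ᶻ z)) (exponent D (Y + D + X′) (t +ᶻ z)) ⟩
    monomial (s ^ˢ (t -ᶻ z) Sign.* s ^ˢ (t +ᶻ z))
      (exponent (Y + D) (X′ + D) (t -ᶻ z) + exponent D (Y + D + X′) (t +ᶻ z))
      ≡⟨ cong₂ monomial (trans (sign-even s t z) (sym (cong₂ Sign._*_ (+^ˢ z) (+^ˢ t))))
           (exponent-even z t) ⟩
    monomial (Sign.+ ^ˢ z Sign.* Sign.+ ^ˢ t)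
      (exponent Y′ (Y′ + double Y) z + exponent X (X + double X′) t)
      ≈⟨ monomial-⊛ (Sign.+ ^ˢ z) (Sign.+ ^ˢ t) (exponent Y′ (Y′ + double Y) z) (exponent X (X + double X′) t) ⟨
    term Sign.+ Y′ (Y′ + double Y) z ⊛ term Sign.+ X (X + double X′) t ∎
    where open ≈-Reasoning

  term-odd : ∀ z t → term s (Y + D) (X′ + D) (t -ᶻ z) ⊛ term s D (Y + D + X′) (1ℤ +ᶻ (t +ᶻ z)) ≈
    (monomial s D ⊛ term Sign.+ (Y + double Y′) Y z) ⊛ term Sign.+ (X′ + double X) X′ t
  term-odd z t = begin
    term s (Y + D) (X′ + D) (t -ᶻ z) ⊛ term s D (Y + D + X′) (1ℤ +ᶻ (t +ᶻ z))
      ≈⟨ monomial-⊛ (s ^ˢ (t -ᶻ z)) (s ^ˢ (1ℤ +ᶻ (t +ᶻ z))) (exponent (Y + D) (X′ + D) (t -ᶻ z))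
                        (exponent D (Y + D + X′) (1ℤ +ᶻ (t +ᶻ z))) ⟩
    monomial (s ^ˢ (t -ᶻ z) Sign.* s ^ˢ (1ℤ +ᶻ (t +ᶻ z)))
      (exponent (Y + D) (X′ + D) (t -ᶻ z) + exponent D (Y + D + X′) (1ℤ +ᶻ (t +ᶻ z)))
      ≡⟨ cong₂ monomial (trans (sign-odd s t z) (sym (trans (cong (s Sign.*_)
           (cong₂ Sign._*_ (+^ˢ z) (+^ˢ t))) (Signₚ.*-identityʳ s)))) (exponent-odd z t) ⟩
    monomial (s Sign.* (Sign.+ ^ˢ z Sign.* Sign.+ ^ˢ t)) (D + (e + e′))
      ≈⟨ monomial-⊛ s (Sign.+ ^ˢ z Sign.* Sign.+ ^ˢ t) D (e + e′) ⟨
    monomial s D ⊛ monomial (Sign.+ ^ˢ z Sign.* Sign.+ ^ˢ t) (e + e′)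
      ≈⟨ ⊛-congˡ (monomial s D) (monomial-⊛ (Sign.+ ^ˢ z) (Sign.+ ^ˢ t) e e′) ⟨
    monomial s D ⊛ (term Sign.+ (Y + double Y′) Y z ⊛ term Sign.+ (X′ + double X) X′ t)
      ≈⟨ *-assoc (monomial s D) _ _ ⟨
    (monomial s D ⊛ term Sign.+ (Y + double Y′) Y z) ⊛ term Sign.+ (X′ + double X) X′ t ∎
    where
    open ≈-Reasoning
    e  = exponent (Y + double Y′) Y z
    e′ = exponent (X′ + double X) X′ t

-- a x x′ = Σ q^{M n(n-1) + x n} with M = x + x′
a : ℕ → ℕ → Series
a x x′ = J Sign.+ x (x + double x′)

-- With X = Y + 2D, the first parameters Y + D and D are the half sum and half difference of X and
-- Y. For s = - the right side is, up to the weight q^D, the minor of the rows (`a X X′`, `a X′ X`)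
-- and (`a Y Y′`, `a Y′ Y`).
J-product : ∀ s {Y D X′} → 1 ≤ Y → 1 ≤ D → 1 ≤ X′ →
  J s (Y + D) (X′ + D) ⊛ J s D (Y + D + X′) ≈
  a (Y + double D) X′ ⊛ a (X′ + double D) Y ⊕
  monomial s D ⊛ (a X′ (Y + double D) ⊛ a Y (X′ + double D))
J-product s {Y} {D} {X′} y d x = ≈-trans (coeffs rotated) (⊕-cong
  (*-comm (a Y′ Y) (a X X′))
  (≈-trans (⊛-cong (bilateral-scale (monomial s D) (summable₃)) ≈-refl)
    (≈-trans (*-assoc (monomial s D) _ _) (⊛-congˡ (monomial s D)
      -- The odd half yields both series reversed; `J-sym` brings them into the form `a`.
      (≈-trans (⊛-cong (J-sym Sign.+ Y+≥1 y) (J-sym Sign.+ X′+≥1 x)) (*-comm (a Y Y′) (a X′ X)))))))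
  where
  X  = Y + double D
  Y′ = X′ + double D
  X≥1 : 1 ≤ X
  X≥1 = ℕₚ.≤-trans y (ℕₚ.m≤m+n Y (double D))
  Y′≥1 : 1 ≤ Y′
  Y′≥1 = ℕₚ.≤-trans x (ℕₚ.m≤m+n X′ (double D))
  Y+≥1 : 1 ≤ Y + double Y′
  Y+≥1 = ℕₚ.≤-trans y (ℕₚ.m≤m+n Y _)
  X′+≥1 : 1 ≤ X′ + double X
  X′+≥1 = ℕₚ.≤-trans x (ℕₚ.m≤m+n X′ _)
  t₁ = term s (Y + D) (X′ + D)
  t₂ = term s D (Y + D + X′)
  summable₁ : Summable t₁
  summable₁ = Summable-term s (X′ + D) (ℕₚ.≤-trans y (ℕₚ.m≤m+n Y D))
  summable₂ : Summable t₂
  summable₂ = Summable-term s (Y + D + X′) d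
  summable₃ : Summable (term Sign.+ (Y + double Y′) Y)
  summable₃ = Summable-term Sign.+ Y Y+≥1
  rotated : ∀ n → (bilateral t₁ ⊛ bilateral t₂) n ≡
    (a Y′ Y ⊛ a X X′ ⊕
     bilateral (λ z → monomial s D ⊛ term Sign.+ (Y + double Y′) Y z) ⊛
       J Sign.+ (X′ + double X) X′) n
  rotated n = begin
    (bilateral t₁ ⊛ bilateral t₂) n
      ≡⟨ bilateral-⊛ summable₁ summable₂ {n} ℕₚ.≤-refl ℕₚ.≤-refl ⟩
    ∑± K (λ u → ∑± K (F u))
      ≡⟨ ∑-rotate F K
           (λ u v l → trans (coeff≤ (⊛-cong[] (Summable-≈[] summable₁ {z = u} l) (≈[]-refl {t₂ v})) n ℕₚ.≤-refl)
             (coeff (zeroˡ (t₂ v)) n))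
           (λ u v l → trans (coeff≤ (⊛-cong[] (≈[]-refl {t₁ u}) (Summable-≈[] summable₂ {z = v} l)) n ℕₚ.≤-refl)
             (coeff (zeroʳ (t₁ u)) n)) ⟩
    ∑± K (λ z → ∑± (K + K) (λ t → F (t -ᶻ z) (t +ᶻ z))) +ᶻ
    ∑± K (λ z → ∑± (K + K) (λ t → F (t -ᶻ z) (1ℤ +ᶻ (t +ᶻ z))))
      ≡⟨ cong₂ _+ᶻ_
           (∑±-cong {K} λ z _ → ∑±-cong {K + K} λ t _ → coeff (term-even s Y D X′ z t) n)
           (∑±-cong {K} λ z _ → ∑±-cong {K + K} λ t _ → coeff (term-odd s Y D X′ z t) n) ⟩
    ∑± K (λ z → ∑± (K + K) (λ t →
      (term Sign.+ Y′ (Y′ + double Y) z ⊛ term Sign.+ X (X + double X′) t) n)) +ᶻ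
    ∑± K (λ z → ∑± (K + K) (λ t →
      ((monomial s D ⊛ term Sign.+ (Y + double Y′) Y z) ⊛ term Sign.+ (X′ + double X) X′ t) n))
      ≡⟨ cong₂ _+ᶻ_
           (bilateral-⊛ (Summable-term Sign.+ (Y′ + double Y) Y′≥1)
             (Summable-term Sign.+ (X + double X′) X≥1) {n} ℕₚ.≤-refl (ℕₚ.m≤m+n K K))
           (bilateral-⊛ (Summable-⊛ (monomial s D) summable₃)
             (Summable-term Sign.+ X′ X′+≥1) {n} ℕₚ.≤-refl (ℕₚ.m≤m+n K K)) ⟨
    (a Y′ Y ⊛ a X X′ ⊕
     bilateral (λ z → monomial s D ⊛ term Sign.+ (Y + double Y′) Y z) ⊛
       J Sign.+ (X′ + double X) X′) n ∎
    where
    open ≡-Reasoning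
    K = suc n
    F : ℤ → ℤ → ℤ
    F u v = (t₁ u ⊛ t₂ v) n

-- X, Y′ and M enter through equations because different pairs of points reach the same sums with
-- different bracketings.
θ-product : ∀ s {Y D X′ X Y′ M} → 1 ≤ Y → 1 ≤ D → 1 ≤ X′ →
  X ≡ Y + double D → Y′ ≡ X′ + double D → M ≡ X + X′ →
  θ s (Y + D) (X′ + D) ⊛ θ s D (Y + D + X′) ≈
  (binom-limit M ⊛ binom-limit M) ⊛ (a X X′ ⊛ a Y′ Y ⊕ monomial s D ⊛ (a X′ X ⊛ a Y Y′))
θ-product s {Y} {D} {X′} y d x refl refl refl = begin
  θ s (Y + D) (X′ + D) ⊛ θ s D (Y + D + X′)
    ≈⟨ ⊛-cong (triple-product s (ℕₚ.≤-trans y (ℕₚ.m≤m+n Y D)) (ℕₚ.≤-trans x (ℕₚ.m≤m+n X′ D)))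
              (triple-product s d (ℕₚ.≤-trans x (ℕₚ.m≤n+m X′ (Y + D)))) ⟩
  (binom-limit (Y + D + (X′ + D)) ⊛ J₁) ⊛ (binom-limit (D + (Y + D + X′)) ⊛ J₂)
    ≡⟨ cong₂ (λ m n → (binom-limit m ⊛ J₁) ⊛ (binom-limit n ⊛ J₂)) (arith₁ Y D X′) (arith₂ Y D X′) ⟩
  (C ⊛ J₁) ⊛ (C ⊛ J₂)
    ≈⟨ solve 3 (λ c i j → (c :* i) :* (c :* j) := (c :* c) :* (i :* j)) ≈-refl C J₁ J₂ ⟩
  (C ⊛ C) ⊛ (J₁ ⊛ J₂)
    ≈⟨ ⊛-congˡ (C ⊛ C) (J-product s y d x) ⟩
  (C ⊛ C) ⊛ (a (Y + double D) X′ ⊛ a (X′ + double D) Y ⊕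
    monomial s D ⊛ (a X′ (Y + double D) ⊛ a Y (X′ + double D))) ∎
  where
  open ≈-Reasoning
  C  = binom-limit (Y + double D + X′)
  J₁ = J s (Y + D) (X′ + D)
  J₂ = J s D (Y + D + X′)
  arith₁ : ∀ y d x → y + d + (x + d) ≡ y + (d + d) + x
  arith₁ = ℕSolver.solve-∀
  arith₂ : ∀ y d x → d + (y + d + x) ≡ y + (d + d) + x
  arith₂ = ℕSolver.solve-∀

-- Weierstrass' three-term relation

-- The summand K is added to both sides to obtain an identity over semirings.
plücker : ∀ s q₁ q₂ q₃ x x′ y y′ u u′ v v′ →
  q₂ ⊛ ((x ⊛ y′ ⊕ (sgn s ⊛ q₁) ⊛ (x′ ⊛ y)) ⊛ (u ⊛ v′ ⊕ (sgn s ⊛ q₃) ⊛ (u′ ⊛ v))) ⊕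
  (x ⊛ v′ ⊕ (sgn Sign.- ⊛ (q₁ ⊛ q₂ ⊛ q₃)) ⊛ (x′ ⊛ v)) ⊛
    (y ⊛ u′ ⊕ (sgn Sign.- ⊛ q₂) ⊛ (y′ ⊛ u)) ≈
  (x ⊛ u′ ⊕ (sgn s ⊛ (q₁ ⊛ q₂)) ⊛ (x′ ⊛ u)) ⊛
    (y ⊛ v′ ⊕ (sgn s ⊛ (q₂ ⊛ q₃)) ⊛ (y′ ⊛ v))
plücker s q₁ q₂ q₃ x x′ y y′ u u′ v v′ = GroupProperties.∙-cancelʳ +-group K L R (begin
  L ⊕ K
    ≈⟨ ⊕-congˡ L (≈-trans (⊛-cong (square s) ≈-refl) (*-identityˡ K)) ⟨
  L ⊕ (m ⊛ m) ⊛ K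
    ≈⟨ identity ⟩
  R ⊕ (𝟙 ⊕ e) ⊛ P ⊕ (m ⊛ m ⊕ e) ⊛ Q ⊕ (e ⊛ e) ⊛ K
    -- The two sides of `identity` are equal for opaque `m` and `e`; only here do e = -1 and m² = e²
    -- = 1 enter and remove P and Q.
    ≈⟨ ⊕-cong (⊕-cong (⊕-congˡ R (vanish (-‿inverseʳ 𝟙) P))
         (vanish (≈-trans (⊕-cong {b = e} (square s) ≈-refl) (-‿inverseʳ 𝟙)) Q))
         (≈-trans (⊛-cong (square Sign.-) ≈-refl) (*-identityˡ K)) ⟩
  R ⊕ 𝟘 ⊕ 𝟘 ⊕ K
    ≈⟨ ⊕-cong {b = K} (≈-trans (+-identityʳ (R ⊕ 𝟘)) (+-identityʳ R)) ≈-refl ⟩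
  R ⊕ K ∎)
  where
  open ≈-Reasoning
  open CommutativeRing seriesRing using (-‿inverseʳ; +-group)
  m e P Q K L R : Series
  m = sgn s
  e = sgn Sign.-
  P = q₂ ⊛ (x ⊛ y′ ⊛ u ⊛ v′)
  Q = (q₁ ⊛ q₂ ⊛ q₃) ⊛ (x′ ⊛ y ⊛ u′ ⊛ v)
  K = (q₁ ⊛ q₂ ⊛ q₂ ⊛ q₃) ⊛ (x′ ⊛ u ⊛ y′ ⊛ v)
  L = q₂ ⊛ ((x ⊛ y′ ⊕ (m ⊛ q₁) ⊛ (x′ ⊛ y)) ⊛ (u ⊛ v′ ⊕ (m ⊛ q₃) ⊛ (u′ ⊛ v))) ⊕
    (x ⊛ v′ ⊕ (e ⊛ (q₁ ⊛ q₂ ⊛ q₃)) ⊛ (x′ ⊛ v)) ⊛ (y ⊛ u′ ⊕ (e ⊛ q₂) ⊛ (y′ ⊛ u))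
  R = (x ⊛ u′ ⊕ (m ⊛ (q₁ ⊛ q₂)) ⊛ (x′ ⊛ u)) ⊛ (y ⊛ v′ ⊕ (m ⊛ (q₂ ⊛ q₃)) ⊛ (y′ ⊛ v))
  square : ∀ t → sgn t ⊛ sgn t ≈ 𝟙
  square t = ≈-trans (≈-sym (sgn-* t t)) (≡⇒≈ (cong sgn (Signₚ.s*s≡+ t)))
  vanish : ∀ {b} → b ≈ 𝟘 → ∀ c → b ⊛ c ≈ 𝟘
  vanish p c = ≈-trans (⊛-cong p ≈-refl) (zeroˡ c)
  identity : L ⊕ (m ⊛ m) ⊛ K ≈ R ⊕ (𝟙 ⊕ e) ⊛ P ⊕ (m ⊛ m ⊕ e) ⊛ Q ⊕ (e ⊛ e) ⊛ K
  identity = solve 13 (λ m e q₁ q₂ q₃ x x′ y y′ u u′ v v′ →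
    let P = q₂ :* (x :* y′ :* u :* v′)
        Q = (q₁ :* q₂ :* q₃) :* (x′ :* y :* u′ :* v)
        K = (q₁ :* q₂ :* q₂ :* q₃) :* (x′ :* u :* y′ :* v)
        L = q₂ :* ((x :* y′ :+ (m :* q₁) :* (x′ :* y)) :* (u :* v′ :+ (m :* q₃) :* (u′ :* v))) :+
          (x :* v′ :+ (e :* (q₁ :* q₂ :* q₃)) :* (x′ :* v)) :* (y :* u′ :+ (e :* q₂) :* (y′ :* u))
        R = (x :* u′ :+ (m :* (q₁ :* q₂)) :* (x′ :* u)) :* (y :* v′ :+ (m :* (q₂ :* q₃)) :* (y′ :* v))
    in L :+ (m :* m) :* K := R :+ (con 1 :+ e) :* P :+ (m :* m :+ e) :* Q :+ (e :* e) :* K)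
    ≈-refl m e q₁ q₂ q₃ x x′ y y′ u u′ v v′

θθ : Sign → ℕ → ℕ → ℕ → Series
θθ s y d x′ = θ s (y + d) (x′ + d) ⊛ θ s d (y + d + x′)

-- Weierstrass' three-term relation for the points q^(v/2), q^(u/2), q^(y/2), q^(x/2) with
-- u = v + 2 d₃, y = u + 2 d₂, x = y + 2 d₁, in the modulus x + x′. If s = +, the two middle
-- points carry a minus sign.
weierstrass : ∀ s v d₃ d₂ d₁ x′ → 1 ≤ v → 1 ≤ d₃ → 1 ≤ d₂ → 1 ≤ d₁ → 1 ≤ x′ →
  let u  = v + double d₃
      y  = u + double d₂
      y′ = x′ + double d₁
      u′ = y′ + double d₂
  in q^ d₂ ⊛ (θθ s y d₁ x′ ⊛ θθ s v d₃ u′) ⊕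
     θθ Sign.- v (d₁ + d₂ + d₃) x′ ⊛ θθ Sign.- u d₂ y′ ≈
     θθ s u (d₁ + d₂) x′ ⊛ θθ s v (d₂ + d₃) y′
weierstrass s v d₃ d₂ d₁ x′ v≥1 d₃≥1 d₂≥1 d₁≥1 x′≥1 = begin
  q₂ ⊛ (θθ s y d₁ x′ ⊛ θθ s v d₃ u′) ⊕ θθ Sign.- v (d₁ + d₂ + d₃) x′ ⊛ θθ Sign.- u d₂ y′
    ≈⟨ ⊕-cong (⊛-congˡ q₂ (⊛-cong
         (θ-product s y≥1 d₁≥1 x′≥1 refl refl refl)
         (θ-product s v≥1 d₃≥1 u′≥1 refl refl (eq₁ v d₃ d₂ d₁ x′))))
       (⊛-cong
         (≈-trans (θ-product Sign.- v≥1 d₁₂₃≥1 x′≥1 (eq₂ v d₃ d₂ d₁) (eq₃ x′ d₁ d₂ d₃) refl)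
           (shape Sign.- (X ⊛ V′) (X′ ⊛ V) split₃))
         (θ-product Sign.- u≥1 d₂≥1 y′≥1 refl refl (eq₄ v d₃ d₂ d₁ x′))) ⟩
  q₂ ⊛ ((c ⊛ (X ⊛ Y′ ⊕ (sgn s ⊛ q₁) ⊛ (X′ ⊛ Y))) ⊛ (c ⊛ (U ⊛ V′ ⊕ (sgn s ⊛ q₃) ⊛ (U′ ⊛ V)))) ⊕
  (c ⊛ (X ⊛ V′ ⊕ (sgn Sign.- ⊛ (q₁ ⊛ q₂ ⊛ q₃)) ⊛ (X′ ⊛ V))) ⊛
    (c ⊛ (Y ⊛ U′ ⊕ (sgn Sign.- ⊛ q₂) ⊛ (Y′ ⊛ U)))
    ≈⟨ solve 6 (λ q c x y z w →
         q :* ((c :* x) :* (c :* y)) :+ (c :* z) :* (c :* w) :=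
         (c :* c) :* (q :* (x :* y) :+ z :* w)) ≈-refl q₂ c _ _ _ _ ⟩
  (c ⊛ c) ⊛ (q₂ ⊛ ((X ⊛ Y′ ⊕ (sgn s ⊛ q₁) ⊛ (X′ ⊛ Y)) ⊛ (U ⊛ V′ ⊕ (sgn s ⊛ q₃) ⊛ (U′ ⊛ V))) ⊕
    (X ⊛ V′ ⊕ (sgn Sign.- ⊛ (q₁ ⊛ q₂ ⊛ q₃)) ⊛ (X′ ⊛ V)) ⊛
      (Y ⊛ U′ ⊕ (sgn Sign.- ⊛ q₂) ⊛ (Y′ ⊛ U)))
    ≈⟨ ⊛-congˡ (c ⊛ c) (plücker s q₁ q₂ q₃ X X′ Y Y′ U U′ V V′) ⟩
  (c ⊛ c) ⊛ ((X ⊛ U′ ⊕ (sgn s ⊛ (q₁ ⊛ q₂)) ⊛ (X′ ⊛ U)) ⊛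
    (Y ⊛ V′ ⊕ (sgn s ⊛ (q₂ ⊛ q₃)) ⊛ (Y′ ⊛ V)))
    ≈⟨ solve 3 (λ c x y → (c :* x) :* (c :* y) := (c :* c) :* (x :* y)) ≈-refl c _ _ ⟨
  (c ⊛ (X ⊛ U′ ⊕ (sgn s ⊛ (q₁ ⊛ q₂)) ⊛ (X′ ⊛ U))) ⊛
  (c ⊛ (Y ⊛ V′ ⊕ (sgn s ⊛ (q₂ ⊛ q₃)) ⊛ (Y′ ⊛ V)))
    ≈⟨ ⊛-cong
         (≈-trans (θ-product s u≥1 d₁₂≥1 x′≥1 (eq₆ u d₂ d₁) (eq₅ x′ d₁ d₂) refl)
           (shape s (X ⊛ U′) (X′ ⊛ U) (q^-+ d₁ d₂)))
         (≈-trans (θ-product s v≥1 d₂₃≥1 y′≥1 (eq₆ v d₃ d₂) (eq₅ y′ d₂ d₃) (eq₄ v d₃ d₂ d₁ x′))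
           (shape s (Y ⊛ V′) (Y′ ⊛ V) (q^-+ d₂ d₃))) ⟨
  θθ s u (d₁ + d₂) x′ ⊛ θθ s v (d₂ + d₃) y′ ∎
  where
  open ≈-Reasoning
  u  = v + double d₃
  y  = u + double d₂
  x  = y + double d₁
  y′ = x′ + double d₁
  u′ = y′ + double d₂
  v′ = u′ + double d₃
  q₁ = q^ d₁
  q₂ = q^ d₂
  q₃ = q^ d₃
  X  = a x x′
  X′ = a x′ x
  Y  = a y y′
  Y′ = a y′ y
  U  = a u u′
  U′ = a u′ u
  V  = a v v′
  V′ = a v′ v
  c  = binom-limit (x + x′) ⊛ binom-limit (x + x′)
  grow : ∀ {m} n → 1 ≤ m → 1 ≤ m + n
  grow n p = ℕₚ.≤-trans p (ℕₚ.m≤m+n _ n)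
  u≥1 = grow (double d₃) v≥1
  y≥1 = grow (double d₂) u≥1
  y′≥1 = grow (double d₁) x′≥1
  u′≥1 = grow (double d₂) y′≥1
  d₁₂≥1 = grow d₂ d₁≥1
  d₂₃≥1 = grow d₃ d₂≥1
  d₁₂₃≥1 = grow d₃ d₁₂≥1
  split₃ : q^ (d₁ + d₂ + d₃) ≈ q₁ ⊛ q₂ ⊛ q₃
  split₃ = ≈-trans (q^-+ (d₁ + d₂) d₃) (⊛-cong (q^-+ d₁ d₂) ≈-refl)
  shape : ∀ t A B {p r} → p ≈ r → c ⊛ (A ⊕ (sgn t ⊛ p) ⊛ B) ≈ c ⊛ (A ⊕ (sgn t ⊛ r) ⊛ B)
  shape t A B p = ⊛-congˡ c (⊕-congˡ A (⊛-cong (⊛-congˡ (sgn t) p) ≈-refl))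
  eq₁ : ∀ v d₃ d₂ d₁ x′ → v + (d₃ + d₃) + (d₂ + d₂) + (d₁ + d₁) + x′ ≡
    v + (d₃ + d₃) + (x′ + (d₁ + d₁) + (d₂ + d₂))
  eq₁ = ℕSolver.solve-∀
  eq₂ : ∀ v d₃ d₂ d₁ → v + (d₃ + d₃) + (d₂ + d₂) + (d₁ + d₁) ≡
    v + (d₁ + d₂ + d₃ + (d₁ + d₂ + d₃))
  eq₂ = ℕSolver.solve-∀
  eq₃ : ∀ x′ d₁ d₂ d₃ → x′ + (d₁ + d₁) + (d₂ + d₂) + (d₃ + d₃) ≡
    x′ + (d₁ + d₂ + d₃ + (d₁ + d₂ + d₃))
  eq₃ = ℕSolver.solve-∀
  eq₄ : ∀ v d₃ d₂ d₁ x′ → v + (d₃ + d₃) + (d₂ + d₂) + (d₁ + d₁) + x′ ≡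
    v + (d₃ + d₃) + (d₂ + d₂) + (x′ + (d₁ + d₁))
  eq₄ = ℕSolver.solve-∀
  eq₅ : ∀ u d e → u + (d + d) + (e + e) ≡ u + (d + e + (d + e))
  eq₅ = ℕSolver.solve-∀
  eq₆ : ∀ v d₃ d₂ → v + (d₃ + d₃) + (d₂ + d₂) ≡ v + (d₂ + d₃ + (d₂ + d₃))
  eq₆ = ℕSolver.solve-∀

-- Products of theta functions over lists of residues

∏ˡ : (ℕ → Series) → List ℕ → Series
∏ˡ f []       = 𝟙
∏ˡ f (r ∷ rs) = f r ⊛ ∏ˡ f rs

∏ˡ-++ : ∀ f rs ss → ∏ˡ f (rs ++ ss) ≈ ∏ˡ f rs ⊛ ∏ˡ f ss
∏ˡ-++ f []       ss = ≈-sym (*-identityˡ (∏ˡ f ss))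
∏ˡ-++ f (r ∷ rs) ss = ≈-trans (⊛-congˡ (f r) (∏ˡ-++ f rs ss)) (≈-sym (*-assoc (f r) (∏ˡ f rs) (∏ˡ f ss)))

∏ˡ-↭ : ∀ f {rs ss} → rs ↭ ss → ∏ˡ f rs ≈ ∏ˡ f ss
∏ˡ-↭ f ↭.refl                   = ≈-refl
∏ˡ-↭ f (↭.prep r p)             = ⊛-congˡ (f r) (∏ˡ-↭ f p)
∏ˡ-↭ f (↭.swap {rs} {ss} r s p) = ≈-trans
  (solve 3 (λ x y z → x :* (y :* z) := y :* (x :* z)) ≈-refl (f r) (f s) (∏ˡ f rs))
  (⊛-congˡ (f s) (⊛-congˡ (f r) (∏ˡ-↭ f p)))
∏ˡ-↭ f (↭.trans p q)            = ≈-trans (∏ˡ-↭ f p) (∏ˡ-↭ f q)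

-- Turns equality of multisets into an evaluation: for closed lists the hypothesis is `refl`.
sort-≡⇒↭ : ∀ {rs ss} → Sort.sort rs ≡ Sort.sort ss → rs ↭ ss
sort-≡⇒↭ {rs} {ss} p =
  ↭-trans (↭-sym (Sortₚ.sort-↭ rs)) (subst (_↭ ss) (sym p) (Sortₚ.sort-↭ ss))

-- (q^r, q^(60-r); q^60)_∞
θ₆₀ : ℕ → Series
θ₆₀ r = θ Sign.- r (60 ∸ r)

qθ : ℕ → List ℕ → Series
qθ d rs = q^ d ⊛ ∏ˡ θ₆₀ rs

qθ-⊛ : ∀ d rs e ss → qθ d rs ⊛ qθ e ss ≈ qθ (d + e) (rs ++ ss)
qθ-⊛ d rs e ss = begin
  (q^ d ⊛ x) ⊛ (q^ e ⊛ y)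
    ≈⟨ solve 4 (λ a b c d → (a :* b) :* (c :* d) := (a :* c) :* (b :* d)) ≈-refl (q^ d) x (q^ e) y ⟩
  (q^ d ⊛ q^ e) ⊛ (x ⊛ y)
    ≈⟨ ⊛-cong (q^-+ d e) (∏ˡ-++ θ₆₀ rs ss) ⟨
  q^ (d + e) ⊛ ∏ˡ θ₆₀ (rs ++ ss) ∎
  where
  open ≈-Reasoning
  x = ∏ˡ θ₆₀ rs
  y = ∏ˡ θ₆₀ ss

qθ-≈ : ∀ d rs e ss → d ≡ e → Sort.sort rs ≡ Sort.sort ss → qθ d rs ≈ qθ e ss
qθ-≈ d rs _ ss refl p = ⊛-congˡ (q^ d) (∏ˡ-↭ θ₆₀ (sort-≡⇒↭ {rs} {ss} p))

qθ-unit : ∀ rs → qθ 0 rs 0 ≡ 1ℤ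
qθ-unit rs = trans (ℤₚ.*-identityˡ _) (go rs)
  where
  go : ∀ rs → ∏ˡ θ₆₀ rs 0 ≡ 1ℤ
  go []       = refl
  go (r ∷ rs) = trans (ℤₚ.*-identityˡ _) (go rs)

-- A theta function of modulus M belongs to r and to M - r alike; taking the smaller residue makes
-- lists of residues comparable.
θ-fold : ∀ s {α β M} → α + β ≡ M → θ s α β ≈ θ s (α ⊓ β) (M ∸ (α ⊓ β))
θ-fold s {α} {β} refl with ℕₚ.≤-total α β
... | inj₁ α≤β rewrite ℕₚ.m≤n⇒m⊓n≡m α≤β | ℕₚ.m+n∸m≡n α β = ≈-refl
... | inj₂ β≤α rewrite ℕₚ.m≥n⇒m⊓n≡n β≤α | ℕₚ.m+n∸n≡m α β = θ-sym s α β

-- Only the first residue has to be folded: 2d ≤ M makes d the smaller of its pair already.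
θθ-fold : ∀ s y d x′ {M} → y + double d + x′ ≡ M →
  θθ s y d x′ ≈ θ s ((y + d) ⊓ (x′ + d)) (M ∸ (y + d) ⊓ (x′ + d)) ⊛ θ s d (M ∸ d)
θθ-fold s y d x′ refl = ⊛-cong (θ-fold s (arith y d x′)) (≡⇒≈ (cong (θ s d) complement))
  where
  arith : ∀ y d x → y + d + (x + d) ≡ y + (d + d) + x
  arith = ℕSolver.solve-∀
  arith′ : ∀ y d x → y + (d + d) + x ≡ d + (y + d + x)
  arith′ = ℕSolver.solve-∀
  complement : y + d + x′ ≡ y + double d + x′ ∸ d
  complement = sym (trans (cong (_∸ d) (arith′ y d x′)) (ℕₚ.m+n∸m≡n d (y + d + x′)))

flatten : ∀ (f : ℕ → Series) i j k l → (f i ⊛ f j) ⊛ (f k ⊛ f l) ≈ ∏ˡ f (i ∷ j ∷ k ∷ l ∷ [])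
flatten f i j k l = solve 4 (λ i j k l →
  (i :* j) :* (k :* l) := i :* (j :* (k :* (l :* con 1)))) ≈-refl (f i) (f j) (f k) (f l)

module _ (v d₃ d₂ d₁ x′ : ℕ) where
  private
    u y x y′ u′ : ℕ
    u  = v + double d₃
    y  = u + double d₂
    x  = y + double d₁
    y′ = x′ + double d₁
    u′ = y′ + double d₂

  residues₁ residues₂ residues₃ : List ℕ
  residues₁ = (y + d₁) ⊓ (x′ + d₁) ∷ d₁ ∷ (v + d₃) ⊓ (u′ + d₃) ∷ d₃ ∷ []
  residues₂ = (v + (d₁ + d₂ + d₃)) ⊓ (x′ + (d₁ + d₂ + d₃)) ∷ d₁ + d₂ + d₃ ∷
              (u + d₂) ⊓ (y′ + d₂) ∷ d₂ ∷ []
  residues₃ = (u + (d₁ + d₂)) ⊓ (x′ + (d₁ + d₂)) ∷ d₁ + d₂ ∷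
              (v + (d₂ + d₃)) ⊓ (y′ + (d₂ + d₃)) ∷ d₂ + d₃ ∷ []

  weierstrass-fold : ∀ s M → x + x′ ≡ M →
    1 ≤ v → 1 ≤ d₃ → 1 ≤ d₂ → 1 ≤ d₁ → 1 ≤ x′ →
    q^ d₂ ⊛ ∏ˡ (λ r → θ s r (M ∸ r)) residues₁ ⊕ ∏ˡ (λ r → θ Sign.- r (M ∸ r)) residues₂ ≈
    ∏ˡ (λ r → θ s r (M ∸ r)) residues₃
  weierstrass-fold s M p v≥1 d₃≥1 d₂≥1 d₁≥1 x′≥1 = begin
    q^ d₂ ⊛ ∏ˡ (λ r → θ s r (M ∸ r)) residues₁ ⊕ ∏ˡ (λ r → θ Sign.- r (M ∸ r)) residues₂
      ≈⟨ ⊕-cong (⊛-congˡ (q^ d₂) (≈-trans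
             (⊛-cong (θθ-fold s y d₁ x′ p) (θθ-fold s v d₃ u′ (trans (eq₁ v d₃ d₂ d₁ x′) p)))
             (flatten (λ r → θ s r (M ∸ r)) _ _ _ _)))
           (≈-trans (⊛-cong (θθ-fold Sign.- v (d₁ + d₂ + d₃) x′ (trans (eq₂ v d₃ d₂ d₁ x′) p))
                            (θθ-fold Sign.- u d₂ y′ (trans (eq₃ v d₃ d₂ d₁ x′) p)))
             (flatten (λ r → θ Sign.- r (M ∸ r)) _ _ _ _)) ⟨
    q^ d₂ ⊛ (θθ s y d₁ x′ ⊛ θθ s v d₃ u′) ⊕
    θθ Sign.- v (d₁ + d₂ + d₃) x′ ⊛ θθ Sign.- u d₂ y′
      ≈⟨ weierstrass s v d₃ d₂ d₁ x′ v≥1 d₃≥1 d₂≥1 d₁≥1 x′≥1 ⟩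
    θθ s u (d₁ + d₂) x′ ⊛ θθ s v (d₂ + d₃) y′
      ≈⟨ ≈-trans (⊛-cong (θθ-fold s u (d₁ + d₂) x′ (trans (eq₄ v d₃ d₂ d₁ x′) p))
                         (θθ-fold s v (d₂ + d₃) y′ (trans (eq₅ v d₃ d₂ d₁ x′) p)))
           (flatten (λ r → θ s r (M ∸ r)) _ _ _ _) ⟩
    ∏ˡ (λ r → θ s r (M ∸ r)) residues₃ ∎
    where
    open ≈-Reasoning
    eq₁ : ∀ v d₃ d₂ d₁ x′ → v + (d₃ + d₃) + (x′ + (d₁ + d₁) + (d₂ + d₂)) ≡
      v + (d₃ + d₃) + (d₂ + d₂) + (d₁ + d₁) + x′
    eq₁ = ℕSolver.solve-∀
    eq₂ : ∀ v d₃ d₂ d₁ x′ → v + (d₁ + d₂ + d₃ + (d₁ + d₂ + d₃)) + x′ ≡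
      v + (d₃ + d₃) + (d₂ + d₂) + (d₁ + d₁) + x′
    eq₂ = ℕSolver.solve-∀
    eq₃ : ∀ v d₃ d₂ d₁ x′ → v + (d₃ + d₃) + (d₂ + d₂) + (x′ + (d₁ + d₁)) ≡
      v + (d₃ + d₃) + (d₂ + d₂) + (d₁ + d₁) + x′
    eq₃ = ℕSolver.solve-∀
    eq₄ : ∀ v d₃ d₂ d₁ x′ → v + (d₃ + d₃) + (d₁ + d₂ + (d₁ + d₂)) + x′ ≡
      v + (d₃ + d₃) + (d₂ + d₂) + (d₁ + d₁) + x′
    eq₄ = ℕSolver.solve-∀
    eq₅ : ∀ v d₃ d₂ d₁ x′ → v + (d₂ + d₃ + (d₂ + d₃)) + (x′ + (d₁ + d₁)) ≡
      v + (d₃ + d₃) + (d₂ + d₂) + (d₁ + d₁) + x′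
    eq₅ = ℕSolver.solve-∀

  weierstrass₆₀ : x + x′ ≡ 60 → 1 ≤ v → 1 ≤ d₃ → 1 ≤ d₂ → 1 ≤ d₁ → 1 ≤ x′ →
    qθ d₂ residues₁ ⊕ qθ 0 residues₂ ≈ qθ 0 residues₃
  weierstrass₆₀ p v≥1 d₃≥1 d₂≥1 d₁≥1 x′≥1 = ≈-trans
    (⊕-congˡ (qθ d₂ residues₁) (*-identityˡ (∏ˡ θ₆₀ residues₂)))
    (≈-trans (weierstrass-fold Sign.- 60 p v≥1 d₃≥1 d₂≥1 d₁≥1 x′≥1)
      (≈-sym (*-identityˡ (∏ˡ θ₆₀ residues₃))))

-- From modulus 30 to modulus 60

θ₃₀ η : ℕ → Series
θ₃₀ r = θ Sign.- r (30 ∸ r)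
η r   = θ Sign.+ r (30 ∸ r)

pairs : List ℕ → List ℕ
pairs []       = []
pairs (r ∷ rs) = r ∷ 30 ∸ r ∷ pairs rs

InRange : ℕ → Set
InRange r = 1 ≤ r × r < 30

θ₃₀-split : ∀ {r} → InRange r → θ₃₀ r ≈ θ₆₀ r ⊛ θ₆₀ (30 ∸ r)
θ₃₀-split {r} (r≥1 , r<30) =
  subst₂ (λ α β → θ₃₀ r ≈ θ Sign.- r α ⊛ θ Sign.- (30 ∸ r) β) eq₁ eq₂
    (θ-dissect Sign.- r≥1 (ℕₚ.m<n⇒0<n∸m r<30))
  where
  r+ : r + (30 ∸ r) ≡ 30
  r+ = ℕₚ.m+[n∸m]≡n (ℕₚ.<⇒≤ r<30)
  arith : ∀ r c → r + (r + (c + c)) ≡ (r + c) + (r + c)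
  arith = ℕSolver.solve-∀
  arith′ : ∀ r c → c + (c + (r + r)) ≡ (r + c) + (r + c)
  arith′ = ℕSolver.solve-∀
  complement : ∀ {m n} → m + n ≡ 60 → n ≡ 60 ∸ m
  complement {m} {n} p = trans (sym (ℕₚ.m+n∸m≡n m n)) (cong (_∸ m) p)
  eq₁ : r + double (30 ∸ r) ≡ 60 ∸ r
  eq₁ = complement {r} (trans (arith r (30 ∸ r)) (cong₂ _+_ r+ r+))
  eq₂ : 30 ∸ r + double r ≡ 60 ∸ (30 ∸ r)
  eq₂ = complement {30 ∸ r} (trans (arith′ r (30 ∸ r)) (cong₂ _+_ r+ r+))

η-split : ∀ {r} → InRange r → η r ⊛ (θ₆₀ r ⊛ θ₆₀ (30 ∸ r)) ≈ θ₆₀ (double r)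
η-split {r} i@(r≥1 , r<30) = begin
  η r ⊛ (θ₆₀ r ⊛ θ₆₀ (30 ∸ r))          ≈⟨ ⊛-congˡ (η r) (θ₃₀-split i) ⟨
  η r ⊛ θ₃₀ r                           ≈⟨ θ-conjugates r≥1 (ℕₚ.m<n⇒0<n∸m r<30) ⟩
  θ Sign.- (double r) (double (30 ∸ r)) ≡⟨ cong (θ Sign.- (double r)) complement ⟩
  θ₆₀ (double r) ∎
  where
  open ≈-Reasoning
  arith : ∀ r c → (r + c) + (r + c) ≡ (r + r) + (c + c)
  arith = ℕSolver.solve-∀
  r+ : r + (30 ∸ r) ≡ 30
  r+ = ℕₚ.m+[n∸m]≡n (ℕₚ.<⇒≤ r<30)
  complement : double (30 ∸ r) ≡ 60 ∸ double r
  complement = trans (sym (ℕₚ.m+n∸m≡n (double r) _))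
    (cong (_∸ double r) (trans (sym (arith r (30 ∸ r))) (cong₂ _+_ r+ r+)))

θ₃₀-pairs : ∀ {rs} → All InRange rs → ∏ˡ θ₃₀ rs ≈ ∏ˡ θ₆₀ (pairs rs)
θ₃₀-pairs []                    = ≈-refl
θ₃₀-pairs {r ∷ rs} (i ∷ is) = ≈-trans (⊛-cong (θ₃₀-split i) (θ₃₀-pairs is))
  (*-assoc (θ₆₀ r) (θ₆₀ (30 ∸ r)) (∏ˡ θ₆₀ (pairs rs)))

η-pairs : ∀ {rs} → All InRange rs → ∏ˡ η rs ⊛ ∏ˡ θ₆₀ (pairs rs) ≈ ∏ˡ θ₆₀ (map double rs)
η-pairs []                = *-identityˡ 𝟙
η-pairs {r ∷ rs} (i ∷ is) = ≈-trans
  (solve 5 (λ h hs x y t → (h :* hs) :* (x :* (y :* t)) := (h :* (x :* y)) :* (hs :* t)) ≈-refl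
    (η r) (∏ˡ η rs) (θ₆₀ r) (θ₆₀ (30 ∸ r)) (∏ˡ θ₆₀ (pairs rs)))
  (⊛-cong (η-split i) (η-pairs is))

-- The relation is multiplied by the θ₆₀ over `pairs as` and `pairs bs`. By `η-pairs` each list of
-- `η` then consumes its own pairs and becomes θ₆₀ at the doubled residues, while the other pairs
-- remain as cofactor.
clear-η : ∀ {d as rs bs} → All InRange as → All InRange rs → All InRange bs →
  q^ d ⊛ ∏ˡ η as ⊕ ∏ˡ θ₃₀ rs ≈ ∏ˡ η bs →
  qθ d (map double as ++ pairs bs) ⊕ qθ 0 (pairs rs ++ pairs as ++ pairs bs) ≈
  qθ 0 (map double bs ++ pairs as)
clear-η {d} {as} {rs} {bs} ia ir ib p = begin
  q^ d ⊛ ∏ˡ θ₆₀ (map double as ++ pairs bs) ⊕ 𝟙 ⊛ ∏ˡ θ₆₀ (pairs rs ++ pairs as ++ pairs bs)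
    ≈⟨ ⊕-cong
         (⊛-congˡ (q^ d) (≈-trans (∏ˡ-++ θ₆₀ (map double as) (pairs bs)) (⊛-cong (≈-sym (η-pairs ia)) ≈-refl)))
         (⊛-congˡ 𝟙 (≈-trans (∏ˡ-++ θ₆₀ (pairs rs) (pairs as ++ pairs bs))
           (⊛-cong (≈-sym (θ₃₀-pairs ir)) (∏ˡ-++ θ₆₀ (pairs as) (pairs bs))))) ⟩
  q^ d ⊛ (∏ˡ η as ⊛ A ⊛ B) ⊕ 𝟙 ⊛ (∏ˡ θ₃₀ rs ⊛ (A ⊛ B))
    ≈⟨ solve 5 (λ q h t a b → q :* (h :* a :* b) :+ con 1 :* (t :* (a :* b)) :=
         (q :* h :+ t) :* (a :* b)) ≈-refl (q^ d) (∏ˡ η as) (∏ˡ θ₃₀ rs) A B ⟩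
  (q^ d ⊛ ∏ˡ η as ⊕ ∏ˡ θ₃₀ rs) ⊛ (A ⊛ B)
    ≈⟨ ⊛-cong p ≈-refl ⟩
  ∏ˡ η bs ⊛ (A ⊛ B)
    ≈⟨ solve 3 (λ h a b → h :* (a :* b) := con 1 :* (h :* b :* a)) ≈-refl (∏ˡ η bs) A B ⟩
  𝟙 ⊛ (∏ˡ η bs ⊛ B ⊛ A)
    ≈⟨ ⊛-congˡ 𝟙 (≈-trans (∏ˡ-++ θ₆₀ (map double bs) (pairs as)) (⊛-cong (≈-sym (η-pairs ib)) ≈-refl)) ⟨
  𝟙 ⊛ ∏ˡ θ₆₀ (map double bs ++ pairs as) ∎
  where
  open ≈-Reasoning
  A = ∏ˡ θ₆₀ (pairs as)
  B = ∏ˡ θ₆₀ (pairs bs)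

-- Three-term relations between monomials in theta functions

Monomial : Set
Monomial = ℕ × List ℕ

⟦_⟧ : Monomial → Series
⟦ d , rs ⟧ = qθ d rs

infixl 7 _·_
_·_ : Monomial → Monomial → Monomial
(d , rs) · (e , ss) = d + e , rs ++ ss

-- Monomials are kept as data with a normal form, so that the matching of cofactors in `combine` is
-- settled by `refl`.
normal : Monomial → Monomial
normal (d , rs) = d , Sort.sort rs

normal-≡⇒≈ : ∀ A B → normal A ≡ normal B → ⟦ A ⟧ ≈ ⟦ B ⟧
normal-≡⇒≈ (d , rs) (e , ss) p = qθ-≈ d rs e ss (cong proj₁ p) (cong proj₂ p)

record ThreeTerm (A B C : Monomial) : Set where
  constructor threeTerm
  field relation : ⟦ A ⟧ ⊕ ⟦ B ⟧ ≈ ⟦ C ⟧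
open ThreeTerm

commute : ∀ {A B C} → ThreeTerm A B C → ThreeTerm B A C
commute {A} {B} (threeTerm p) = threeTerm (≈-trans (+-comm ⟦ B ⟧ ⟦ A ⟧) p)

scale : ∀ M {A B C} → ThreeTerm A B C → ThreeTerm (M · A) (M · B) (M · C)
scale M@(d , rs) {A@(e , ss)} {B@(f , ts)} {C@(g , us)} (threeTerm p) = threeTerm (begin
  ⟦ M · A ⟧ ⊕ ⟦ M · B ⟧          ≈⟨ ⊕-cong (qθ-⊛ d rs e ss) (qθ-⊛ d rs f ts) ⟨
  ⟦ M ⟧ ⊛ ⟦ A ⟧ ⊕ ⟦ M ⟧ ⊛ ⟦ B ⟧  ≈⟨ distribˡ ⟦ M ⟧ ⟦ A ⟧ ⟦ B ⟧ ⟨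
  ⟦ M ⟧ ⊛ (⟦ A ⟧ ⊕ ⟦ B ⟧)        ≈⟨ ⊛-congˡ ⟦ M ⟧ p ⟩
  ⟦ M ⟧ ⊛ ⟦ C ⟧                  ≈⟨ qθ-⊛ d rs g us ⟩
  ⟦ M · C ⟧ ∎)
  where open ≈-Reasoning

-- From X = A + B, Y = A + C and B = C + Z, each up to a monomial factor, conclude X = Y + Z.
combine : ∀ N M₁ M₂ M₃ {X Y Z A₁ B₁ X₁ A₂ C₂ Y₂ C₃ Z₃ B₃} →
  ThreeTerm A₁ B₁ X₁ → ThreeTerm A₂ C₂ Y₂ → ThreeTerm C₃ Z₃ B₃ →
  normal ((0 , N) · X) ≡ normal (M₁ · X₁) →
  normal (M₁ · A₁) ≡ normal (M₂ · A₂) →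
  normal (M₂ · Y₂) ≡ normal ((0 , N) · Y) →
  normal (M₁ · B₁) ≡ normal (M₃ · B₃) →
  normal (M₃ · C₃) ≡ normal (M₂ · C₂) →
  normal (M₃ · Z₃) ≡ normal ((0 , N) · Z) →
  ThreeTerm Y Z X
combine N M₁ M₂ M₃ {X@(d , rs)} {Y@(e , ss)} {Z@(f , ts)} {A₁} {B₁} {X₁} {A₂} {C₂} {Y₂} {C₃} {Z₃} {B₃}
  r₁ r₂ r₃ eX eA eY eB eC eZ = threeTerm (≈-sym (unit-cancel (qθ 0 N) (qθ-unit N) (begin
  -- The three instances fit together only after multiplication by the product over `N`; its
  -- constant term is 1, so it can be cancelled at the end.
  qθ 0 N ⊛ ⟦ X ⟧                              ≈⟨ qθ-⊛ 0 N d rs ⟩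
  ⟦ (0 , N) · X ⟧                             ≈⟨ normal-≡⇒≈ ((0 , N) · X) (M₁ · X₁) eX ⟩
  ⟦ M₁ · X₁ ⟧                                 ≈⟨ relation (scale M₁ r₁) ⟨
  ⟦ M₁ · A₁ ⟧ ⊕ ⟦ M₁ · B₁ ⟧
    ≈⟨ ⊕-cong (normal-≡⇒≈ (M₁ · A₁) (M₂ · A₂) eA) (normal-≡⇒≈ (M₁ · B₁) (M₃ · B₃) eB) ⟩
  ⟦ M₂ · A₂ ⟧ ⊕ ⟦ M₃ · B₃ ⟧
    ≈⟨ ⊕-congˡ ⟦ M₂ · A₂ ⟧ (relation (scale M₃ r₃)) ⟨
  ⟦ M₂ · A₂ ⟧ ⊕ (⟦ M₃ · C₃ ⟧ ⊕ ⟦ M₃ · Z₃ ⟧)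
    ≈⟨ ⊕-congˡ ⟦ M₂ · A₂ ⟧ (⊕-cong (normal-≡⇒≈ (M₃ · C₃) (M₂ · C₂) eC)
         (normal-≡⇒≈ (M₃ · Z₃) ((0 , N) · Z) eZ)) ⟩
  ⟦ M₂ · A₂ ⟧ ⊕ (⟦ M₂ · C₂ ⟧ ⊕ ⟦ (0 , N) · Z ⟧)
    ≈⟨ +-assoc ⟦ M₂ · A₂ ⟧ ⟦ M₂ · C₂ ⟧ ⟦ (0 , N) · Z ⟧ ⟨
  ⟦ M₂ · A₂ ⟧ ⊕ ⟦ M₂ · C₂ ⟧ ⊕ ⟦ (0 , N) · Z ⟧
    ≈⟨ ⊕-cong (≈-trans (relation (scale M₂ r₂)) (normal-≡⇒≈ (M₂ · Y₂) ((0 , N) · Y) eY))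
              (≈-refl {⟦ (0 , N) · Z ⟧}) ⟩
  ⟦ (0 , N) · Y ⟧ ⊕ ⟦ (0 , N) · Z ⟧           ≈⟨ ⊕-cong (qθ-⊛ 0 N e ss) (qθ-⊛ 0 N f ts) ⟨
  qθ 0 N ⊛ ⟦ Y ⟧ ⊕ qθ 0 N ⊛ ⟦ Z ⟧             ≈⟨ distribˡ (qθ 0 N) ⟦ Y ⟧ ⟦ Z ⟧ ⟨
  qθ 0 N ⊛ (⟦ Y ⟧ ⊕ ⟦ Z ⟧) ∎)))
  where
  open ≈-Reasoning
  open CommutativeRing seriesRing using (+-assoc)

inRange? : Decidable InRange
inRange? r = (1 ℕₚ.≤? r) ×-dec (r ℕₚ.<? 30)

-- Phrased with `True`, so that at numerals the conditions reduce to unit types and are filled in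
-- silently.
Admissible : ℕ → (v d₃ d₂ d₁ x′ : ℕ) → Set
Admissible M v d₃ d₂ d₁ x′ =
  True (v + double d₃ + double d₂ + double d₁ + x′ ℕₚ.≟ M) ×
  True (all? (1 ℕₚ.≤?_) (v ∷ d₃ ∷ d₂ ∷ d₁ ∷ x′ ∷ []))

relation₆₀ : ∀ v d₃ d₂ d₁ x′ → {Admissible 60 v d₃ d₂ d₁ x′} →
  ThreeTerm (d₂ , residues₁ v d₃ d₂ d₁ x′) (0 , residues₂ v d₃ d₂ d₁ x′)
            (0 , residues₃ v d₃ d₂ d₁ x′)
relation₆₀ v d₃ d₂ d₁ x′ {s , p} with a ∷ b ∷ c ∷ d ∷ e ∷ [] ← toWitness p =
  threeTerm (weierstrass₆₀ v d₃ d₂ d₁ x′ (toWitness s) a b c d e)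

relation₃₀ : ∀ v d₃ d₂ d₁ x′ → {Admissible 30 v d₃ d₂ d₁ x′} →
  {True (all? inRange? (residues₁ v d₃ d₂ d₁ x′))} →
  {True (all? inRange? (residues₂ v d₃ d₂ d₁ x′))} →
  {True (all? inRange? (residues₃ v d₃ d₂ d₁ x′))} →
  let as = residues₁ v d₃ d₂ d₁ x′
      rs = residues₂ v d₃ d₂ d₁ x′
      bs = residues₃ v d₃ d₂ d₁ x′
  in ThreeTerm (d₂ , map double as ++ pairs bs) (0 , pairs rs ++ pairs as ++ pairs bs)
               (0 , map double bs ++ pairs as)
relation₃₀ v d₃ d₂ d₁ x′ {s , p} {ia} {ir} {ib} with a ∷ b ∷ c ∷ d ∷ e ∷ [] ← toWitness p =
  threeTerm (clear-η {d = d₂} {bs = residues₃ v d₃ d₂ d₁ x′} (toWitness ia) (toWitness ir) (toWitness ib)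
    (weierstrass-fold v d₃ d₂ d₁ x′ Sign.+ 30 (toWitness s) a b c d e))

-- The four theta identities

S₁ S₂ S₃ S₄ T₁ T₂ T₃ T₄ : List ℕ
S₁ = 1 ∷ 4 ∷ 7 ∷ 10 ∷ 11 ∷ 13 ∷ 17 ∷ 18 ∷ 19 ∷ 24 ∷ 25 ∷ 27 ∷ []
T₁ = 1 ∷ 3 ∷ 7 ∷ 10 ∷ 11 ∷ 16 ∷ 17 ∷ 18 ∷ 23 ∷ 24 ∷ 25 ∷ 29 ∷ []
S₂ = 1 ∷ 5 ∷ 6 ∷ 7 ∷ 8 ∷ 10 ∷ 11 ∷ 12 ∷ 17 ∷ 19 ∷ 21 ∷ 23 ∷ []
T₂ = 1 ∷ 5 ∷ 6 ∷ 7 ∷ 9 ∷ 10 ∷ 11 ∷ 12 ∷ 13 ∷ 17 ∷ 28 ∷ 29 ∷ []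
S₃ = 6 ∷ 7 ∷ 8 ∷ 9 ∷ 10 ∷ 11 ∷ 12 ∷ 13 ∷ 19 ∷ 23 ∷ 25 ∷ 29 ∷ []
T₃ = 1 ∷ 6 ∷ 10 ∷ 12 ∷ 13 ∷ 17 ∷ 19 ∷ 21 ∷ 23 ∷ 25 ∷ 28 ∷ 29 ∷ []
S₄ = 3 ∷ 4 ∷ 5 ∷ 10 ∷ 11 ∷ 13 ∷ 17 ∷ 18 ∷ 19 ∷ 23 ∷ 24 ∷ 29 ∷ []
T₄ = 1 ∷ 5 ∷ 7 ∷ 10 ∷ 13 ∷ 16 ∷ 18 ∷ 19 ∷ 23 ∷ 24 ∷ 27 ∷ 29 ∷ []

-- The points of the three instances and the cofactors were found by a computer search among
-- relations between products of theta functions modulo the divisors of 60.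
identity₁ : ThreeTerm (1 , S₁) (0 , S₁ ++ T₁) (0 , T₁)
identity₁ = combine
  (6 ∷ 8 ∷ 12 ∷ 14 ∷ 20 ∷ 22 ∷ 23 ∷ 26 ∷ [])
  (0 , 1 ∷ 3 ∷ 6 ∷ 7 ∷ 8 ∷ 10 ∷ 11 ∷ 12 ∷ 14 ∷ 16 ∷ 17 ∷ 18 ∷ 23 ∷ 24 ∷ 25 ∷ 26 ∷ [])
  (1 , 1 ∷ 4 ∷ 6 ∷ 7 ∷ 8 ∷ 10 ∷ 11 ∷ 12 ∷ 13 ∷ 14 ∷ 17 ∷ 18 ∷ 23 ∷ 24 ∷ 25 ∷ 26 ∷ [])
  (0 , 1 ∷ 10 ∷ 11 ∷ 17 ∷ 18 ∷ 24 ∷ 25 ∷ 25 ∷ [])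
  (relation₆₀ 1 4 18 2 11)
  (relation₆₀ 1 2 17 5 11)
  (relation₃₀ 1 6 1 3 9)
  refl refl refl refl refl refl

-- The exponent 8 is the exceptional n of part (ii), where p(S, 8) = p(T, 8) + 1. In the two
-- instances modulo 60, `commute` puts the summand carrying the power of q second, as `combine`
-- expects.
identity₂ : ThreeTerm (0 , S₂) (8 , S₂ ++ T₂) (0 , T₂)
identity₂ = combine
  (2 ∷ 4 ∷ 18 ∷ 20 ∷ 22 ∷ 24 ∷ 25 ∷ 26 ∷ [])
  (0 , 1 ∷ 2 ∷ 4 ∷ 5 ∷ 6 ∷ 7 ∷ 10 ∷ 11 ∷ 12 ∷ 13 ∷ 17 ∷ 18 ∷ 24 ∷ 26 ∷ 28 ∷ 29 ∷ [])
  (0 , 1 ∷ 2 ∷ 4 ∷ 5 ∷ 6 ∷ 7 ∷ 8 ∷ 10 ∷ 11 ∷ 12 ∷ 17 ∷ 18 ∷ 21 ∷ 23 ∷ 24 ∷ 26 ∷ [])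
  (8 , 1 ∷ 5 ∷ 6 ∷ 7 ∷ 10 ∷ 11 ∷ 12 ∷ 17 ∷ [])
  (commute (relation₆₀ 2 12 8 1 16))
  (commute (relation₆₀ 1 6 13 9 3))
  (relation₃₀ 1 1 5 4 9)
  refl refl refl refl refl refl

identity₃ : ThreeTerm (6 , S₃) (0 , S₃ ++ T₃) (0 , T₃)
identity₃ = combine
  (2 ∷ 5 ∷ 14 ∷ 16 ∷ 18 ∷ 20 ∷ 22 ∷ 24 ∷ [])
  (0 , 1 ∷ 2 ∷ 5 ∷ 6 ∷ 10 ∷ 12 ∷ 13 ∷ 14 ∷ 16 ∷ 19 ∷ 20 ∷ 22 ∷ 23 ∷ 25 ∷ 28 ∷ 29 ∷ [])
  (6 , 2 ∷ 6 ∷ 7 ∷ 8 ∷ 10 ∷ 11 ∷ 12 ∷ 13 ∷ 14 ∷ 16 ∷ 19 ∷ 20 ∷ 22 ∷ 23 ∷ 25 ∷ 29 ∷ [])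
  (0 , 6 ∷ 10 ∷ 12 ∷ 13 ∷ 19 ∷ 23 ∷ 25 ∷ 29 ∷ [])
  (relation₆₀ 1 7 10 11 3)
  (relation₆₀ 4 1 4 14 18)
  (relation₃₀ 1 1 6 5 5)
  refl refl refl refl refl refl

identity₄ : ThreeTerm (3 , S₄) (0 , S₄ ++ T₄) (0 , T₄)
identity₄ = combine
  (2 ∷ 6 ∷ 6 ∷ 12 ∷ 17 ∷ 20 ∷ 25 ∷ 26 ∷ 28 ∷ [])
  (0 , 1 ∷ 2 ∷ 5 ∷ 6 ∷ 10 ∷ 12 ∷ 13 ∷ 16 ∷ 17 ∷ 18 ∷ 19 ∷ 20 ∷ 23 ∷ 24 ∷ 26 ∷ 27 ∷ 29 ∷ [])
  (3 , 2 ∷ 3 ∷ 4 ∷ 5 ∷ 6 ∷ 10 ∷ 12 ∷ 13 ∷ 17 ∷ 18 ∷ 19 ∷ 20 ∷ 23 ∷ 24 ∷ 25 ∷ 26 ∷ 29 ∷ [])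
  (0 , 3 ∷ 5 ∷ 10 ∷ 16 ∷ 18 ∷ 19 ∷ 23 ∷ 27 ∷ 29 ∷ [])
  (relation₆₀ 1 3 3 22 3)
  (commute (relation₆₀ 5 5 1 16 11))
  (relation₃₀ 1 1 4 6 7)
  refl refl refl refl refl refl

-- Generating functions of partitions

partitions≤ : PosSet → ℕ → Series
partitions≤ S k n = + pLe S k n

partitions : PosSet → Series
partitions S n = + p S n

module _ (g : ℕ → ℕ) (k : ℕ) where
  private
    e : ℕ
    e = suc k

  -- Literally the summand inside `pLe`, with g for `pLe S k`, so that `pLe-member` holds by
  -- computation.
  summand : ℕ → ℕ → ℕ
  summand n j = if (j * e) ≤ᵇ n then g (n ∸ j * e) else 0

  private
    <⇒≤ᵇ-false : ∀ m n → n < m → (m ≤ᵇ n) ≡ false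
    <⇒≤ᵇ-false (suc m)       zero    l       = refl
    <⇒≤ᵇ-false (suc zero)    (suc n) (s≤s ())
    <⇒≤ᵇ-false (suc (suc m)) (suc n) (s≤s l) = <⇒≤ᵇ-false (suc m) n l

    ≤ᵇ-suc : ∀ m n → (suc m ≤ᵇ suc n) ≡ (m ≤ᵇ n)
    ≤ᵇ-suc zero    n = refl
    ≤ᵇ-suc (suc m) n = refl

    ≤ᵇ-+ : ∀ c m n → (c + m ≤ᵇ c + n) ≡ (m ≤ᵇ n)
    ≤ᵇ-+ zero    m n = refl
    ≤ᵇ-+ (suc c) m n = trans (≤ᵇ-suc (c + m) (c + n)) (≤ᵇ-+ c m n)

    summand-0 : ∀ n j → n < j * e → summand n j ≡ 0
    summand-0 n j l rewrite <⇒≤ᵇ-false (j * e) n l = refl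

    summand-suc : ∀ m j → summand (e + m) (suc j) ≡ summand m j
    summand-suc m j rewrite ≤ᵇ-+ e (j * e) m | ℕₚ.[m+n]∸[m+o]≡n∸o e m (j * e) = refl

    sumUpTo-cong : ∀ {f h} m → (∀ j → f j ≡ h j) → sumUpTo m f ≡ sumUpTo m h
    sumUpTo-cong zero    p = p 0
    sumUpTo-cong (suc m) p = cong₂ _+_ (sumUpTo-cong m p) (p (suc m))

    sumUpTo-suc : ∀ m f → sumUpTo (suc m) f ≡ f 0 + sumUpTo m (f ∘ suc)
    sumUpTo-suc zero    f = refl
    sumUpTo-suc (suc m) f = trans (cong (_+ f (suc (suc m))) (sumUpTo-suc m f))
      (ℕₚ.+-assoc (f 0) _ _)

    sumUpTo-zeros : ∀ m d f → (∀ j → m < j → f j ≡ 0) → sumUpTo (d + m) f ≡ sumUpTo m f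
    sumUpTo-zeros m zero    f p = refl
    sumUpTo-zeros m (suc d) f p = trans
      (cong₂ _+_ (sumUpTo-zeros m d f p) (p (suc (d + m)) (s≤s (ℕₚ.m≤n+m m d))))
      (ℕₚ.+-identityʳ _)

  sumUpTo-small : ∀ n → n < e → sumUpTo n (summand n) ≡ g n
  sumUpTo-small n l = trans
    (cong (λ x → sumUpTo x (summand n)) (sym (ℕₚ.+-identityʳ n)))
    (sumUpTo-zeros 0 n (summand n) λ
      { (suc j) _ → summand-0 n (suc j) (ℕₚ.<-≤-trans l (ℕₚ.m≤m+n e (j * e))) })

  -- Multiplicity 0 gives the first summand; for positive multiplicity one copy of e is removed,
  -- leaving m. The terms with j > m are zero because j e ≥ j.
  sumUpTo-large : ∀ m → sumUpTo (e + m) (summand (e + m)) ≡ g (e + m) + sumUpTo m (summand m)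
  sumUpTo-large m = trans (sumUpTo-suc (k + m) (summand (e + m)))
    (cong (λ x → g (e + m) + x) (trans (sumUpTo-cong (k + m) (summand-suc m))
      (sumUpTo-zeros m k (summand m) λ j m<j →
        summand-0 m j (ℕₚ.<-≤-trans m<j (ℕₚ.m≤m*n j e)))))

pLe-member : ∀ S k n → S (suc k) ≡ true → pLe S (suc k) n ≡ sumUpTo n (summand (pLe S k) k n)
pLe-member S k n p rewrite p = refl

pLe-nonmember : ∀ S k n → S (suc k) ≡ false → pLe S (suc k) n ≡ pLe S k n
pLe-nonmember S k n p rewrite p = refl

pLe-small : ∀ S k n → n ≤ k → pLe S (suc k) n ≡ pLe S k n
pLe-small S k n l with S (suc k)
... | true  = sumUpTo-small (pLe S k) k n (s≤s l)
... | false = refl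

pLe-stable : ∀ S d n → pLe S (d + n) n ≡ p S n
pLe-stable S zero    n = refl
pLe-stable S (suc d) n = trans (pLe-small S (d + n) n (ℕₚ.m≤n+m n d)) (pLe-stable S d n)

q^-⊛-+ : ∀ e a m → (q^ e ⊛ a) (e + m) ≡ a m
q^-⊛-+ zero    a m = 𝟙-⊛ a m
q^-⊛-+ (suc e) a m = trans (shift-⊛ (q^ e) a (suc (e + m))) (q^-⊛-+ e a m)

-- A partition either avoids the part k + 1 or is obtained by adding one copy of it.
partitions≤-member : ∀ S k → S (suc k) ≡ true →
  partitions≤ S (suc k) ≈ partitions≤ S k ⊕ q^ suc k ⊛ partitions≤ S (suc k)
partitions≤-member S k p = coeffs go
  where
  go : ∀ n → partitions≤ S (suc k) n ≡
             partitions≤ S k n +ᶻ (q^ suc k ⊛ partitions≤ S (suc k)) n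
  go n with suc k ℕₚ.≤? n
  ... | no k≰n = trans
    (cong +_ (trans (pLe-member S k n p) (sumUpTo-small (pLe S k) k n (ℕₚ.≰⇒> k≰n))))
    (sym (trans (cong (+ pLe S k n +ᶻ_) (q^-⊛-< (suc k) (partitions≤ S (suc k)) (ℕₚ.≰⇒> k≰n)))
      (ℤₚ.+-identityʳ _)))
  ... | yes k≤n = subst (λ n → partitions≤ S (suc k) n ≡
      partitions≤ S k n +ᶻ (q^ suc k ⊛ partitions≤ S (suc k)) n) (ℕₚ.m+[n∸m]≡n k≤n) (large (n ∸ suc k))
    where
    large : ∀ m → partitions≤ S (suc k) (suc k + m) ≡
      partitions≤ S k (suc k + m) +ᶻ (q^ suc k ⊛ partitions≤ S (suc k)) (suc k + m)
    large m = begin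
      + pLe S (suc k) (suc k + m)
        ≡⟨ cong +_ (trans (pLe-member S k (suc k + m) p) (sumUpTo-large (pLe S k) k m)) ⟩
      + pLe S k (suc k + m) +ᶻ + sumUpTo m (summand (pLe S k) k m)
        ≡⟨ cong (λ x → + pLe S k (suc k + m) +ᶻ + x) (pLe-member S k m p) ⟨
      + pLe S k (suc k + m) +ᶻ + pLe S (suc k) m
        ≡⟨ cong (+ pLe S k (suc k + m) +ᶻ_) (q^-⊛-+ (suc k) (partitions≤ S (suc k)) m) ⟨
      partitions≤ S k (suc k + m) +ᶻ (q^ suc k ⊛ partitions≤ S (suc k)) (suc k + m) ∎
      where open ≡-Reasoning

select : PosSet → (ℕ → Series) → ℕ → Series
select S f j = if S j then f j else 𝟙

part-factor : PosSet → ℕ → Series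
part-factor S i = select S (factor Sign.-) (suc i)

partitions≤-step : ∀ S k → partitions≤ S (suc k) ⊛ part-factor S k ≈ partitions≤ S k
partitions≤-step S k = by-membership (S (suc k)) refl
  where
  open ≈-Reasoning
  open CommutativeRing seriesRing using (-‿inverseʳ; +-assoc)
  G G′ : Series
  G  = partitions≤ S k
  G′ = partitions≤ S (suc k)
  selected : ∀ {b} → S (suc k) ≡ b →
    part-factor S k ≡ (if b then factor Sign.- (suc k) else 𝟙)
  selected p = cong (λ b → if b then factor Sign.- (suc k) else 𝟙) p
  by-membership : ∀ b → S (suc k) ≡ b → G′ ⊛ part-factor S k ≈ G
  by-membership false p = begin
    G′ ⊛ part-factor S k  ≡⟨ cong (G′ ⊛_) (selected p) ⟩
    G′ ⊛ 𝟙                ≈⟨ *-identityʳ G′ ⟩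
    G′                    ≈⟨ coeffs (λ n → cong +_ (pLe-nonmember S k n p)) ⟩
    G ∎
  by-membership true p = begin
    G′ ⊛ part-factor S k
      ≡⟨ cong (G′ ⊛_) (selected p) ⟩
    G′ ⊛ (𝟙 ⊕ m ⊛ q)
      ≈⟨ solve 3 (λ g m q → g :* (con 1 :+ m :* q) := g :+ m :* (q :* g)) ≈-refl G′ m q ⟩
    G′ ⊕ m ⊛ (q ⊛ G′)
      ≈⟨ ⊕-cong {b = m ⊛ (q ⊛ G′)} (partitions≤-member S k p) ≈-refl ⟩
    G ⊕ q ⊛ G′ ⊕ m ⊛ (q ⊛ G′)
      ≈⟨ solve 3 (λ g m x → g :+ x :+ m :* x := g :+ (con 1 :+ m) :* x) ≈-refl G m (q ⊛ G′) ⟩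
    G ⊕ (𝟙 ⊕ m) ⊛ (q ⊛ G′)
      ≈⟨ ⊕-congˡ G (≈-trans (⊛-cong (-‿inverseʳ 𝟙) ≈-refl) (zeroˡ (q ⊛ G′))) ⟩
    G ⊕ 𝟘
      ≈⟨ +-identityʳ G ⟩
    G ∎
    where
    m = sgn Sign.-
    q = q^ suc k

partitions≤-product : ∀ S k → partitions≤ S k ⊛ ∏< (part-factor S) k ≈ 𝟙
partitions≤-product S zero    = ≈-trans (*-identityʳ (partitions≤ S 0))
  (coeffs λ { zero → refl ; (suc n) → refl })
partitions≤-product S (suc k) = begin
  partitions≤ S (suc k) ⊛ (∏< (part-factor S) k ⊛ part-factor S k)
    ≈⟨ solve 3 (λ g P f → g :* (P :* f) := (g :* f) :* P) ≈-refl
         (partitions≤ S (suc k)) (∏< (part-factor S) k) (part-factor S k) ⟩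
  (partitions≤ S (suc k) ⊛ part-factor S k) ⊛ ∏< (part-factor S) k
    ≈⟨ ⊛-cong (partitions≤-step S k) ≈-refl ⟩
  partitions≤ S k ⊛ ∏< (part-factor S) k
    ≈⟨ partitions≤-product S k ⟩
  𝟙 ∎
  where open ≈-Reasoning

Tame-part-factor : ∀ S → Tame (part-factor S)
Tame-part-factor S k with S (suc k)
... | true  = Tame-factor {Sign.-} {suc} ℕₚ.n<1+n k
... | false = ≈[]-refl

partitions-product : ∀ S → partitions S ⊛ ∏∞ (part-factor S) ≈ 𝟙
partitions-product S = ≈[]⇒≈ λ N → ≈[]-trans
  (⊛-cong[] (coeffs≤ λ i i≤N → cong +_
      (sym (subst (λ m → pLe S m i ≡ p S i) (ℕₚ.m∸n+n≡m i≤N) (pLe-stable S (N ∸ i) i))))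
    (∏∞-approx (Tame-part-factor S) ℕₚ.≤-refl))
  (≈⇒≈[] (partitions≤-product S N))

-- Grouping the parts by residue modulo 60

∏<-+ : ∀ f m n → ∏< f (m + n) ≈ ∏< f m ⊛ ∏< (λ i → f (m + i)) n
∏<-+ f m zero    rewrite ℕₚ.+-identityʳ m = ≈-sym (*-identityʳ (∏< f m))
∏<-+ f m (suc n) rewrite ℕₚ.+-suc m n =
  ≈-trans (⊛-cong (∏<-+ f m n) ≈-refl) (*-assoc (∏< f m) _ (f (m + n)))

∏<-blocks : ∀ f b n → ∏< f (n * b) ≈ ∏< (λ k → ∏< (λ i → f (k * b + i)) b) n
∏<-blocks f b zero    = ≈-refl
∏<-blocks f b (suc n) rewrite ℕₚ.+-comm b (n * b) =
  ≈-trans (∏<-+ f (n * b) b) (⊛-cong (∏<-blocks f b n) ≈-refl)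

∏∞-blocks : ∀ {f} → Tame f → ∀ b → 1 ≤ b → ∏∞ f ≈ ∏∞ (λ k → ∏< (λ i → f (k * b + i)) b)
∏∞-blocks {f} t b b≥1 = coeffs λ n → trans
  (coeff≤ (∏∞-approx t (ℕₚ.m≤m*n n b {{ℕ.>-nonZero b≥1}})) n ℕₚ.≤-refl)
  (coeff (∏<-blocks f b n) n)

members : PosSet → ℕ → List ℕ
members S zero    = []
members S (suc m) = if S (suc m) then suc m ∷ members S m else members S m

∏<-members : ∀ S f m → ∏< (λ i → select S f (suc i)) m ≈ ∏ˡ f (members S m)
∏<-members S f zero    = ≈-refl
∏<-members S f (suc m) with S (suc m)
... | true  = ≈-trans (*-comm _ (f (suc m))) (⊛-congˡ (f (suc m)) (∏<-members S f m))
... | false = ≈-trans (*-identityʳ _) (∏<-members S f m)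

mirror : List ℕ → List ℕ
mirror []       = []
mirror (r ∷ rs) = r ∷ 60 ∸ r ∷ mirror rs

Residue : ℕ → Set
Residue r = 1 ≤ r × r < 60

residue? : Decidable Residue
residue? r = (1 ℕₚ.≤? r) ×-dec (r ℕₚ.<? 60)

∏ˡ-mirror : ∀ k {rs} → All Residue rs →
  ∏ˡ (λ j → factor Sign.- (k * 60 + j)) (mirror rs) ≈ ∏ˡ (λ r → θ-block Sign.- r (60 ∸ r) k) rs
∏ˡ-mirror k []                           = ≈-refl
∏ˡ-mirror k {r ∷ rs} ((r≥1 , r<60) ∷ is) = ≈-trans
  (≈-sym (*-assoc (factor Sign.- (k * 60 + r)) (factor Sign.- (k * 60 + (60 ∸ r))) _))
  (⊛-cong (≡⇒≈ (cong (λ M → factor Sign.- (k * M + r) ⊛ factor Sign.- (k * M + (60 ∸ r)))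
    (sym (ℕₚ.m+[n∸m]≡n (ℕₚ.<⇒≤ r<60))))) (∏ˡ-mirror k is))

Tame-θ₆₀ : ∀ {r} → Residue r → Tame (θ-block Sign.- r (60 ∸ r))
Tame-θ₆₀ (r≥1 , r<60) = Tame-θ Sign.- r≥1 (ℕₚ.m<n⇒0<n∸m r<60)

Tame-∏ˡ : ∀ {rs} → All Residue rs → Tame (λ k → ∏ˡ (λ r → θ-block Sign.- r (60 ∸ r) k) rs)
Tame-∏ˡ []       k = ≈[]-refl
Tame-∏ˡ (i ∷ is) = Tame-⊛ (Tame-θ₆₀ i) (Tame-∏ˡ is)

∏∞-∏ˡ : ∀ {rs} → All Residue rs →
  ∏∞ (λ k → ∏ˡ (λ r → θ-block Sign.- r (60 ∸ r) k) rs) ≈ ∏ˡ θ₆₀ rs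
∏∞-∏ˡ []            = coeffs λ n → coeff (ones n) n
  where
  ones : ∀ n → ∏< (λ _ → 𝟙) n ≈ 𝟙
  ones zero    = ≈-refl
  ones (suc n) = ≈-trans (*-identityʳ _) (ones n)
∏∞-∏ˡ {r ∷ rs} (i ∷ is) = ≈-trans (∏∞-⊛ (Tame-θ₆₀ i) (Tame-∏ˡ is)) (⊛-congˡ (θ₆₀ r) (∏∞-∏ˡ is))

pmSet60-periodic : ∀ rs i k → pmSet60 rs (suc i + k * 60) ≡ pmSet60 rs (suc i)
pmSet60-periodic []       i k = refl
pmSet60-periodic (r ∷ rs) i k = cong₂ _∨_
  (cong₂ _∨_
    (cong (_≡ᵇ r % 60) ([m+kn]%n≡m%n (suc i) k 60))
    (cong (_≡ᵇ 0) (trans (cong (_% 60) (arith (suc i) (k * 60) r)) ([m+kn]%n≡m%n (suc i + r) k 60))))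
  (pmSet60-periodic rs i k)
  where
  arith : ∀ x y z → x + y + z ≡ x + z + y
  arith = ℕSolver.solve-∀

-- Block k of the product covers the parts 60k + 1, ..., 60k + 60, and by periodicity all blocks
-- select the same residues. The hypothesis on sorted lists, an evaluation for given `rs`, says that
-- these are the r and 60 - r, each counted once.
part-product : ∀ rs → All Residue rs → Sort.sort (members (pmSet60 rs) 60) ≡ Sort.sort (mirror rs) →
  ∏∞ (part-factor (pmSet60 rs)) ≈ ∏ˡ θ₆₀ rs
part-product rs is e = begin
  ∏∞ (part-factor S)
    ≈⟨ ∏∞-blocks (Tame-part-factor S) 60 (s≤s z≤n) ⟩
  ∏∞ (λ k → ∏< (λ i → part-factor S (k * 60 + i)) 60)
    ≈⟨ ∏∞-cong (λ k → begin
         ∏< (λ i → part-factor S (k * 60 + i)) 60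
           ≈⟨ ∏<-cong (shifted k) 60 ⟩
         ∏< (λ i → select S (λ j → factor Sign.- (k * 60 + j)) (suc i)) 60
           ≈⟨ ∏<-members S (λ j → factor Sign.- (k * 60 + j)) 60 ⟩
         ∏ˡ (λ j → factor Sign.- (k * 60 + j)) (members S 60)
           ≈⟨ ∏ˡ-↭ (λ j → factor Sign.- (k * 60 + j)) (sort-≡⇒↭ {members S 60} {mirror rs} e) ⟩
         ∏ˡ (λ j → factor Sign.- (k * 60 + j)) (mirror rs)
           ≈⟨ ∏ˡ-mirror k is ⟩
         ∏ˡ (λ r → θ-block Sign.- r (60 ∸ r) k) rs ∎) ⟩
  ∏∞ (λ k → ∏ˡ (λ r → θ-block Sign.- r (60 ∸ r) k) rs)
    ≈⟨ ∏∞-∏ˡ is ⟩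
  ∏ˡ θ₆₀ rs ∎
  where
  open ≈-Reasoning
  S = pmSet60 rs
  shifted : ∀ k i → part-factor S (k * 60 + i) ≈ select S (λ j → factor Sign.- (k * 60 + j)) (suc i)
  shifted k i = ≡⇒≈ (cong₂ (λ b j → if b then factor Sign.- j else 𝟙)
    (trans (cong (λ x → S (suc x)) (ℕₚ.+-comm (k * 60) i)) (pmSet60-periodic rs i k))
    (sym (ℕₚ.+-suc (k * 60) i)))

-- From theta identities to partition numbers

-- Multiplying the three-term relation by both generating functions g and h leaves g = q^k h + q^l,
-- and q^l touches the coefficient of index l only. Keeping k and l as parameters covers all four
-- parts.
shifted-partitions : ∀ {k l} (R Q : List ℕ) → ThreeTerm (k , R) (l , R ++ Q) (0 , Q) →
  ∏∞ (part-factor (pmSet60 R)) ≈ ∏ˡ θ₆₀ R → ∏∞ (part-factor (pmSet60 Q)) ≈ ∏ˡ θ₆₀ Q →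
  ∀ n → k ≤ n → n ≢ l → p (pmSet60 R) n ≡ p (pmSet60 Q) (n ∸ k)
shifted-partitions {k} {l} R Q rel eR eQ n k≤n n≢l = ℤₚ.+-injective (begin
  g n                           ≡⟨ coeff series n ⟩
  (q^ k ⊛ h) n +ᶻ (q^ l) n      ≡⟨ cong₂ _+ᶻ_ (shifted n k≤n) (q^-≢ l n n≢l) ⟩
  h (n ∸ k) +ᶻ 0ℤ               ≡⟨ ℤₚ.+-identityʳ (h (n ∸ k)) ⟩
  h (n ∸ k) ∎)
  where
  open ≡-Reasoning
  g h r s : Series
  g = partitions (pmSet60 R)
  h = partitions (pmSet60 Q)
  r = ∏ˡ θ₆₀ R
  s = ∏ˡ θ₆₀ Q
  gr≈𝟙 : g ⊛ r ≈ 𝟙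
  gr≈𝟙 = ≈-trans (⊛-congˡ g (≈-sym eR)) (partitions-product (pmSet60 R))
  hs≈𝟙 : h ⊛ s ≈ 𝟙
  hs≈𝟙 = ≈-trans (⊛-congˡ h (≈-sym eQ)) (partitions-product (pmSet60 Q))
  shifted : ∀ n → k ≤ n → (q^ k ⊛ h) n ≡ h (n ∸ k)
  shifted n k≤n = subst (λ m → (q^ k ⊛ h) m ≡ h (n ∸ k)) (ℕₚ.m+[n∸m]≡n k≤n) (q^-⊛-+ k h (n ∸ k))
  q^-≢ : ∀ l n → n ≢ l → (q^ l) n ≡ 0ℤ
  q^-≢ zero    zero    n≢l = contradiction refl n≢l
  q^-≢ zero    (suc n) n≢l = refl
  q^-≢ (suc l) zero    n≢l = refl
  q^-≢ (suc l) (suc n) n≢l = q^-≢ l n (n≢l ∘ cong suc)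
  module ≈R = ≈-Reasoning
  series : g ≈ q^ k ⊛ h ⊕ q^ l
  series = ≈R.begin
    g                                         ≈R.≈⟨ ≈-trans (⊛-congˡ g hs≈𝟙) (*-identityʳ g) ⟨
    g ⊛ (h ⊛ s)                               ≈R.≈⟨ ⊛-congˡ g (⊛-congˡ h (*-identityˡ s)) ⟨
    g ⊛ (h ⊛ qθ 0 Q)                          ≈R.≈⟨ ⊛-congˡ g (⊛-congˡ h (relation rel)) ⟨
    g ⊛ (h ⊛ (q^ k ⊛ r ⊕ q^ l ⊛ ∏ˡ θ₆₀ (R ++ Q)))
      ≈R.≈⟨ ⊛-congˡ g (⊛-congˡ h (⊕-congˡ (q^ k ⊛ r) (⊛-congˡ (q^ l) (∏ˡ-++ θ₆₀ R Q)))) ⟩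
    g ⊛ (h ⊛ (q^ k ⊛ r ⊕ q^ l ⊛ (r ⊛ s)))
      ≈R.≈⟨ solve 6 (λ g h x r y s → g :* (h :* (x :* r :+ y :* (r :* s))) :=
           x :* h :* (g :* r) :+ y :* ((g :* r) :* (h :* s))) ≈-refl g h (q^ k) r (q^ l) s ⟩
    q^ k ⊛ h ⊛ (g ⊛ r) ⊕ q^ l ⊛ ((g ⊛ r) ⊛ (h ⊛ s))
      ≈R.≈⟨ ⊕-cong (⊛-congˡ (q^ k ⊛ h) gr≈𝟙) (⊛-congˡ (q^ l) (⊛-cong gr≈𝟙 hs≈𝟙)) ⟩
    q^ k ⊛ h ⊛ 𝟙 ⊕ q^ l ⊛ (𝟙 ⊛ 𝟙)
      ≈R.≈⟨ solve 2 (λ x y → x :* con 1 :+ y :* (con 1 :* con 1) := x :+ y) ≈-refl (q^ k ⊛ h) (q^ l) ⟩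
    q^ k ⊛ h ⊕ q^ l ≈R.∎

residue-product : ∀ rs → {True (all? residue? rs)} →
  Sort.sort (members (pmSet60 rs) 60) ≡ Sort.sort (mirror rs) →
  ∏∞ (part-factor (pmSet60 rs)) ≈ ∏ˡ θ₆₀ rs
residue-product rs {is} = part-product rs (toWitness is)

theorem12p7 : ((n : ℕ) → 1 ≤ n →
    p (pmSet60 (1 ∷ 4 ∷ 7 ∷ 10 ∷ 11 ∷ 13 ∷ 17 ∷ 18 ∷ 19 ∷ 24 ∷ 25 ∷ 27 ∷ [])) n
    ≡ p (pmSet60 (1 ∷ 3 ∷ 7 ∷ 10 ∷ 11 ∷ 16 ∷ 17 ∷ 18 ∷ 23 ∷ 24 ∷ 25 ∷ 29 ∷ [])) (n ∸ 1))
    × ((n : ℕ) → n ≢ 8 →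
    p (pmSet60 (1 ∷ 5 ∷ 6 ∷ 7 ∷ 8 ∷ 10 ∷ 11 ∷ 12 ∷ 17 ∷ 19 ∷ 21 ∷ 23 ∷ [])) n
    ≡ p (pmSet60 (1 ∷ 5 ∷ 6 ∷ 7 ∷ 9 ∷ 10 ∷ 11 ∷ 12 ∷ 13 ∷ 17 ∷ 28 ∷ 29 ∷ [])) n)
    × ((n : ℕ) → 6 ≤ n →
    p (pmSet60 (6 ∷ 7 ∷ 8 ∷ 9 ∷ 10 ∷ 11 ∷ 12 ∷ 13 ∷ 19 ∷ 23 ∷ 25 ∷ 29 ∷ [])) n
    ≡ p (pmSet60 (1 ∷ 6 ∷ 10 ∷ 12 ∷ 13 ∷ 17 ∷ 19 ∷ 21 ∷ 23 ∷ 25 ∷ 28 ∷ 29 ∷ [])) (n ∸ 6))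
    × ((n : ℕ) → 3 ≤ n →
    p (pmSet60 (3 ∷ 4 ∷ 5 ∷ 10 ∷ 11 ∷ 13 ∷ 17 ∷ 18 ∷ 19 ∷ 23 ∷ 24 ∷ 29 ∷ [])) n
    ≡ p (pmSet60 (1 ∷ 5 ∷ 7 ∷ 10 ∷ 13 ∷ 16 ∷ 18 ∷ 19 ∷ 23 ∷ 24 ∷ 27 ∷ 29 ∷ [])) (n ∸ 3))
theorem12p7 =
    -- In (i), (iii) and (iv) the exceptional index is l = 0, which the lower bound on n rules out;
    -- in (ii) k = 0 and l = 8.
    (λ n 1≤n → shifted-partitions S₁ T₁ identity₁ (residue-product S₁ refl) (residue-product T₁ refl)
       n 1≤n (positive 1≤n))
  , (λ n n≢8 → shifted-partitions S₂ T₂ identity₂ (residue-product S₂ refl) (residue-product T₂ refl)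
       n z≤n n≢8)
  , (λ n 6≤n → shifted-partitions S₃ T₃ identity₃ (residue-product S₃ refl) (residue-product T₃ refl)
       n 6≤n (positive 6≤n))
  , (λ n 3≤n → shifted-partitions S₄ T₄ identity₄ (residue-product S₄ refl) (residue-product T₄ refl)
       n 3≤n (positive 3≤n))
  where
  positive : ∀ {m n} → suc m ≤ n → n ≢ 0
  positive (s≤s _) ()
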